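{- Let $\mathtt{s1}$ and $\mathtt{s2}$ be two closed terms of type $\mathtt{A}$ with $\mathtt{s1}\neq_{\beta\eta c}\mathtt{s2}$. Let $\mathtt{r1}$ and $\mathtt{r2}$ be closed terms of type $\mathtt{A0}$, and let $\mathtt{u1}$ and $\mathtt{u2}$ be two different closed terms, each poly-typable by $\mathtt{A0\to B}$ with respect to $\mathtt{r1}$ and with respect to $\mathtt{r2}$, such that the set $\{\mathtt{u1\,r1},\ \mathtt{u1\,r2},\ \mathtt{u2\,r1},\ \mathtt{u2\,r2}\}$ consists of one or two closed terms of type $\mathtt{B}$ (up to $=_{\beta\eta c}$). Then there is a closed term $\mathtt{t}$ that is poly-typable by $\mathtt{A\to A0\to B}$ (with respect to $\mathtt{sj},\mathtt{ri}$ for $i,j\in\{1,2\}$) such that for each $i\in\{1,2\}$ \[ \mathtt{t\,s1\,ri} =_{\beta\eta c} \mathtt{u1\,ri} \quad\text{and}\quad \mathtt{t\,s2\,ri} =_{\beta\eta c} \mathtt{u2\,ri}. \]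
   Context: Linear $\lambda$-calculus in ML-like notation. Types: $\mathtt{A} ::= \mathtt{'a} \mid \mathtt{A1 * A2} \mid \mathtt{A1 \to A2}$ ($\mathtt{'a}$ type variables, $*$ tensor, $\to$ linear implication). Terms: $\mathtt{t} ::= \mathtt{x} \mid \mathtt{t}\,\mathtt{s} \mid \mathtt{fn\ x => t} \mid \mathtt{(s,t)} \mid \mathtt{let\ val\ (x,y)=s\ in\ t\ end}$. Typing judgements $\Gamma \vdash \mathtt{t:A}$ are derived by: $\mathtt{x:A}\vdash\mathtt{x:A}$; exchange; from $\mathtt{x:A},\Gamma\vdash \mathtt{t:B}$ infer $\Gamma\vdash\mathtt{fn\ x=>t : A\to B}$; from $\Gamma\vdash\mathtt{t:A\to B}$ and $\Delta\vdash\mathtt{s:A}$ infer $\Gamma,\Delta\vdash\mathtt{t\,s:B}$; from $\Gamma\vdash\mathtt{s:A}$ and $\Delta\vdash\mathtt{t:B}$ infer $\Gamma,\Delta\vdash\mathtt{(s,t):A*B}$; from $\Gamma\vdash\mathtt{s:A*B}$ and $\mathtt{x:A},\mathtt{y:B},\Delta\vdash\mathtt{t:C}$ infer $\Gamma,\Delta\vdash\mathtt{let\ val\ (x,y)=s\ in\ t\ end:C}$ ($\Gamma,\Delta$ disjoint lists of distinct variables). A closed term of type $\mathtt{A}$ is a term with $\vdash\mathtt{t:A}$ derivable. The equality $=_{\beta\eta c}$ is the least congruence on typed terms containing: $(\mathtt{fn\ x=>t})\,\mathtt{s} = \mathtt{t[s/x]}$; $\mathtt{let\ val\ (x,y)=(u,v)\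 in\ w\ end} = \mathtt{w[u/x,v/y]}$; $\mathtt{fn\ x=>(t\ x)} = \mathtt{t}$; $\mathtt{let\ val\ (x,y)=t\ in\ (x,y)\ end} = \mathtt{t}$; and $C[\mathtt{let\ val\ (x,y)=t\ in\ u\ end}] = \mathtt{let\ val\ (x,y)=t\ in}\ C[\mathtt{u}]\ \mathtt{end}$ for every one-hole context $C$ in which $\mathtt{x},\mathtt{y}$ are not free and whose binders capture no free variable of $\mathtt{t}$. Poly-typability: the principal type $\mathrm{PT}(\mathtt{t})$ of a typable term is a type $\mathtt{A}$ with $\Gamma\vdash\mathtt{t:A}$ derivable for some $\Gamma$ such that every derivable typing of $\mathtt{t}$ is a substitution instance of it. For closed terms $\mathtt{t},\mathtt{s}_1,\dots,\mathtt{s}_n$ with $\vdash \mathtt{t : A'_1\to\cdots\to A'_n\to B'}$ derivable for some types and $\vdash\mathtt{s}_i\mathtt{:A}_i$, $\mathtt{t}$ is poly-typable by $\mathtt{A_1\to\cdots\to A_n\to B}$ with respect to $\mathtt{s}_1,\dots,\mathtt{s}_n$ if there is a type substitution $\theta$ with $\theta(\mathrm{PT}(\mathtt{t})) = \mathtt{A''_1\to\cdots\to A''_n\to B}$ and $\theta(\mathrm{PT}(\mathtt{s}_i)) = \mathtt{A''_i}$ for each $i$. (Then $\mathtt{t\,s_1\cdots s_n}$ is a closed term of type $\mathtt{B}$.) -}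

module Defs where

open import Data.Nat using (ℕ; _≟_)
open import Data.List using (List; []; _∷_; [_]; _++_; map; filter)
open import Data.List.Membership.Propositional using (_∈_; _∉_)
open import Data.List.Relation.Unary.All using (All)
open import Data.List.Relation.Unary.Unique.Propositional using (Unique)
open import Data.Product using (Σ; _×_; _,_; proj₁; ∃; ∃-syntax)
open import Data.Sum using (_⊎_)
open import Relation.Nullary using (¬_; ¬?)
open import Relation.Nullary.Decidable using (⌊_⌋)
open import Relation.Binary.PropositionalEquality using (_≡_; _≢_)

infixr 7 _⊗_
infixr 6 _⊸_

data Ty : Set where
  tv  : ℕ → Ty
  _⊗_ : Ty → Ty → Ty
  _⊸_ : Ty → Ty → Ty

TySub : Set
TySub = ℕ → Ty

sub : TySub → Ty → Ty
sub θ (tv a)  = θ a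
sub θ (A ⊗ B) = sub θ A ⊗ sub θ B
sub θ (A ⊸ B) = sub θ A ⊸ sub θ B

infixl 9 _·_

data Tm : Set where
  `_    : ℕ → Tm
  _·_   : Tm → Tm → Tm
  ƛ_⇒_  : ℕ → Tm → Tm
  ⟨_,_⟩ : Tm → Tm → Tm
  let⊗  : ℕ → ℕ → Tm → Tm → Tm

remove : ℕ → List ℕ → List ℕ
remove z xs = filter (λ w → ¬? (w ≟ z)) xs

FV : Tm → List ℕ
FV (` x)          = [ x ]
FV (t · s)        = FV t ++ FV s
FV (ƛ x ⇒ t)      = remove x (FV t)
FV ⟨ s , t ⟩      = FV s ++ FV t
FV (let⊗ x y s t) = FV s ++ remove x (remove y (FV t))

BV : Tm → List ℕ
BV (` x)          = []
BV (t · s)        = BV t ++ BV s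
BV (ƛ x ⇒ t)      = x ∷ BV t
BV ⟨ s , t ⟩      = BV s ++ BV t
BV (let⊗ x y s t) = x ∷ y ∷ BV s ++ BV t

Vars : Tm → List ℕ
Vars t = FV t ++ BV t

-- Simultaneous (naive) substitution; used only under side conditions
-- guaranteeing that no capture happens (Barendregt convention).

Subst : Set
Subst = List (ℕ × Tm)

look : Subst → ℕ → Tm
look []            x = ` x
look ((y , u) ∷ σ) x with x ≟ y
... | Relation.Nullary.yes _ = u
... | Relation.Nullary.no  _ = look σ x

dropS : ℕ → Subst → Subst
dropS z σ = filter (λ p → ¬? (proj₁ p ≟ z)) σ

subst : Subst → Tm → Tm
subst σ (` x)          = look σ x
subst σ (t · s)        = subst σ t · subst σ s
subst σ (ƛ x ⇒ t)      = ƛ x ⇒ subst (dropS x σ) t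
subst σ ⟨ s , t ⟩      = ⟨ subst σ s , subst σ t ⟩
subst σ (let⊗ x y s t) = let⊗ x y (subst σ s) (subst (dropS x (dropS y σ)) t)

NoCapture : Tm → Tm → Set
NoCapture t u = All (λ z → z ∉ FV u) (BV t)

data Cx : Set where
  □      : Cx
  _·ₗ_   : Cx → Tm → Cx
  _·ᵣ_   : Tm → Cx → Cx
  ƛ_⇒ᶜ_  : ℕ → Cx → Cx
  ⟨_,_⟩ₗ : Cx → Tm → Cx
  ⟨_,_⟩ᵣ : Tm → Cx → Cx
  letₗ   : ℕ → ℕ → Cx → Tm → Cx
  letᵣ   : ℕ → ℕ → Tm → Cx → Cx

plug : Cx → Tm → Tm
plug □              u = u
plug (C ·ₗ s)       u = plug C u · s
plug (t ·ᵣ C)       u = t · plug C u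
plug (ƛ x ⇒ᶜ C)     u = ƛ x ⇒ plug C u
plug ⟨ C , s ⟩ₗ     u = ⟨ plug C u , s ⟩
plug ⟨ s , C ⟩ᵣ     u = ⟨ s , plug C u ⟩
plug (letₗ x y C t) u = let⊗ x y (plug C u) t
plug (letᵣ x y s C) u = let⊗ x y s (plug C u)

FVC : Cx → List ℕ
FVC □              = []
FVC (C ·ₗ s)       = FVC C ++ FV s
FVC (t ·ᵣ C)       = FV t ++ FVC C
FVC (ƛ x ⇒ᶜ C)     = remove x (FVC C)
FVC ⟨ C , s ⟩ₗ     = FVC C ++ FV s
FVC ⟨ s , C ⟩ᵣ     = FV s ++ FVC C
FVC (letₗ x y C t) = FVC C ++ remove x (remove y (FV t))
FVC (letᵣ x y s C) = FV s ++ remove x (remove y (FVC C))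

BC : Cx → List ℕ
BC □              = []
BC (C ·ₗ s)       = BC C
BC (t ·ᵣ C)       = BC C
BC (ƛ x ⇒ᶜ C)     = x ∷ BC C
BC ⟨ C , s ⟩ₗ     = BC C
BC ⟨ s , C ⟩ᵣ     = BC C
BC (letₗ x y C t) = BC C
BC (letᵣ x y s C) = x ∷ y ∷ BC C

-- Basic equations (raw, before restriction to typed terms),
-- together with α-conversion (terms are identified up to renaming of
-- bound variables).

data _~_ : Tm → Tm → Set where
  β     : ∀ {x t s} → NoCapture t s →
          ((ƛ x ⇒ t) · s) ~ subst ((x , s) ∷ []) t
  βlet  : ∀ {x y u v w} → NoCapture w u → NoCapture w v →
          let⊗ x y ⟨ u , v ⟩ w ~ subst ((x , u) ∷ (y , v) ∷ []) w
  η     : ∀ {x t} → (ƛ x ⇒ (t · ` x)) ~ t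
  ηlet  : ∀ {x y t} → let⊗ x y t ⟨ ` x , ` y ⟩ ~ t
  comm  : ∀ {x y t u} (C : Cx) →
          x ∉ FVC C → y ∉ FVC C → All (λ z → z ∉ BC C) (FV t) →
          plug C (let⊗ x y t u) ~ let⊗ x y t (plug C u)
  αlam  : ∀ {x x′ t} → x′ ∉ Vars t →
          (ƛ x ⇒ t) ~ (ƛ x′ ⇒ subst ((x , ` x′) ∷ []) t)
  αlet  : ∀ {x y x′ y′ s t} → x′ ∉ Vars t → y′ ∉ Vars t → x′ ≢ y′ →
          let⊗ x y s t ~ let⊗ x′ y′ s (subst ((x , ` x′) ∷ (y , ` y′) ∷ []) t)

Ctx : Set
Ctx = List (ℕ × Ty)

names : Ctx → List ℕ
names Γ = map proj₁ Γ

infix 4 _⊢_∶_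

data _⊢_∶_ : Ctx → Tm → Ty → Set where
  ax   : ∀ {x A} → ((x , A) ∷ []) ⊢ ` x ∶ A
  exch : ∀ Γ Δ {x A y B t C} →
         (Γ ++ (x , A) ∷ (y , B) ∷ Δ) ⊢ t ∶ C →
         (Γ ++ (y , B) ∷ (x , A) ∷ Δ) ⊢ t ∶ C
  lam  : ∀ {x A Γ t B} → ((x , A) ∷ Γ) ⊢ t ∶ B → Γ ⊢ ƛ x ⇒ t ∶ A ⊸ B
  app  : ∀ {Γ Δ t s A B} → Γ ⊢ t ∶ A ⊸ B → Δ ⊢ s ∶ A →
         Unique (names (Γ ++ Δ)) → (Γ ++ Δ) ⊢ t · s ∶ B
  pair : ∀ {Γ Δ s t A B} → Γ ⊢ s ∶ A → Δ ⊢ t ∶ B →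
         Unique (names (Γ ++ Δ)) → (Γ ++ Δ) ⊢ ⟨ s , t ⟩ ∶ A ⊗ B
  letp : ∀ {Γ Δ x y s t A B C} → Γ ⊢ s ∶ A ⊗ B →
         ((x , A) ∷ (y , B) ∷ Δ) ⊢ t ∶ C →
         Unique (names (Γ ++ Δ)) → (Γ ++ Δ) ⊢ let⊗ x y s t ∶ C

infix 4 _⊢_≈_∶_

data _⊢_≈_∶_ : Ctx → Tm → Tm → Ty → Set where
  ≈ax    : ∀ {Γ t s A} → Γ ⊢ t ∶ A → Γ ⊢ s ∶ A → t ~ s → Γ ⊢ t ≈ s ∶ A
  ≈refl  : ∀ {Γ t A} → Γ ⊢ t ∶ A → Γ ⊢ t ≈ t ∶ A
  ≈sym   : ∀ {Γ t s A} → Γ ⊢ t ≈ s ∶ A → Γ ⊢ s ≈ t ∶ A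
  ≈trans : ∀ {Γ t s u A} → Γ ⊢ t ≈ s ∶ A → Γ ⊢ s ≈ u ∶ A → Γ ⊢ t ≈ u ∶ A
  ≈exch  : ∀ Γ Δ {x A y B t t′ C} →
           (Γ ++ (x , A) ∷ (y , B) ∷ Δ) ⊢ t ≈ t′ ∶ C →
           (Γ ++ (y , B) ∷ (x , A) ∷ Δ) ⊢ t ≈ t′ ∶ C
  ≈lam   : ∀ {x A Γ t t′ B} → ((x , A) ∷ Γ) ⊢ t ≈ t′ ∶ B →
           Γ ⊢ ƛ x ⇒ t ≈ ƛ x ⇒ t′ ∶ A ⊸ B
  ≈app   : ∀ {Γ Δ t t′ s s′ A B} → Γ ⊢ t ≈ t′ ∶ A ⊸ B → Δ ⊢ s ≈ s′ ∶ A →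
           Unique (names (Γ ++ Δ)) → (Γ ++ Δ) ⊢ t · s ≈ t′ · s′ ∶ B
  ≈pair  : ∀ {Γ Δ s s′ t t′ A B} → Γ ⊢ s ≈ s′ ∶ A → Δ ⊢ t ≈ t′ ∶ B →
           Unique (names (Γ ++ Δ)) → (Γ ++ Δ) ⊢ ⟨ s , t ⟩ ≈ ⟨ s′ , t′ ⟩ ∶ A ⊗ B
  ≈let   : ∀ {Γ Δ x y s s′ t t′ A B C} → Γ ⊢ s ≈ s′ ∶ A ⊗ B →
           ((x , A) ∷ (y , B) ∷ Δ) ⊢ t ≈ t′ ∶ C →
           Unique (names (Γ ++ Δ)) →
           (Γ ++ Δ) ⊢ let⊗ x y s t ≈ let⊗ x y s′ t′ ∶ C

infix 4 _≈βηc_∶_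
_≈βηc_∶_ : Tm → Tm → Ty → Set
t ≈βηc s ∶ A = [] ⊢ t ≈ s ∶ A

IsPT : Tm → Ty → Set
IsPT t P = (∃[ Γ ] (Γ ⊢ t ∶ P)) ×
           (∀ Γ′ A′ → Γ′ ⊢ t ∶ A′ → ∃[ θ ] (sub θ P ≡ A′))

PolyTypable₁ : Tm → Ty → Ty → Tm → Set
PolyTypable₁ t A₁ B s₁ =
  (∃[ A′ ] ∃[ B′ ] ([] ⊢ t ∶ A′ ⊸ B′)) × ([] ⊢ s₁ ∶ A₁) ×
  (∃[ P ] ∃[ Q₁ ] ∃[ θ ]
     (IsPT t P × IsPT s₁ Q₁ × sub θ P ≡ (sub θ Q₁ ⊸ B)))

PolyTypable₂ : Tm → Ty → Ty → Ty → Tm → Tm → Set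
PolyTypable₂ t A₁ A₂ B s₁ s₂ =
  (∃[ A′₁ ] ∃[ A′₂ ] ∃[ B′ ] ([] ⊢ t ∶ A′₁ ⊸ A′₂ ⊸ B′)) ×
  ([] ⊢ s₁ ∶ A₁) × ([] ⊢ s₂ ∶ A₂) ×
  (∃[ P ] ∃[ Q₁ ] ∃[ Q₂ ] ∃[ θ ]
     (IsPT t P × IsPT s₁ Q₁ × IsPT s₂ Q₂ ×
      sub θ P ≡ (sub θ Q₁ ⊸ sub θ Q₂ ⊸ B)))

{-# OPTIONS --safe #-}

-- Cut-free proofs show that s₁ and s₂ also have types A₁ and A₂ of the shape
-- of A in which the inputs (negative atoms) are pairwise distinct variables,
-- the same in both, and every output is named after the input linked to it.
-- If A₁ = A₂, then s₁ = s₂, because a sequent whose variables have at most one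
-- output each has at most one proof up to equality. Otherwise some output is
-- linked to different inputs, and a linear test T that sends the exchange of
-- pairs into one of them and the identity into all others satisfies
-- T s₁ ⟨x , y⟩ = ⟨y , x⟩ and T s₂ ⟨x , y⟩ = ⟨x , y⟩. Then
-- t s r := let (F , G) = T s ⟨u₂ , u₁⟩ in F r, where the unwanted G is applied
-- to r₁ and the resulting closed term of type B is erased. Linear β-expansion
-- preserves all typings, so t s r inherits the types of uⱼ r.

module Submission where

open import Defs
open import Data.Bool using (Bool; true; false; not; _xor_; _∧_; if_then_else_)
open import Data.Empty using (⊥; ⊥-elim)
open import Data.Unit using (⊤; tt)
open import Data.Nat using (ℕ; zero; suc; _+_; _≤_; _<_; z≤n; s≤s; _≟_; _⊔_)
import Data.Nat.Properties as ℕ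
import Data.Bool.Properties as Bool
open import Data.List using (List; []; _∷_; [_]; _++_; map)
open import Data.List.Properties using (++-assoc; ++-identityʳ; map-++; filter-accept; filter-reject)
open import Data.List.Membership.Propositional using (_∈_; _∉_)
open import Data.List.Membership.Propositional.Properties
  using (∈-++⁺ˡ; ∈-++⁺ʳ; ∈-++⁻; ∈-filter⁺; ∈-filter⁻; ∈-map⁺; ∈-map⁻; ∈-∃++)
open import Data.List.Relation.Unary.Any using (here; there)
open import Data.List.Relation.Unary.All as All using (All; []; _∷_)
import Data.List.Relation.Unary.All.Properties as All
open import Data.List.Relation.Unary.AllPairs using ([]; _∷_)
open import Data.List.Relation.Unary.Unique.Propositional using (Unique)
import Data.List.Relation.Unary.Unique.Propositional.Properties as Unique
open import Data.List.Relation.Binary.Permutation.Propositional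
  using (_↭_; prep; swap; ↭-refl; ↭-sym; ↭-trans; ↭-reflexive)
open import Data.List.Relation.Binary.Permutation.Propositional.Properties as ↭
  using (∈-resp-↭; drop-∷; shift; ++-comm; ++⁺ˡ; ++⁺ʳ; ++⁺; ++-commutativeMonoid)
open import Data.Product using (_×_; _,_; proj₁; proj₂; ∃-syntax)
open import Data.Sum using (_⊎_; inj₁; inj₂)
open import Function using (_∘_; id)
open import Relation.Nullary using (¬_; Dec; yes; no; ¬?; _×-dec_)
open import Relation.Nullary.Decidable using (True; toWitness; ⌊_⌋)
open import Relation.Binary.PropositionalEquality as ≡
  using (_≡_; _≢_; refl; sym; trans; cong; cong₂)
import Algebra.Solver.CommutativeMonoid as CommutativeMonoidSolver
open import Data.Fin using (#_)
open import Data.Vec using ([]; _∷_)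
open import Data.Nat.Solver using (module +-*-Solver)

-- No typing of the tests is ever written down: poly-typability lets the type of `t` vary with its
-- arguments, so all computation is done on untyped linear terms, and the typing of `uⱼ rᵢ` is
-- pulled back along `⊒` at the very end. Two obstacles shape the tests. A linear term cannot branch
-- on a Boolean and drop the losing branch; a bit is therefore an action on pairs, the identity or
-- the exchange, and composition of actions is addition in ℤ/2. Nor can a leftover be dropped; it is
-- turned into an action that changes nothing. The delicate point of the uniqueness half is the
-- division of the context at the tensor right rule and the arrow left rule, where two proofs might
-- divide it differently. Colouring the type variables by the premise in which they occur rules this
-- out. Naive substitution on named variables brings capture conditions. A redex used as an explicit
-- substitution, and renaming of bound variables on demand, keep these conditions out of the logical
-- arguments.

-- Lists of variables: duplicate-freeness, permutations, fresh names

Disj : List ℕ → List ℕ → Set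
Disj xs ys = ∀ {z} → z ∈ xs → z ∈ ys → ⊥

∈-remove⁺ : ∀ {z x xs} → z ∈ xs → z ≢ x → z ∈ remove x xs
∈-remove⁺ {x = x} = ∈-filter⁺ (λ w → ¬? (w ≟ x))

∈-remove⁻ : ∀ {z x} xs → z ∈ remove x xs → z ∈ xs × z ≢ x
∈-remove⁻ {x = x} xs = ∈-filter⁻ (λ w → ¬? (w ≟ x)) {xs = xs}

∈-[-] : ∀ {z x : ℕ} → z ∈ [ x ] → z ≡ x
∈-[-] (here p) = p

Unique-resp-↭ : ∀ {xs ys : List ℕ} → xs ↭ ys → Unique xs → Unique ys
Unique-resp-↭ _↭_.refl u = u
Unique-resp-↭ (prep x p) (a ∷ u) = ↭.All-resp-↭ p a ∷ Unique-resp-↭ p u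
Unique-resp-↭ (swap x y p) ((x≢y ∷ a) ∷ b ∷ u) =
  ((λ e → x≢y (sym e)) ∷ ↭.All-resp-↭ p b) ∷ ↭.All-resp-↭ p a ∷ Unique-resp-↭ p u
Unique-resp-↭ (_↭_.trans p q) u = Unique-resp-↭ q (Unique-resp-↭ p u)

All≢⇒∉ : ∀ {x : ℕ} {xs} → All (x ≢_) xs → x ∉ xs
All≢⇒∉ a x∈ = All.lookup a x∈ refl

∉⇒All≢ : ∀ {x : ℕ} {xs} → x ∉ xs → All (x ≢_) xs
∉⇒All≢ x∉ = All.tabulate λ z∈ e → x∉ (≡.subst (_∈ _) (sym e) z∈)

Unique-++⁻ : ∀ xs {ys : List ℕ} → Unique (xs ++ ys) → Unique xs × Unique ys × Disj xs ys
Unique-++⁻ [] u = [] , u , λ ()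
Unique-++⁻ (x ∷ xs) (a ∷ u) with Unique-++⁻ xs u
... | ux , uy , d = (All.++⁻ˡ xs a ∷ ux) , uy ,
  λ { (here refl) z∈ → All≢⇒∉ (All.++⁻ʳ xs a) z∈ ; (there p) z∈ → d p z∈ }

Unique-++⁺ : ∀ {xs ys : List ℕ} → Unique xs → Unique ys → Disj xs ys → Unique (xs ++ ys)
Unique-++⁺ ux uy d = Unique.++⁺ ux uy (λ (p , q) → d p q)

Unique-remove : ∀ {x xs} → Unique xs → Unique (remove x xs)
Unique-remove {x} = Unique.filter⁺ (λ w → ¬? (w ≟ x))

-- Linear contexts have no duplicates, so exchange can be settled by two inclusions of variable
-- sets; `remove-↭` and `transfer` rely on this.
↭-extensional : ∀ {xs ys : List ℕ} → Unique xs → Unique ys →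
  (∀ {z} → z ∈ xs → z ∈ ys) → (∀ {z} → z ∈ ys → z ∈ xs) → xs ↭ ys
↭-extensional {[]} {[]} _ _ _ _ = ↭-refl
↭-extensional {[]} {y ∷ ys} _ _ _ g with () ← g (here refl)
↭-extensional {x ∷ xs} (a ∷ ux) uy f g with ∈-∃++ (f (here refl))
... | as , bs , refl =
  ↭-trans (prep x (↭-extensional ux uab f′ g′)) (↭-sym (shift x as bs))
  where
  u′ = Unique-resp-↭ (shift x as bs) uy
  uab : Unique (as ++ bs)
  uab with u′
  ... | _ ∷ u = u
  x∉ : x ∉ as ++ bs
  x∉ with u′
  ... | a′ ∷ _ = All≢⇒∉ a′
  f′ : ∀ {z} → z ∈ xs → z ∈ as ++ bs
  f′ z∈ with ∈-resp-↭ (shift x as bs) (f (there z∈))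
  ... | here refl = ⊥-elim (All≢⇒∉ a z∈)
  ... | there q = q
  g′ : ∀ {z} → z ∈ as ++ bs → z ∈ xs
  g′ z∈ with g (∈-resp-↭ (↭-sym (shift x as bs)) (there z∈))
  ... | here refl = ⊥-elim (x∉ z∈)
  ... | there q = q

max : List ℕ → ℕ
max [] = 0
max (x ∷ xs) = x ⊔ max xs

∈⇒≤max : ∀ {x xs} → x ∈ xs → x ≤ max xs
∈⇒≤max {xs = y ∷ ys} (here refl) = ℕ.m≤m⊔n y (max ys)
∈⇒≤max {xs = y ∷ ys} (there p) = ℕ.≤-trans (∈⇒≤max p) (ℕ.m≤n⊔m y (max ys))

fresh : ∀ xs → ∃[ y ] (y ∉ xs)
fresh xs = suc (max xs) , λ p → ℕ.<-irrefl refl (∈⇒≤max p)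

∉ˡ : ∀ {y : ℕ} {xs ys} → y ∉ xs ++ ys → y ∉ xs
∉ˡ n p = n (∈-++⁺ˡ p)

∉ʳ : ∀ {y : ℕ} xs {ys} → y ∉ xs ++ ys → y ∉ ys
∉ʳ xs n p = n (∈-++⁺ʳ xs p)

∉-∷ : ∀ {y x : ℕ} {xs} → y ≢ x → y ∉ xs → y ∉ x ∷ xs
∉-∷ ne n (here p) = ne p
∉-∷ ne n (there p) = n p

∉-++ : ∀ {y : ℕ} xs {ys} → y ∉ xs → y ∉ ys → y ∉ xs ++ ys
∉-++ xs n m p with ∈-++⁻ xs p
... | inj₁ q = n q
... | inj₂ q = m q

-- Typing over total environments

upd : (ℕ → Ty) → ℕ → Ty → ℕ → Ty
upd E x A z with z ≟ x
... | yes _ = A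
... | no  _ = E z

upd-≡ : ∀ E x A → upd E x A x ≡ A
upd-≡ E x A with x ≟ x
... | yes _ = refl
... | no n  = ⊥-elim (n refl)

upd-≢ : ∀ E x A {z} → z ≢ x → upd E x A z ≡ E z
upd-≢ E x A {z} n with z ≟ x
... | yes p = ⊥-elim (n p)
... | no _  = refl

upd-cong : ∀ {E E′} {x A z} → (z ≢ x → E z ≡ E′ z) → upd E x A z ≡ upd E′ x A z
upd-cong {x = x} {z = z} h with z ≟ x
... | yes _ = refl
... | no n  = h n

-- Typing with contexts replaced by total environments: the linearity
-- constraints are split off into Lin.

data HasTy : (ℕ → Ty) → Tm → Ty → Set where
  var  : ∀ {E x A} → E x ≡ A → HasTy E (` x) A
  app  : ∀ {E t s A B} → HasTy E t (A ⊸ B) → HasTy E s A → HasTy E (t · s) B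
  lam  : ∀ {E x t A B} → HasTy (upd E x A) t B → HasTy E (ƛ x ⇒ t) (A ⊸ B)
  pair : ∀ {E s t A B} → HasTy E s A → HasTy E t B → HasTy E ⟨ s , t ⟩ (A ⊗ B)
  letp : ∀ {E x y s t A B C} → HasTy E s (A ⊗ B) →
         HasTy (upd (upd E y B) x A) t C → HasTy E (let⊗ x y s t) C

Lin : Tm → Set
Lin (` x)          = ⊤
Lin (t · s)        = Lin t × Lin s × Disj (FV t) (FV s)
Lin (ƛ x ⇒ t)      = Lin t × x ∈ FV t
Lin ⟨ s , t ⟩      = Lin s × Lin t × Disj (FV s) (FV t)
Lin (let⊗ x y s t) = Lin s × Lin t × x ≢ y × x ∈ FV t × y ∈ FV t ×
                     Disj (FV s) (remove x (remove y (FV t)))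

HasTy-ext : ∀ {E E′ t A} → (∀ {z} → z ∈ FV t → E z ≡ E′ z) → HasTy E t A → HasTy E′ t A
HasTy-ext h (var e) = var (trans (sym (h (here refl))) e)
HasTy-ext {t = t · s} h (app d e) =
  app (HasTy-ext (h ∘ ∈-++⁺ˡ) d) (HasTy-ext (h ∘ ∈-++⁺ʳ (FV t)) e)
HasTy-ext {t = ƛ x ⇒ t} h (lam d) =
  lam (HasTy-ext (λ z∈ → upd-cong (λ n → h (∈-remove⁺ z∈ n))) d)
HasTy-ext {t = ⟨ t , s ⟩} h (pair d e) =
  pair (HasTy-ext (h ∘ ∈-++⁺ˡ) d) (HasTy-ext (h ∘ ∈-++⁺ʳ (FV t)) e)
HasTy-ext {t = let⊗ x y s t} h (letp d e) =
  letp (HasTy-ext (h ∘ ∈-++⁺ˡ) d)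
       (HasTy-ext (λ z∈ → upd-cong (λ n → upd-cong (λ m →
          h (∈-++⁺ʳ (FV s) (∈-remove⁺ (∈-remove⁺ z∈ m) n))))) e)

Lin⇒Unique : ∀ t → Lin t → Unique (FV t)
Lin⇒Unique (` x) _ = [] ∷ []
Lin⇒Unique (t · s) (l , m , d) = Unique-++⁺ (Lin⇒Unique t l) (Lin⇒Unique s m) d
Lin⇒Unique (ƛ x ⇒ t) (l , _) = Unique-remove (Lin⇒Unique t l)
Lin⇒Unique ⟨ t , s ⟩ (l , m , d) = Unique-++⁺ (Lin⇒Unique t l) (Lin⇒Unique s m) d
Lin⇒Unique (let⊗ x y s t) (l , m , _ , _ , _ , d) =
  Unique-++⁺ (Lin⇒Unique s l) (Unique-remove (Unique-remove (Lin⇒Unique t m))) d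

remove-↭ : ∀ {x xs} → Unique xs → x ∈ xs → xs ↭ x ∷ remove x xs
remove-↭ {x} {xs} u x∈ = ↭-extensional u (∉⇒All≢ (λ p → proj₂ (∈-remove⁻ xs p) refl) ∷ Unique-remove u)
  f g
  where
  f : ∀ {z} → z ∈ xs → z ∈ x ∷ remove x xs
  f {z} z∈ with z ≟ x
  ... | yes e = here e
  ... | no n  = there (∈-remove⁺ z∈ n)
  g : ∀ {z} → z ∈ x ∷ remove x xs → z ∈ xs
  g (here refl) = x∈
  g (there p) = proj₁ (∈-remove⁻ xs p)

-- Exchange and inversion for the typing rules

⊢-↭ : ∀ Π {Γ Γ′ t A} → Γ ↭ Γ′ → (Π ++ Γ) ⊢ t ∶ A → (Π ++ Γ′) ⊢ t ∶ A
⊢-↭ Π _↭_.refl d = d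
⊢-↭ Π {t = t} {A} (prep {xs} {ys} x p) d =
  ≡.subst (λ Δ → Δ ⊢ t ∶ A) (++-assoc Π [ x ] ys)
    (⊢-↭ (Π ++ [ x ]) p (≡.subst (λ Δ → Δ ⊢ t ∶ A) (sym (++-assoc Π [ x ] xs)) d))
⊢-↭ Π {t = t} {A} (swap {xs} {ys} x y p) d =
  ≡.subst (λ Δ → Δ ⊢ t ∶ A) (++-assoc Π (y ∷ x ∷ []) ys)
    (⊢-↭ (Π ++ y ∷ x ∷ []) p
      (≡.subst (λ Δ → Δ ⊢ t ∶ A) (sym (++-assoc Π (y ∷ x ∷ []) xs)) (exch Π xs d)))
⊢-↭ Π (_↭_.trans p q) d = ⊢-↭ Π q (⊢-↭ Π p d)

≈-↭ : ∀ Π {Γ Γ′ t s A} → Γ ↭ Γ′ → (Π ++ Γ) ⊢ t ≈ s ∶ A → (Π ++ Γ′) ⊢ t ≈ s ∶ A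
≈-↭ Π _↭_.refl d = d
≈-↭ Π {t = t} {s} {A} (prep {xs} {ys} x p) d =
  ≡.subst (λ Δ → Δ ⊢ t ≈ s ∶ A) (++-assoc Π [ x ] ys)
    (≈-↭ (Π ++ [ x ]) p (≡.subst (λ Δ → Δ ⊢ t ≈ s ∶ A) (sym (++-assoc Π [ x ] xs)) d))
≈-↭ Π {t = t} {s} {A} (swap {xs} {ys} x y p) d =
  ≡.subst (λ Δ → Δ ⊢ t ≈ s ∶ A) (++-assoc Π (y ∷ x ∷ []) ys)
    (≈-↭ (Π ++ y ∷ x ∷ []) p
      (≡.subst (λ Δ → Δ ⊢ t ≈ s ∶ A) (sym (++-assoc Π (y ∷ x ∷ []) xs)) (≈exch Π xs d)))
≈-↭ Π (_↭_.trans p q) d = ≈-↭ Π q (≈-↭ Π p d)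

perm : ∀ {Γ Γ′ t A} → Γ ↭ Γ′ → Γ ⊢ t ∶ A → Γ′ ⊢ t ∶ A
perm = ⊢-↭ []

≈perm : ∀ {Γ Γ′ t s A} → Γ ↭ Γ′ → Γ ⊢ t ≈ s ∶ A → Γ′ ⊢ t ≈ s ∶ A
≈perm = ≈-↭ []

≈⇒ˡ : ∀ {Γ t s A} → Γ ⊢ t ≈ s ∶ A → Γ ⊢ t ∶ A
≈⇒ʳ : ∀ {Γ t s A} → Γ ⊢ t ≈ s ∶ A → Γ ⊢ s ∶ A
≈⇒ˡ (≈ax d _ _) = d
≈⇒ˡ (≈refl d) = d
≈⇒ˡ (≈sym e) = ≈⇒ʳ e
≈⇒ˡ (≈trans e _) = ≈⇒ˡ e
≈⇒ˡ (≈exch Γ Δ e) = exch Γ Δ (≈⇒ˡ e)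
≈⇒ˡ (≈lam e) = lam (≈⇒ˡ e)
≈⇒ˡ (≈app e f u) = app (≈⇒ˡ e) (≈⇒ˡ f) u
≈⇒ˡ (≈pair e f u) = pair (≈⇒ˡ e) (≈⇒ˡ f) u
≈⇒ˡ (≈let e f u) = letp (≈⇒ˡ e) (≈⇒ˡ f) u
≈⇒ʳ (≈ax _ d _) = d
≈⇒ʳ (≈refl d) = d
≈⇒ʳ (≈sym e) = ≈⇒ˡ e
≈⇒ʳ (≈trans _ e) = ≈⇒ʳ e
≈⇒ʳ (≈exch Γ Δ e) = exch Γ Δ (≈⇒ʳ e)
≈⇒ʳ (≈lam e) = lam (≈⇒ʳ e)
≈⇒ʳ (≈app e f u) = app (≈⇒ʳ e) (≈⇒ʳ f) u
≈⇒ʳ (≈pair e f u) = pair (≈⇒ʳ e) (≈⇒ʳ f) u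
≈⇒ʳ (≈let e f u) = letp (≈⇒ʳ e) (≈⇒ʳ f) u

inv-var : ∀ {Γ x A} → Γ ⊢ ` x ∶ A → Γ ≡ [ x , A ]
inv-var ax = refl
inv-var (exch [] Δ d) with () ← inv-var d
inv-var (exch (_ ∷ []) Δ d) with () ← inv-var d
inv-var (exch (_ ∷ _ ∷ _) Δ d) with () ← inv-var d

swap-mid : ∀ {ℓ} {X : Set ℓ} (Γ : List X) {Δ x y} → Γ ++ x ∷ y ∷ Δ ↭ Γ ++ y ∷ x ∷ Δ
swap-mid Γ = ++⁺ˡ Γ (swap _ _ ↭-refl)

inv-lam : ∀ {Γ x t C} → Γ ⊢ ƛ x ⇒ t ∶ C → ∃[ A ] ∃[ B ] (C ≡ A ⊸ B × ((x , A) ∷ Γ) ⊢ t ∶ B)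
inv-lam (lam d) = _ , _ , refl , d
inv-lam (exch Γ Δ d) with inv-lam d
... | A , B , refl , e = A , B , refl , perm (prep _ (swap-mid Γ)) e

inv-app : ∀ {Γ t s B} → Γ ⊢ t · s ∶ B → ∃[ Γ₁ ] ∃[ Γ₂ ] ∃[ A ]
  (Γ₁ ++ Γ₂ ↭ Γ × Unique (names (Γ₁ ++ Γ₂)) × Γ₁ ⊢ t ∶ A ⊸ B × Γ₂ ⊢ s ∶ A)
inv-app (app d e u) = _ , _ , _ , ↭-refl , u , d , e
inv-app (exch Γ Δ d) with inv-app d
... | Γ₁ , Γ₂ , A , p , u , d , e = Γ₁ , Γ₂ , A , ↭-trans p (swap-mid Γ) , u , d , e

inv-pair : ∀ {Γ s t C} → Γ ⊢ ⟨ s , t ⟩ ∶ C → ∃[ Γ₁ ] ∃[ Γ₂ ] ∃[ A ] ∃[ B ]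
  (C ≡ A ⊗ B × Γ₁ ++ Γ₂ ↭ Γ × Unique (names (Γ₁ ++ Γ₂)) × Γ₁ ⊢ s ∶ A × Γ₂ ⊢ t ∶ B)
inv-pair (pair d e u) = _ , _ , _ , _ , refl , ↭-refl , u , d , e
inv-pair (exch Γ Δ d) with inv-pair d
... | Γ₁ , Γ₂ , A , B , q , p , u , d , e = Γ₁ , Γ₂ , A , B , q , ↭-trans p (swap-mid Γ) , u , d , e

inv-let : ∀ {Γ x y s t C} → Γ ⊢ let⊗ x y s t ∶ C → ∃[ Γ₁ ] ∃[ Γ₂ ] ∃[ A ] ∃[ B ]
  (Γ₁ ++ Γ₂ ↭ Γ × Unique (names (Γ₁ ++ Γ₂)) × Γ₁ ⊢ s ∶ A ⊗ B × ((x , A) ∷ (y , B) ∷ Γ₂) ⊢ t ∶ C)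
inv-let (letp d e u) = _ , _ , _ , _ , ↭-refl , u , d , e
inv-let (exch Γ Δ d) with inv-let d
... | Γ₁ , Γ₂ , A , B , p , u , d , e = Γ₁ , Γ₂ , A , B , ↭-trans p (swap-mid Γ) , u , d , e

⊢-Unique : ∀ {Γ t A} → Γ ⊢ t ∶ A → Unique (names Γ)
⊢-Unique ax = [] ∷ []
⊢-Unique (exch Γ Δ d) = Unique-resp-↭ (↭.map⁺ proj₁ (swap-mid Γ)) (⊢-Unique d)
⊢-Unique (lam d) with ⊢-Unique d
... | _ ∷ u = u
⊢-Unique (app _ _ u) = u
⊢-Unique (pair _ _ u) = u
⊢-Unique (letp _ _ u) = u

-- Equivalence of the two presentations of typing

ctx : (ℕ → Ty) → List ℕ → Ctx
ctx E = map (λ x → x , E x)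

names-ctx : ∀ E xs → names (ctx E xs) ≡ xs
names-ctx E [] = refl
names-ctx E (x ∷ xs) = cong (x ∷_) (names-ctx E xs)

ctx-cong : ∀ {E E′} xs → (∀ {z} → z ∈ xs → E z ≡ E′ z) → ctx E xs ≡ ctx E′ xs
ctx-cong [] h = refl
ctx-cong (x ∷ xs) h = cong₂ _∷_ (cong (x ,_) (h (here refl))) (ctx-cong xs (h ∘ there))

Agrees : (ℕ → Ty) → Ctx → Set
Agrees E = All (λ (x , A) → E x ≡ A)

Agrees⇒ctx : ∀ {E Γ} → Agrees E Γ → ctx E (names Γ) ≡ Γ
Agrees⇒ctx [] = refl
Agrees⇒ctx {Γ = (x , A) ∷ _} (refl ∷ a) = cong (_ ∷_) (Agrees⇒ctx a)

-- The context is read off `FV t`. Under a binder, `Lin` guarantees that the bound variable occurs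
-- there, so exchange can bring it to the front as the typing rule wants.
HasTy⇒⊢ : ∀ {E} t {A} → Lin t → HasTy E t A → ctx E (FV t) ⊢ t ∶ A
lam-premise : ∀ {E} x t {A B} → Lin t → x ∈ FV t → HasTy (upd E x A) t B →
  ((x , A) ∷ ctx E (remove x (FV t))) ⊢ t ∶ B
let-premise : ∀ {E} x y t {A B C} → Lin t → x ≢ y → x ∈ FV t → y ∈ FV t →
  HasTy (upd (upd E y B) x A) t C →
  ((x , A) ∷ (y , B) ∷ ctx E (remove x (remove y (FV t)))) ⊢ t ∶ C
lam-premise {E} x t {A} {B} l x∈ d =
  ≡.subst (λ Δ → Δ ⊢ t ∶ B)
    (cong₂ _∷_ (cong (x ,_) (upd-≡ E x A))
      (ctx-cong (remove x (FV t)) (λ z∈ → upd-≢ E x A (proj₂ (∈-remove⁻ (FV t) z∈)))))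
    (perm (↭.map⁺ _ (remove-↭ (Lin⇒Unique t l) x∈)) (HasTy⇒⊢ t l d))
let-premise {E} x y t {A} {B} {C} l x≢y x∈ y∈ d =
  ≡.subst (λ Δ → Δ ⊢ t ∶ C)
    (cong₂ _∷_ (cong (x ,_) (upd-≡ _ x A))
    (cong₂ _∷_ (cong (y ,_) (trans (upd-≢ _ x A (λ e → x≢y (sym e))) (upd-≡ E y B)))
      (ctx-cong _ (λ z∈ → trans (upd-≢ _ x A (proj₂ (∈-remove⁻ (remove y (FV t)) z∈)))
         (upd-≢ E y B (proj₂ (∈-remove⁻ (FV t) (proj₁ (∈-remove⁻ (remove y (FV t)) z∈)))))))))
    (perm (↭.map⁺ _ (↭-trans (remove-↭ u y∈)
             (↭-trans (prep y (remove-↭ (Unique-remove u) (∈-remove⁺ x∈ x≢y))) (swap y x ↭-refl))))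
          (HasTy⇒⊢ t l d))
  where u = Lin⇒Unique t l
HasTy⇒⊢ (` x) l (var refl) = ax
HasTy⇒⊢ {E} (t · s) {A} l@(l₁ , l₂ , d) (app h k) =
  ≡.subst (λ Δ → Δ ⊢ t · s ∶ A) (sym (map-++ _ (FV t) (FV s)))
    (app (HasTy⇒⊢ t l₁ h) (HasTy⇒⊢ s l₂ k)
      (≡.subst Unique (trans (sym (names-ctx E _)) (cong names (map-++ _ (FV t) (FV s)))) (Lin⇒Unique (t · s) l)))
HasTy⇒⊢ (ƛ x ⇒ t) (l , x∈) (lam d) = lam (lam-premise x t l x∈ d)
HasTy⇒⊢ {E} ⟨ t , s ⟩ {A} l@(l₁ , l₂ , d) (pair h k) =
  ≡.subst (λ Δ → Δ ⊢ ⟨ t , s ⟩ ∶ A) (sym (map-++ _ (FV t) (FV s)))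
    (pair (HasTy⇒⊢ t l₁ h) (HasTy⇒⊢ s l₂ k)
      (≡.subst Unique (trans (sym (names-ctx E _)) (cong names (map-++ _ (FV t) (FV s)))) (Lin⇒Unique (t · s) l)))
HasTy⇒⊢ {E} (let⊗ x y s t) {A} l@(l₁ , l₂ , x≢y , x∈ , y∈ , d) (letp h k) =
  ≡.subst (λ Δ → Δ ⊢ let⊗ x y s t ∶ A) (sym (map-++ _ (FV s) _))
    (letp (HasTy⇒⊢ s l₁ h) (let-premise x y t l₂ x≢y x∈ y∈ k)
      (≡.subst Unique (trans (sym (names-ctx E _)) (cong names (map-++ _ (FV s) _))) (Lin⇒Unique (let⊗ x y s t) l)))

-- Together with `names-FV` and `⊢⇒HasTy` this takes a derivation apart into linearity, free
-- variables and environment typing, three conditions that can be carried over to another term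
-- independently.
mk⊢ : ∀ {E Γ t A} → Lin t → FV t ↭ names Γ → Agrees E Γ → HasTy E t A → Γ ⊢ t ∶ A
mk⊢ {E} {Γ} {t} {A} l p a d =
  ≡.subst (λ Δ → Δ ⊢ t ∶ A) (Agrees⇒ctx a) (perm (↭.map⁺ _ p) (HasTy⇒⊢ t l d))

∉-names : ∀ {x A Γ} → Unique (x ∷ names Γ) → ∀ {E} → Agrees E Γ → Agrees (upd E x A) Γ
∉-names {Γ = []} u [] = []
∉-names {x} {A} {Γ = (y , B) ∷ Γ} ((x≢y ∷ a) ∷ _ ∷ u) {E} (e ∷ es) =
  trans (upd-≢ E x A (λ q → x≢y (sym q))) e ∷ ∉-names (a ∷ u) es

names-FV : ∀ {Γ t A} → Γ ⊢ t ∶ A → Lin t × FV t ↭ names Γ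
names-FV ax = tt , ↭-refl
names-FV (exch Γ Δ d) with names-FV d
... | l , p = l , ↭-trans p (↭.map⁺ proj₁ (swap-mid Γ))
names-FV {t = ƛ x ⇒ t} (lam {Γ = Γ} d) with names-FV d | ⊢-Unique d
... | l , p | u = (l , x∈) , drop-∷ (↭-trans (↭-sym (remove-↭ (Lin⇒Unique _ l) x∈)) p)
  where x∈ = ∈-resp-↭ (↭-sym p) (here refl)
names-FV (app {Γ} {Δ} {t} {s} d e u) with names-FV d | names-FV e
... | l , p | m , q = (l , m , λ z∈ z∈′ → proj₂ (proj₂ (Unique-++⁻ (names Γ)
    (≡.subst Unique (map-++ _ Γ Δ) u))) (∈-resp-↭ p z∈) (∈-resp-↭ q z∈′)) ,
  ↭-trans (++⁺ p q) (↭-reflexive (sym (map-++ _ Γ Δ)))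
names-FV (pair {Γ} {Δ} {t} {s} d e u) with names-FV d | names-FV e
... | l , p | m , q = (l , m , λ z∈ z∈′ → proj₂ (proj₂ (Unique-++⁻ (names Γ)
    (≡.subst Unique (map-++ _ Γ Δ) u))) (∈-resp-↭ p z∈) (∈-resp-↭ q z∈′)) ,
  ↭-trans (++⁺ p q) (↭-reflexive (sym (map-++ _ Γ Δ)))
names-FV (letp {Γ} {Δ} {x} {y} {s} {t} d e u) with names-FV d | names-FV e | ⊢-Unique e
... | l , p | m , q | (x≢y ∷ _) ∷ _ =
  (l , m , x≢y , x∈ , y∈ , λ z∈ z∈′ → proj₂ (proj₂ (Unique-++⁻ (names Γ)
    (≡.subst Unique (map-++ _ Γ Δ) u))) (∈-resp-↭ p z∈) (∈-resp-↭ q′ z∈′)) ,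
  ↭-trans (++⁺ p q′) (↭-reflexive (sym (map-++ _ Γ Δ)))
  where
  x∈ = ∈-resp-↭ (↭-sym q) (here refl)
  y∈ = ∈-resp-↭ (↭-sym q) (there (here refl))
  u′ = Lin⇒Unique t m
  q′ : remove x (remove y (FV t)) ↭ names Δ
  q′ = drop-∷ (drop-∷ (↭-trans (↭-sym (↭-trans (remove-↭ u′ y∈)
         (↭-trans (prep y (remove-↭ (Unique-remove u′) (∈-remove⁺ x∈ x≢y))) (swap y x ↭-refl)))) q))

⊢⇒HasTy : ∀ {Γ t A E} → Γ ⊢ t ∶ A → Agrees E Γ → HasTy E t A
⊢⇒HasTy ax (e ∷ []) = var e
⊢⇒HasTy (exch Γ Δ d) a = ⊢⇒HasTy d (↭.All-resp-↭ (swap-mid Γ) a)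
⊢⇒HasTy {E = E} (lam {x} {A} d) a =
  lam (⊢⇒HasTy d (upd-≡ E x A ∷ ∉-names (⊢-Unique d) a))
⊢⇒HasTy (app {Γ} d e _) a = app (⊢⇒HasTy d (All.++⁻ˡ Γ a)) (⊢⇒HasTy e (All.++⁻ʳ Γ a))
⊢⇒HasTy (pair {Γ} d e _) a = pair (⊢⇒HasTy d (All.++⁻ˡ Γ a)) (⊢⇒HasTy e (All.++⁻ʳ Γ a))
⊢⇒HasTy {E = E} (letp {Γ} {x = x} {y} {A = A} {B} d e _) a with ⊢-Unique e
... | u@((x≢y ∷ _) ∷ u′) = letp (⊢⇒HasTy d (All.++⁻ˡ Γ a))
  (⊢⇒HasTy e (upd-≡ _ x A ∷ ∉-names u (upd-≡ E y B ∷ ∉-names u′ (All.++⁻ʳ Γ a))))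

envOf : Ctx → ℕ → Ty
-- The default is arbitrary: a term typed in `Γ` has no free variable outside `names Γ`.
envOf [] = λ _ → tv 0
envOf ((x , A) ∷ Γ) = upd (envOf Γ) x A

Agrees-envOf : ∀ Γ → Unique (names Γ) → Agrees (envOf Γ) Γ
Agrees-envOf [] u = []
Agrees-envOf ((x , A) ∷ Γ) u@(_ ∷ u′) = upd-≡ (envOf Γ) x A ∷ ∉-names u (Agrees-envOf Γ u′)

-- Simultaneous substitution: free variables, linearity, types

look-≡ : ∀ x u σ → look ((x , u) ∷ σ) x ≡ u
look-≡ x u σ with x ≟ x
... | yes _ = refl
... | no n  = ⊥-elim (n refl)

look-≢ : ∀ {x u σ z} → z ≢ x → look ((x , u) ∷ σ) z ≡ look σ z
look-≢ {x} {z = z} n with z ≟ x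
... | yes p = ⊥-elim (n p)
... | no _  = refl

dropS-≡ : ∀ y u σ → dropS y ((y , u) ∷ σ) ≡ dropS y σ
dropS-≡ y u σ = filter-reject (λ p → ¬? (proj₁ p ≟ y)) {(y , u)} {σ} (λ n → n refl)

dropS-≢ : ∀ {x y} u σ → x ≢ y → dropS y ((x , u) ∷ σ) ≡ (x , u) ∷ dropS y σ
dropS-≢ {x} {y} u σ = filter-accept (λ p → ¬? (proj₁ p ≟ y)) {(x , u)} {σ}

look-drop-≡ : ∀ y σ → look (dropS y σ) y ≡ ` y
look-drop-≡ y [] = refl
look-drop-≡ y ((x , u) ∷ σ) = step (x ≟ y)
  where
  step : Dec (x ≡ y) → look (dropS y ((x , u) ∷ σ)) y ≡ ` y
  step (yes refl) = trans (cong (λ τ → look τ y) (dropS-≡ y u σ)) (look-drop-≡ y σ)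
  step (no n) = trans (cong (λ τ → look τ y) (dropS-≢ u σ n))
    (trans (look-≢ (λ e → n (sym e))) (look-drop-≡ y σ))

look-drop-≢ : ∀ {y z} σ → z ≢ y → look (dropS y σ) z ≡ look σ z
look-drop-≢ [] n = refl
look-drop-≢ {y} {z} ((x , u) ∷ σ) n = step (x ≟ y) (z ≟ x)
  where
  step : Dec (x ≡ y) → Dec (z ≡ x) → look (dropS y ((x , u) ∷ σ)) z ≡ look ((x , u) ∷ σ) z
  step (yes refl) _ = trans (cong (λ τ → look τ z) (dropS-≡ y u σ)) (trans (look-drop-≢ σ n) (sym (look-≢ n)))
  step (no m) (yes refl) = trans (cong (λ τ → look τ z) (dropS-≢ u σ m)) (trans (look-≡ z u _) (sym (look-≡ z u σ)))
  step (no m) (no k) = trans (cong (λ τ → look τ z) (dropS-≢ u σ m))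
    (trans (look-≢ k) (trans (look-drop-≢ σ n) (sym (look-≢ k))))

look-drop : ∀ y σ τ z → (z ≢ y → look σ z ≡ look τ z) → look (dropS y σ) z ≡ look (dropS y τ) z
look-drop y σ τ z h with z ≟ y
... | yes refl = trans (look-drop-≡ y σ) (sym (look-drop-≡ y τ))
... | no n = trans (look-drop-≢ σ n) (trans (h n) (sym (look-drop-≢ τ n)))

subst-ext : ∀ t {σ τ} → (∀ {z} → z ∈ FV t → look σ z ≡ look τ z) → subst σ t ≡ subst τ t
subst-ext (` x) h = h (here refl)
subst-ext (t · s) h = cong₂ _·_ (subst-ext t (h ∘ ∈-++⁺ˡ)) (subst-ext s (h ∘ ∈-++⁺ʳ (FV t)))
subst-ext (ƛ x ⇒ t) {σ} {τ} h = cong (ƛ x ⇒_) (subst-ext t (λ {z} z∈ → look-drop x σ τ z (λ n → h (∈-remove⁺ z∈ n))))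
subst-ext ⟨ t , s ⟩ h = cong₂ ⟨_,_⟩ (subst-ext t (h ∘ ∈-++⁺ˡ)) (subst-ext s (h ∘ ∈-++⁺ʳ (FV t)))
subst-ext (let⊗ x y s t) {σ} {τ} h = cong₂ (let⊗ x y) (subst-ext s (h ∘ ∈-++⁺ˡ))
  (subst-ext t (λ {z} z∈ → look-drop x (dropS y σ) (dropS y τ) z λ n → look-drop y σ τ z λ m →
     h (∈-++⁺ʳ (FV s) (∈-remove⁺ (∈-remove⁺ z∈ m) n))))

subst-[] : ∀ t → subst [] t ≡ t
subst-[] (` x) = refl
subst-[] (t · s) = cong₂ _·_ (subst-[] t) (subst-[] s)
subst-[] (ƛ x ⇒ t) = cong (ƛ x ⇒_) (subst-[] t)
subst-[] ⟨ t , s ⟩ = cong₂ ⟨_,_⟩ (subst-[] t) (subst-[] s)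
subst-[] (let⊗ x y s t) = cong₂ (let⊗ x y) (subst-[] s) (subst-[] t)

subst-id : ∀ t {σ} → (∀ {z} → z ∈ FV t → look σ z ≡ ` z) → subst σ t ≡ t
subst-id t h = trans (subst-ext t h) (subst-[] t)

subst-∉ : ∀ t {x s} → x ∉ FV t → subst [ x , s ] t ≡ t
subst-∉ t {s = s} x∉ = subst-id t (λ z∈ → look-≢ {u = s} {[]} (λ { refl → x∉ z∈ }))

-- The case `z ≡ y` is exempt: below a binder of `y` the substitution has been restricted by `dropS`
-- and maps `y` to itself.
NC : Subst → Tm → Set
NC σ t = ∀ {y z} → y ∈ BV t → z ≢ y → y ∉ FV (look σ z)

NC-drop : ∀ x σ t u → (∀ {y} → y ∈ BV t → y ∈ BV u) → NC σ u → NC (dropS x σ) t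
NC-drop x σ t u f nc {y} {z} y∈ n with z ≟ x
... | yes refl rewrite look-drop-≡ x σ = λ { (here refl) → n refl }
... | no m rewrite look-drop-≢ σ m = nc (f y∈) n

FVσ : Subst → ℕ → List ℕ
FVσ σ z = FV (look σ z)

FV-subst⁺ : ∀ t {σ} → NC σ t → ∀ {w z} → z ∈ FV t → w ∈ FVσ σ z → w ∈ FV (subst σ t)
FV-subst⁺ (` x) nc (here refl) w∈ = w∈
FV-subst⁺ (t · s) {σ} nc z∈ w∈ with ∈-++⁻ (FV t) z∈
... | inj₁ p = ∈-++⁺ˡ (FV-subst⁺ t {σ} (nc ∘ ∈-++⁺ˡ) p w∈)
... | inj₂ p = ∈-++⁺ʳ _ (FV-subst⁺ s {σ} (nc ∘ ∈-++⁺ʳ (BV t)) p w∈)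
FV-subst⁺ (ƛ x ⇒ t) {σ} nc {w} {z} z∈ w∈ with ∈-remove⁻ (FV t) z∈
... | z∈′ , n = ∈-remove⁺
  (FV-subst⁺ t {dropS x σ} (NC-drop x σ t (ƛ x ⇒ t) there nc) z∈′ (≡.subst (λ q → w ∈ FV q) (sym (look-drop-≢ σ n)) w∈))
  λ { refl → nc (here refl) n w∈ }
FV-subst⁺ ⟨ t , s ⟩ {σ} nc z∈ w∈ with ∈-++⁻ (FV t) z∈
... | inj₁ p = ∈-++⁺ˡ (FV-subst⁺ t {σ} (nc ∘ ∈-++⁺ˡ) p w∈)
... | inj₂ p = ∈-++⁺ʳ _ (FV-subst⁺ s {σ} (nc ∘ ∈-++⁺ʳ (BV t)) p w∈)
FV-subst⁺ (let⊗ x y s t) {σ} nc {w} {z} z∈ w∈ with ∈-++⁻ (FV s) z∈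
... | inj₁ p = ∈-++⁺ˡ (FV-subst⁺ s {σ} (nc ∘ there ∘ there ∘ ∈-++⁺ˡ) p w∈)
... | inj₂ p with ∈-remove⁻ (remove y (FV t)) p
...   | p′ , n with ∈-remove⁻ (FV t) p′
...     | z∈′ , m = ∈-++⁺ʳ _ (∈-remove⁺ (∈-remove⁺
  (FV-subst⁺ t {dropS x (dropS y σ)} (NC-drop x (dropS y σ) t (let⊗ x y s t) (there ∘ there ∘ ∈-++⁺ʳ (BV s)) (NC-drop y σ (let⊗ x y s t) (let⊗ x y s t) id nc)) z∈′
     (≡.subst (λ q → w ∈ FV q) (sym (trans (look-drop-≢ (dropS y σ) n) (look-drop-≢ σ m))) w∈))
   λ { refl → nc (there (here refl)) m w∈ }) λ { refl → nc (here refl) n w∈ })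

FV-subst⁻ : ∀ t {σ w} → w ∈ FV (subst σ t) → ∃[ z ] (z ∈ FV t × w ∈ FVσ σ z)
FV-let⁻ : ∀ x y t {σ w} → w ∈ remove x (remove y (FV (subst (dropS x (dropS y σ)) t))) →
  ∃[ z ] (z ∈ remove x (remove y (FV t)) × w ∈ FVσ σ z)
FV-subst⁻ (` x) w∈ = x , here refl , w∈
FV-subst⁻ (t · s) {σ} w∈ with ∈-++⁻ (FV (subst σ t)) w∈
... | inj₁ p = let z , q , r = FV-subst⁻ t {σ} p in z , ∈-++⁺ˡ q , r
... | inj₂ p = let z , q , r = FV-subst⁻ s {σ} p in z , ∈-++⁺ʳ (FV t) q , r
FV-subst⁻ (ƛ x ⇒ t) {σ} {w} w∈ with ∈-remove⁻ (FV (subst (dropS x σ) t)) w∈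
... | w∈′ , n with FV-subst⁻ t {dropS x σ} w∈′
...   | z , z∈ , r with z ≟ x
...     | yes refl rewrite look-drop-≡ x σ = ⊥-elim (n (∈-[-] r))
...     | no m = z , ∈-remove⁺ z∈ m , ≡.subst (λ q → w ∈ FV q) (look-drop-≢ σ m) r
FV-subst⁻ ⟨ t , s ⟩ {σ} w∈ with ∈-++⁻ (FV (subst σ t)) w∈
... | inj₁ p = let z , q , r = FV-subst⁻ t {σ} p in z , ∈-++⁺ˡ q , r
... | inj₂ p = let z , q , r = FV-subst⁻ s {σ} p in z , ∈-++⁺ʳ (FV t) q , r
FV-subst⁻ (let⊗ x y s t) {σ} {w} w∈ with ∈-++⁻ (FV (subst σ s)) w∈
... | inj₁ p = let z , q , r = FV-subst⁻ s {σ} p in z , ∈-++⁺ˡ q , r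
... | inj₂ p = let z , q , r = FV-let⁻ x y t {σ} p in z , ∈-++⁺ʳ (FV s) q , r
FV-let⁻ x y t {σ} {w} p with ∈-remove⁻ (remove y (FV (subst (dropS x (dropS y σ)) t))) p
... | p′ , n with ∈-remove⁻ (FV (subst (dropS x (dropS y σ)) t)) p′
...   | w∈′ , m with FV-subst⁻ t {dropS x (dropS y σ)} w∈′
...     | z , z∈ , r with z ≟ x
...       | yes refl rewrite look-drop-≡ x (dropS y σ) = ⊥-elim (n (∈-[-] r))
...       | no k with z ≟ y
...         | yes refl rewrite look-drop-≢ (dropS y σ) k | look-drop-≡ y σ = ⊥-elim (m (∈-[-] r))
...         | no j = z , ∈-remove⁺ (∈-remove⁺ z∈ j) k ,
              ≡.subst (λ q → w ∈ FV q) (trans (look-drop-≢ (dropS y σ) k) (look-drop-≢ σ j)) r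

LinS : Subst → Tm → Set
LinS σ t = (∀ {z} → z ∈ FV t → Lin (look σ z)) ×
  (∀ {z z′} → z ∈ FV t → z′ ∈ FV t → z ≢ z′ → Disj (FVσ σ z) (FVσ σ z′))

LinS-drop : ∀ σ x t → NC σ (ƛ x ⇒ t) →
  (∀ {z} → z ∈ FV t → z ≢ x → Lin (look σ z)) →
  (∀ {z z′} → z ∈ FV t → z ≢ x → z′ ∈ FV t → z′ ≢ x → z ≢ z′ → Disj (FVσ σ z) (FVσ σ z′)) →
  LinS (dropS x σ) t
LinS-drop σ x t nc h₁ h₂ = f , g
  where
  f : ∀ {z} → z ∈ FV t → Lin (look (dropS x σ) z)
  f {z} z∈ with z ≟ x
  ... | yes refl rewrite look-drop-≡ x σ = tt
  ... | no n rewrite look-drop-≢ σ n = h₁ z∈ n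
  g : ∀ {z z′} → z ∈ FV t → z′ ∈ FV t → z ≢ z′ → Disj (FVσ (dropS x σ) z) (FVσ (dropS x σ) z′)
  g {z} {z′} z∈ z∈′ ne with z ≟ x | z′ ≟ x
  ... | yes refl | yes refl = ⊥-elim (ne refl)
  ... | yes refl | no m rewrite look-drop-≡ x σ | look-drop-≢ σ m = λ { (here refl) q → nc (here refl) m q }
  ... | no n | yes refl rewrite look-drop-≡ x σ | look-drop-≢ σ n = λ { q (here refl) → nc (here refl) n q }
  ... | no n | no m rewrite look-drop-≢ σ n | look-drop-≢ σ m = h₂ z∈ n z∈′ m ne

Disj-images : ∀ {σ xs ys w} → Disj xs ys →
  (∀ {z z′} → z ∈ xs ++ ys → z′ ∈ xs ++ ys → z ≢ z′ → Disj (FVσ σ z) (FVσ σ z′)) →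
  ∃[ z ] (z ∈ xs × w ∈ FVσ σ z) → ∃[ z ] (z ∈ ys × w ∈ FVσ σ z) → ⊥
Disj-images {xs = xs} d k (z , z∈ , r) (z′ , z∈′ , r′) =
  k (∈-++⁺ˡ z∈) (∈-++⁺ʳ xs z∈′) (λ { refl → d z∈ z∈′ }) r r′

Lin-subst : ∀ t {σ} → Lin t → NC σ t → LinS σ t → Lin (subst σ t)
Lin-subst (` x) l nc (h , _) = h (here refl)
Lin-subst (t · s) {σ} (l , m , d) nc (h , k) =
  Lin-subst t {σ} l (nc ∘ ∈-++⁺ˡ) (h ∘ ∈-++⁺ˡ , λ p q → k (∈-++⁺ˡ p) (∈-++⁺ˡ q)) ,
  Lin-subst s {σ} m (nc ∘ ∈-++⁺ʳ (BV t)) (h ∘ ∈-++⁺ʳ (FV t) , λ p q → k (∈-++⁺ʳ (FV t) p) (∈-++⁺ʳ (FV t) q)) ,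
  λ p q → Disj-images {σ} d k (FV-subst⁻ t {σ} p) (FV-subst⁻ s {σ} q)
Lin-subst (ƛ x ⇒ t) {σ} (l , x∈) nc (h , k) =
  Lin-subst t {dropS x σ} l (NC-drop x σ t (ƛ x ⇒ t) there nc)
    (LinS-drop σ x t nc (λ p n → h (∈-remove⁺ p n)) (λ p n q m → k (∈-remove⁺ p n) (∈-remove⁺ q m))) ,
  FV-subst⁺ t {dropS x σ} (NC-drop x σ t (ƛ x ⇒ t) there nc) x∈ (≡.subst (λ q → x ∈ FV q) (sym (look-drop-≡ x σ)) (here refl))
Lin-subst ⟨ t , s ⟩ {σ} (l , m , d) nc (h , k) =
  Lin-subst t {σ} l (nc ∘ ∈-++⁺ˡ) (h ∘ ∈-++⁺ˡ , λ p q → k (∈-++⁺ˡ p) (∈-++⁺ˡ q)) ,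
  Lin-subst s {σ} m (nc ∘ ∈-++⁺ʳ (BV t)) (h ∘ ∈-++⁺ʳ (FV t) , λ p q → k (∈-++⁺ʳ (FV t) p) (∈-++⁺ʳ (FV t) q)) ,
  λ p q → Disj-images {σ} d k (FV-subst⁻ t {σ} p) (FV-subst⁻ s {σ} q)
Lin-subst (let⊗ x y s t) {σ} (l , m , x≢y , x∈ , y∈ , d) nc (h , k) =
  Lin-subst s {σ} l (nc ∘ there ∘ there ∘ ∈-++⁺ˡ) (h ∘ ∈-++⁺ˡ , λ p q → k (∈-++⁺ˡ p) (∈-++⁺ˡ q)) ,
  Lin-subst t {dropS x (dropS y σ)} m nct (LinS-drop (dropS y σ) x t ncx f₁ f₂) ,
  x≢y ,
  FV-subst⁺ t {dropS x (dropS y σ)} nct x∈ (≡.subst (λ q → x ∈ FV q) (sym (look-drop-≡ x (dropS y σ))) (here refl)) ,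
  FV-subst⁺ t {dropS x (dropS y σ)} nct y∈ (≡.subst (λ q → y ∈ FV q)
    (sym (trans (look-drop-≢ (dropS y σ) (λ e → x≢y (sym e))) (look-drop-≡ y σ))) (here refl)) ,
  dd
  where
  nct : NC (dropS x (dropS y σ)) t
  nct = NC-drop x (dropS y σ) t (let⊗ x y s t) (there ∘ there ∘ ∈-++⁺ʳ (BV s)) (NC-drop y σ (let⊗ x y s t) (let⊗ x y s t) id nc)
  ncx : NC (dropS y σ) (ƛ x ⇒ t)
  ncx = NC-drop y σ (ƛ x ⇒ t) (let⊗ x y s t) (λ { (here e) → here e ; (there q) → there (there (∈-++⁺ʳ (BV s) q)) }) nc
  ncy : NC σ (ƛ y ⇒ t)
  ncy = λ { (here e) → nc (there (here e)) ; (there q) → nc (there (there (∈-++⁺ʳ (BV s) q))) }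
  ∈l : ∀ {z} → z ∈ FV t → z ≢ x → z ≢ y → z ∈ FV (let⊗ x y s t)
  ∈l z∈ n n′ = ∈-++⁺ʳ (FV s) (∈-remove⁺ (∈-remove⁺ z∈ n′) n)
  f₁ : ∀ {z} → z ∈ FV t → z ≢ x → Lin (look (dropS y σ) z)
  f₁ {z} z∈ n with z ≟ y
  ... | yes refl rewrite look-drop-≡ y σ = tt
  ... | no n′ rewrite look-drop-≢ σ n′ = h (∈l z∈ n n′)
  f₂ : ∀ {z z′} → z ∈ FV t → z ≢ x → z′ ∈ FV t → z′ ≢ x → z ≢ z′ →
       Disj (FVσ (dropS y σ) z) (FVσ (dropS y σ) z′)
  f₂ {z} {z′} z∈ n z∈′ n₂ ne with z ≟ y | z′ ≟ y
  ... | yes refl | yes refl = ⊥-elim (ne refl)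
  ... | yes refl | no b rewrite look-drop-≡ y σ | look-drop-≢ σ b = λ { (here refl) q → ncy (here refl) b q }
  ... | no a | yes refl rewrite look-drop-≡ y σ | look-drop-≢ σ a = λ { q (here refl) → ncy (here refl) a q }
  ... | no a | no b rewrite look-drop-≢ σ a | look-drop-≢ σ b = k (∈l z∈ n a) (∈l z∈′ n₂ b) ne
  dd : Disj (FV (subst σ s)) (remove x (remove y (FV (subst (dropS x (dropS y σ)) t))))
  dd p q = Disj-images {σ} d k (FV-subst⁻ s {σ} p) (FV-let⁻ x y t {σ} q)

HasTy-subst : ∀ t {σ E E′ A} → NC σ t → HasTy E′ t A →
  (∀ {z} → z ∈ FV t → HasTy E (look σ z) (E′ z)) → HasTy E (subst σ t) A
HasTy-subst-drop : ∀ x {xs σ E E′ A} → (∀ {z} → z ≢ x → x ∉ FVσ σ z) →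
  (∀ {z} → z ∈ xs → z ≢ x → HasTy E (look σ z) (E′ z)) → ∀ {z} → z ∈ xs →
  HasTy (upd E x A) (look (dropS x σ) z) (upd E′ x A z)
HasTy-subst-drop x {σ = σ} {E} {E′} {A} nx h {z} z∈ with z ≟ x
... | yes refl rewrite look-drop-≡ x σ = var (upd-≡ E x A)
... | no n rewrite look-drop-≢ σ n = HasTy-ext (λ w∈ → sym (upd-≢ E x A (λ { refl → nx n w∈ }))) (h z∈ n)
HasTy-subst (` x) nc (var refl) h = h (here refl)
HasTy-subst (t · s) {σ} nc (app d e) h = app (HasTy-subst t {σ} (nc ∘ ∈-++⁺ˡ) d (h ∘ ∈-++⁺ˡ))
  (HasTy-subst s {σ} (nc ∘ ∈-++⁺ʳ (BV t)) e (h ∘ ∈-++⁺ʳ (FV t)))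
HasTy-subst (ƛ x ⇒ t) {σ} nc (lam d) h =
  lam (HasTy-subst t {dropS x σ} (NC-drop x σ t (ƛ x ⇒ t) there nc) d
    (HasTy-subst-drop x {σ = σ} (nc (here refl)) (λ z∈ n → h (∈-remove⁺ z∈ n))))
HasTy-subst ⟨ t , s ⟩ {σ} nc (pair d e) h = pair (HasTy-subst t {σ} (nc ∘ ∈-++⁺ˡ) d (h ∘ ∈-++⁺ˡ))
  (HasTy-subst s {σ} (nc ∘ ∈-++⁺ʳ (BV t)) e (h ∘ ∈-++⁺ʳ (FV t)))
HasTy-subst (let⊗ x y s t) {σ} nc (letp d e) h =
  letp (HasTy-subst s {σ} (nc ∘ there ∘ there ∘ ∈-++⁺ˡ) d (h ∘ ∈-++⁺ˡ))
    (HasTy-subst t {dropS x (dropS y σ)} nct e (HasTy-subst-drop x {σ = dropS y σ} (ncy (here refl)) (λ z∈ n →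
      HasTy-subst-drop y {remove x (FV t)} {σ} (nc (there (here refl)))
        (λ z∈ m → let p , k = ∈-remove⁻ (FV t) z∈ in h (∈-++⁺ʳ (FV s) (∈-remove⁺ (∈-remove⁺ p m) k)))
        (∈-remove⁺ z∈ n))))
  where
  ncy : NC (dropS y σ) (let⊗ x y s t)
  ncy = NC-drop y σ (let⊗ x y s t) (let⊗ x y s t) id nc
  nct : NC (dropS x (dropS y σ)) t
  nct = NC-drop x (dropS y σ) t (let⊗ x y s t) (there ∘ there ∘ ∈-++⁺ʳ (BV s)) ncy

_∈?_ : ∀ (x : ℕ) xs → Dec (x ∈ xs)
x ∈? [] = no λ ()
x ∈? (y ∷ xs) with x ≟ y
... | yes e = yes (here e)
... | no n with x ∈? xs
...   | yes p = yes (there p)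
...   | no q  = no (∉-∷ n q)

-- Subject expansion

-- Linearity makes the free variables of the two parts of a term disjoint, so environments found
-- separately for the parts can be merged into one for the whole.
glue : List ℕ → (ℕ → Ty) → (ℕ → Ty) → ℕ → Ty
glue xs E E′ z with z ∈? xs
... | yes _ = E z
... | no _  = E′ z

glue-∈ : ∀ {xs E E′ z} → z ∈ xs → glue xs E E′ z ≡ E z
glue-∈ {xs} {z = z} z∈ with z ∈? xs
... | yes _ = refl
... | no n  = ⊥-elim (n z∈)

glue-∉ : ∀ {xs E E′ z} → z ∉ xs → glue xs E E′ z ≡ E′ z
glue-∉ {xs} {z = z} z∉ with z ∈? xs
... | yes p = ⊥-elim (z∉ p)
... | no _  = refl

Types : (ℕ → Ty) → Subst → List ℕ → (ℕ → Ty) → Set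
Types E σ xs E′ = ∀ {z} → z ∈ xs → HasTy E (look σ z) (E′ z)

glue-Types : ∀ {xs ys E σ E₁ E₂} → Disj xs ys → Types E σ xs E₁ → Types E σ ys E₂ →
  Types E σ (xs ++ ys) (glue xs E₁ E₂)
glue-Types {xs} d h₁ h₂ z∈ with ∈-++⁻ xs z∈
... | inj₁ p = ≡.subst (HasTy _ _) (sym (glue-∈ p)) (h₁ p)
... | inj₂ p = ≡.subst (HasTy _ _) (sym (glue-∉ (λ q → d q p))) (h₂ p)

HasTy-glueˡ : ∀ {E₁ E₂ t A} → HasTy E₁ t A → HasTy (glue (FV t) E₁ E₂) t A
HasTy-glueˡ = HasTy-ext (λ z∈ → sym (glue-∈ z∈))

HasTy-glueʳ : ∀ {xs E₁ E₂ t A} → Disj xs (FV t) → HasTy E₂ t A → HasTy (glue xs E₁ E₂) t A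
HasTy-glueʳ d = HasTy-ext (λ z∈ → sym (glue-∉ (λ q → d q z∈)))

-- Subject expansion: linearity makes the types of the substituted terms
-- recoverable, since every variable of t has exactly one occurrence.
HasTy-subst⁻ : ∀ t {σ E A} → Lin t → NC σ t → HasTy E (subst σ t) A →
  ∃[ E′ ] (Types E σ (FV t) E′ × HasTy E′ t A)
-- The binder case. `dropS` maps `x` to itself, so the occurrence of `x` guaranteed by linearity
-- forces its type in `E′` to be that of the binder.
HasTy-drop⁻ : ∀ x xs {σ E E′ A} → x ∈ xs → (∀ {z} → z ≢ x → x ∉ FVσ σ z) →
  (∀ {z} → z ∈ xs → HasTy (upd E x A) (look (dropS x σ) z) (E′ z)) →
  E′ x ≡ A × (∀ {z} → z ∈ xs → z ≢ x → HasTy E (look σ z) (E′ z))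
HasTy-drop⁻ x xs {σ} {E} {E′} {A} x∈ nx h = f , g
  where
  f : E′ x ≡ A
  f with h x∈
  ... | d rewrite look-drop-≡ x σ with d
  ...   | var e = trans (sym e) (upd-≡ E x A)
  g : ∀ {z} → z ∈ xs → z ≢ x → HasTy E (look σ z) (E′ z)
  g z∈ n with h z∈
  ... | d rewrite look-drop-≢ σ n = HasTy-ext (λ w∈ → upd-≢ E x A (λ { refl → nx n w∈ })) d
upd-self : ∀ {E : ℕ → Ty} {x A z} → E x ≡ A → E z ≡ upd E x A z
upd-self {x = x} {z = z} e with z ≟ x
... | yes refl = e
... | no _ = refl
HasTy-subst⁻ (` x) {A = A} l nc d = (λ _ → A) , (λ { (here refl) → d }) , var refl
HasTy-subst⁻ (t · s) {σ} (l , m , dj) nc (app d e)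
  with HasTy-subst⁻ t {σ} l (nc ∘ ∈-++⁺ˡ) d | HasTy-subst⁻ s {σ} m (nc ∘ ∈-++⁺ʳ (BV t)) e
... | E₁ , h , d′ | E₂ , k , e′ = glue (FV t) E₁ E₂ , glue-Types {σ = σ} dj h k , app (HasTy-glueˡ d′) (HasTy-glueʳ dj e′)
HasTy-subst⁻ (ƛ x ⇒ t) {σ} {E} (l , x∈) nc (lam d) with HasTy-subst⁻ t {dropS x σ} l (NC-drop x σ t (ƛ x ⇒ t) there nc) d
... | E′ , h , d′ with HasTy-drop⁻ x (FV t) {σ} {E} {E′} x∈ (nc (here refl)) h
...   | refl , g = E′ , (λ z∈ → let p , n = ∈-remove⁻ (FV t) z∈ in g p n) , lam (HasTy-ext (λ _ → upd-self {E′} refl) d′)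
HasTy-subst⁻ ⟨ t , s ⟩ {σ} (l , m , dj) nc (pair d e)
  with HasTy-subst⁻ t {σ} l (nc ∘ ∈-++⁺ˡ) d | HasTy-subst⁻ s {σ} m (nc ∘ ∈-++⁺ʳ (BV t)) e
... | E₁ , h , d′ | E₂ , k , e′ = glue (FV t) E₁ E₂ , glue-Types {σ = σ} dj h k , pair (HasTy-glueˡ d′) (HasTy-glueʳ dj e′)
HasTy-subst⁻ (let⊗ x y s t) {σ} {E} (l , m , x≢y , x∈ , y∈ , dj) nc (letp {A = A} {B} d e)
  with HasTy-subst⁻ s {σ} l (nc ∘ there ∘ there ∘ ∈-++⁺ˡ) d
     | HasTy-subst⁻ t {dropS x (dropS y σ)} m (NC-drop x (dropS y σ) t (let⊗ x y s t) (there ∘ there ∘ ∈-++⁺ʳ (BV s))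
         (NC-drop y σ (let⊗ x y s t) (let⊗ x y s t) id nc)) e
... | E₁ , h , d′ | E₂ , k , e′
  with HasTy-drop⁻ x (FV t) {dropS y σ} {upd E y B} {E₂} x∈ (NC-drop y σ (let⊗ x y s t) (let⊗ x y s t) id nc (here refl)) k
...   | refl , g with HasTy-drop⁻ y (remove x (FV t)) {σ} {E} {E₂} (∈-remove⁺ y∈ (λ e → x≢y (sym e))) (nc (there (here refl)))
                     (λ z∈ → let p , n = ∈-remove⁻ (FV t) z∈ in g p n)
...     | refl , g′ = glue (FV s) E₁ E₂ ,
  glue-Types {σ = σ} dj h (λ z∈ → let p , n = ∈-remove⁻ (remove y (FV t)) z∈ ; q , m = ∈-remove⁻ (FV t) p in g′ (∈-remove⁺ q n) m) ,
  letp (HasTy-glueˡ d′) (HasTy-ext ext e′)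
  where
  ext : ∀ {z} → z ∈ FV t → E₂ z ≡ upd (upd (glue (FV s) E₁ E₂) y (E₂ y)) x (E₂ x) z
  ext {z} z∈ with z ≟ x
  ... | yes refl = refl
  ... | no n with z ≟ y
  ...   | yes refl = refl
  ...   | no n′ = sym (glue-∉ (λ p → dj p (∈-remove⁺ (∈-remove⁺ z∈ n′) n)))

-- Typing-preserving expansion and β-equality

infix 4 _⊒_ _≋_ _⊆ᶠ_

-- t ⊒ t′: every typing of t′ is a typing of t and the two are then equal.
-- Linear β-expansion has this property, so untyped computation with ⊒
-- delivers the typings that poly-typability asks for.
_⊒_ : Tm → Tm → Set
t ⊒ t′ = ∀ {Γ A} → Γ ⊢ t′ ∶ A → Γ ⊢ t ≈ t′ ∶ A

_≋_ : Tm → Tm → Set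
t ≋ t′ = (t ⊒ t′) × (t′ ⊒ t)

⊒-refl : ∀ {t} → t ⊒ t
⊒-refl = ≈refl

⊒-trans : ∀ {t u v} → t ⊒ u → u ⊒ v → t ⊒ v
⊒-trans p q d = ≈trans (p (≈⇒ˡ (q d))) (q d)

⊒-reflexive : ∀ {t u} → t ≡ u → t ⊒ u
⊒-reflexive refl = ≈refl

⊒-app : ∀ {t t′ s s′} → t ⊒ t′ → s ⊒ s′ → t · s ⊒ t′ · s′
⊒-app p q d with inv-app d
... | _ , _ , _ , r , u , d₁ , d₂ = ≈perm r (≈app (p d₁) (q d₂) u)

⊒-appˡ : ∀ {t t′ s} → t ⊒ t′ → t · s ⊒ t′ · s
⊒-appˡ p = ⊒-app p ⊒-refl

⊒-appʳ : ∀ {t s s′} → s ⊒ s′ → t · s ⊒ t · s′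
⊒-appʳ {t} q = ⊒-app {t} ⊒-refl q

⊒-lam : ∀ {x t t′} → t ⊒ t′ → ƛ x ⇒ t ⊒ ƛ x ⇒ t′
⊒-lam p d with inv-lam d
... | _ , _ , refl , d₁ = ≈lam (p d₁)

⊒-pair : ∀ {t t′ s s′} → t ⊒ t′ → s ⊒ s′ → ⟨ t , s ⟩ ⊒ ⟨ t′ , s′ ⟩
⊒-pair p q d with inv-pair d
... | _ , _ , _ , _ , refl , r , u , d₁ , d₂ = ≈perm r (≈pair (p d₁) (q d₂) u)

⊒-let : ∀ {x y t t′ s s′} → s ⊒ s′ → t ⊒ t′ → let⊗ x y s t ⊒ let⊗ x y s′ t′
⊒-let p q d with inv-let d
... | _ , _ , _ , _ , r , u , d₁ , d₂ = ≈perm r (≈let (p d₁) (q d₂) u)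

≋-sym : ∀ {t u} → t ≋ u → u ≋ t
≋-sym (p , q) = q , p

≋-refl : ∀ {t} → t ≋ t
≋-refl = ≈refl , ≈refl

≋-trans : ∀ {t u v} → t ≋ u → u ≋ v → t ≋ v
≋-trans {t} {u} {v} (p , p′) (q , q′) = ⊒-trans {t} {u} {v} p q , ⊒-trans {v} {u} {t} q′ p′

infix  3 _∎ _∎⊒
infixr 2 _≋⟨_⟩_ _⊒⟨_⟩_

_≋⟨_⟩_ : ∀ t {u v} → t ≋ u → u ≋ v → t ≋ v
_≋⟨_⟩_ t {u} {v} p q = ≋-trans {t} {u} {v} p q

_∎ : ∀ t → t ≋ t
t ∎ = ≋-refl {t}

_⊒⟨_⟩_ : ∀ t {u v} → t ⊒ u → u ⊒ v → t ⊒ v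
_⊒⟨_⟩_ t {u} {v} p q = ⊒-trans {t} {u} {v} p q

_∎⊒ : ∀ t → t ⊒ t
t ∎⊒ = ⊒-refl {t}

≋-app : ∀ {t t′ s s′} → t ≋ t′ → s ≋ s′ → t · s ≋ t′ · s′
≋-app (p , p′) (q , q′) = ⊒-app p q , ⊒-app p′ q′

≋-appˡ : ∀ {t t′ s} → t ≋ t′ → t · s ≋ t′ · s
≋-appˡ {s = s} p = ≋-app p (≋-refl {s})

≋-appʳ : ∀ {t s s′} → s ≋ s′ → t · s ≋ t · s′
≋-appʳ {t} p = ≋-app (≋-refl {t}) p

≋-lam : ∀ {x t t′} → t ≋ t′ → ƛ x ⇒ t ≋ ƛ x ⇒ t′
≋-lam (p , p′) = ⊒-lam p , ⊒-lam p′

≋-pair : ∀ {t t′ s s′} → t ≋ t′ → s ≋ s′ → ⟨ t , s ⟩ ≋ ⟨ t′ , s′ ⟩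
≋-pair (p , p′) (q , q′) = ⊒-pair p q , ⊒-pair p′ q′

≋-let : ∀ {x y t t′ s s′} → s ≋ s′ → t ≋ t′ → let⊗ x y s t ≋ let⊗ x y s′ t′
≋-let (p , p′) (q , q′) = ⊒-let p q , ⊒-let p′ q′

_⊆ᶠ_ : Tm → Tm → Set
t ⊆ᶠ s = ∀ {z} → z ∈ FV t → z ∈ FV s

transfer : ∀ {t t′ Γ A} → (Lin t′ → Lin t) → t ⊆ᶠ t′ → t′ ⊆ᶠ t →
  (∀ {E A} → HasTy E t′ A → HasTy E t A) → Γ ⊢ t′ ∶ A → Γ ⊢ t ∶ A
transfer {t} {t′} {Γ} l f g h d = mk⊢ (l l′)
  (↭-trans (↭-extensional (Lin⇒Unique t (l l′)) (Lin⇒Unique t′ l′) f g) (proj₂ (names-FV d)))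
  a (h (⊢⇒HasTy d a))
  where
  l′ = proj₁ (names-FV d)
  a = Agrees-envOf Γ (⊢-Unique d)

-- Reduces a basic equation to conditions on raw terms: equivalent linearity, the same free
-- variables, the same types in every environment. Contexts and exchange no longer appear.
raw⇒≋ : ∀ {t t′} → (Lin t → Lin t′) → (Lin t′ → Lin t) → t ⊆ᶠ t′ → t′ ⊆ᶠ t →
  (∀ {E A} → HasTy E t A → HasTy E t′ A) → (∀ {E A} → HasTy E t′ A → HasTy E t A) →
  t ~ t′ → t ≋ t′
raw⇒≋ l l′ f f′ h h′ r =
  (λ d → ≈ax (transfer l′ f f′ h′ d) d r) , (λ d → ≈sym (≈ax d (transfer l f′ f h d) r))

[_↦_] : ℕ → Tm → Subst
[ x ↦ s ] = [ (x , s) ]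

look-↦ : ∀ {x s} {P : ℕ → Tm → Set} → P x s → (∀ {z} → z ≢ x → P z (` z)) → ∀ z → P z (look [ x ↦ s ] z)
look-↦ {x} p q z with z ≟ x
... | yes refl = p
... | no n = q n

NC-↦ : ∀ {x s} t → NoCapture t s → NC [ x ↦ s ] t
NC-↦ {x} {s} t nc {y} {z} y∈ = look-↦ {x} {s} {λ z u → z ≢ y → y ∉ FV u}
  (λ _ → All.lookup nc y∈) (λ { _ n (here refl) → n refl }) z

-- Types pass to the reduct by substitution and back by subject expansion; linearity supplies the
-- occurrence of `x` from which the type of `s` is read off.
β≋ : ∀ {x t s} → Lin ((ƛ x ⇒ t) · s) → NoCapture t s → (ƛ x ⇒ t) · s ≋ subst [ x ↦ s ] t
β≋ {x} {t} {s} l₀@((l , x∈) , m , d) nc = raw⇒≋ (λ _ → l′) (λ _ → l₀) f f′ h h′ (β nc)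
  where
  σ = [ x ↦ s ]
  N = NC-↦ {x} {s} t nc
  at-x : look σ x ≡ s
  at-x = look-≡ x s []
  at : ∀ {z} → z ≢ x → look σ z ≡ ` z
  at n = look-≢ {u = s} {[]} n
  dj : ∀ {z z′} → z ∈ FV t → z′ ∈ FV t → z ≢ z′ → Disj (FVσ σ z) (FVσ σ z′)
  dj {z} {z′} z∈ z∈′ n with z ≟ x | z′ ≟ x
  ... | yes refl | yes refl = ⊥-elim (n refl)
  ... | yes refl | no k = λ { p (here refl) → d (∈-remove⁺ z∈′ k) p }
  ... | no k | yes refl = λ { (here refl) p → d (∈-remove⁺ z∈ k) p }
  ... | no _ | no _ = λ { (here refl) (here refl) → n refl }
  l′ : Lin (subst σ t)
  l′ = Lin-subst t {σ} l N ((λ {z} _ → look-↦ {x} {s} {λ _ u → Lin u} m (λ _ → tt) z) , dj)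
  f : (ƛ x ⇒ t) · s ⊆ᶠ subst σ t
  f {w} w∈ with ∈-++⁻ (remove x (FV t)) w∈
  ... | inj₁ p = let q , n = ∈-remove⁻ (FV t) p in
        FV-subst⁺ t {σ} N q (≡.subst (λ u → w ∈ FV u) (sym (at n)) (here refl))
  ... | inj₂ p = FV-subst⁺ t {σ} N x∈ (≡.subst (λ u → w ∈ FV u) (sym at-x) p)
  f′ : subst σ t ⊆ᶠ (ƛ x ⇒ t) · s
  f′ {w} w∈ with FV-subst⁻ t {σ} w∈
  ... | z , z∈ , r with z ≟ x
  ...   | yes refl = ∈-++⁺ʳ _ r
  ...   | no n with r
  ...     | here refl = ∈-++⁺ˡ (∈-remove⁺ z∈ n)
  h : ∀ {E A} → HasTy E ((ƛ x ⇒ t) · s) A → HasTy E (subst σ t) A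
  h {E} (app (lam {A = A} d) e) = HasTy-subst t {σ} N d (λ {z} _ →
    look-↦ {x} {s} {λ z u → HasTy E u (upd E x A z)}
      (≡.subst (HasTy E s) (sym (upd-≡ E x A)) e) (λ n → var (sym (upd-≢ E x A n))) z)
  h′ : ∀ {E A} → HasTy E (subst σ t) A → HasTy E ((ƛ x ⇒ t) · s) A
  h′ {E} d with HasTy-subst⁻ t {σ} l N d
  ... | E′ , k , d′ = app (lam (HasTy-ext ext d′)) (≡.subst (λ u → HasTy E u (E′ x)) at-x (k x∈))
    where
    ext : ∀ {z} → z ∈ FV t → E′ z ≡ upd E x (E′ x) z
    ext {z} z∈ with z ≟ x | k z∈
    ... | yes refl | _ = refl
    ... | no n | var e = sym e

-- Renaming of binders

BV-rename : ∀ t {σ} → (∀ z → BV (look σ z) ≡ []) → BV (subst σ t) ≡ BV t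
BV-rename-drop : ∀ x σ → (∀ z → BV (look σ z) ≡ []) → ∀ z → BV (look (dropS x σ) z) ≡ []
BV-rename-drop x σ h z with z ≟ x
... | yes refl rewrite look-drop-≡ x σ = refl
... | no n rewrite look-drop-≢ σ n = h z
BV-rename (` x) h = h x
BV-rename (t · s) {σ} h = cong₂ _++_ (BV-rename t {σ} h) (BV-rename s {σ} h)
BV-rename (ƛ x ⇒ t) {σ} h = cong (x ∷_) (BV-rename t {dropS x σ} (BV-rename-drop x σ h))
BV-rename ⟨ t , s ⟩ {σ} h = cong₂ _++_ (BV-rename t {σ} h) (BV-rename s {σ} h)
BV-rename (let⊗ x y s t) {σ} h = cong (λ l → x ∷ y ∷ l)
  (cong₂ _++_ (BV-rename s {σ} h)
    (BV-rename t {dropS x (dropS y σ)} (BV-rename-drop x (dropS y σ) (BV-rename-drop y σ h))))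

-- Injectivity is only demanded on the free variables of `t`: the map that sends `x` to `x′` and
-- fixes everything else identifies these two names, so it is not injective on all of them.
record Renames (σ : Subst) (t : Tm) (ρ : ℕ → ℕ) : Set where
  field
    look-ρ   : ∀ z → look σ z ≡ ` ρ z
    avoids   : ∀ {y z} → y ∈ BV t → z ≢ y → ρ z ≢ y
    injective : ∀ {z z′} → z ∈ FV t → z′ ∈ FV t → ρ z ≡ ρ z′ → z ≡ z′

module Renaming {σ : Subst} {t : Tm} {ρ : ℕ → ℕ} (R : Renames σ t ρ) where
  open Renames R

  N : NC σ t
  N {y} {z} y∈ n p with ≡.subst (λ u → y ∈ FV u) (look-ρ z) p
  ... | here refl = avoids y∈ n refl

  FV⁺ : ∀ {z} → z ∈ FV t → ρ z ∈ FV (subst σ t)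
  FV⁺ {z} z∈ = FV-subst⁺ t {σ} N z∈ (≡.subst (λ u → ρ z ∈ FV u) (sym (look-ρ z)) (here refl))

  FV⁻ : ∀ {w} → w ∈ FV (subst σ t) → ∃[ z ] (z ∈ FV t × w ≡ ρ z)
  FV⁻ {w} p with FV-subst⁻ t {σ} p
  ... | z , z∈ , q with ≡.subst (λ u → w ∈ FV u) (look-ρ z) q
  ...   | here refl = z , z∈ , refl

  lin : Lin t → Lin (subst σ t)
  lin l = Lin-subst t {σ} l N ((λ {z} _ → ≡.subst Lin (sym (look-ρ z)) tt) ,
    λ {z} {z′} p q n {w} a b → n (injective p q
      (trans (sym (∈-[-] (≡.subst (λ u → w ∈ FV u) (look-ρ z) a))) (∈-[-] (≡.subst (λ u → w ∈ FV u) (look-ρ z′) b)))))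

  ty⁺ : ∀ {E E′ A} → HasTy E′ t A → (∀ {z} → z ∈ FV t → E (ρ z) ≡ E′ z) → HasTy E (subst σ t) A
  ty⁺ {E} {E′} d h = HasTy-subst t {σ} N d (λ {z} p → ≡.subst (λ u → HasTy E u (E′ z)) (sym (look-ρ z)) (var (h p)))

  ty⁻ : ∀ {E A} → Lin t → HasTy E (subst σ t) A → ∀ {E′} → (∀ {z} → z ∈ FV t → E (ρ z) ≡ E′ z) → HasTy E′ t A
  ty⁻ {E} l d {E′} h with HasTy-subst⁻ t {σ} l N d
  ... | E″ , k , d′ = HasTy-ext (λ {z} z∈ → g z z∈ (≡.subst (λ u → HasTy E u (E″ z)) (look-ρ z) (k z∈))) d′
    where
    g : ∀ z → z ∈ FV t → HasTy E (` ρ z) (E″ z) → E″ z ≡ E′ z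
    g z z∈ (var e) = trans (sym e) (h z∈)

ren₁ : ℕ → ℕ → ℕ → ℕ
ren₁ x x′ z with z ≟ x
... | yes _ = x′
... | no _  = z

ren₁-≡ : ∀ x x′ → ren₁ x x′ x ≡ x′
ren₁-≡ x x′ with x ≟ x
... | yes _ = refl
... | no n = ⊥-elim (n refl)

ren₁-≢ : ∀ {x x′ z} → z ≢ x → ren₁ x x′ z ≡ z
ren₁-≢ {x} {z = z} n with z ≟ x
... | yes p = ⊥-elim (n p)
... | no _ = refl

∈Vars : ∀ t {z} → z ∉ Vars t → z ∉ FV t × z ∉ BV t
∈Vars t n = n ∘ ∈-++⁺ˡ , n ∘ ∈-++⁺ʳ (FV t)

rename₁ : ∀ {x x′ t} → x′ ∉ Vars t → Renames [ x ↦ ` x′ ] t (ren₁ x x′)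
rename₁ {x} {x′} {t} n = record { look-ρ = lk ; avoids = av ; injective = λ {z} {z′} → inj {z} {z′} }
  where
  lk : ∀ z → look [ x ↦ ` x′ ] z ≡ ` ren₁ x x′ z
  lk z with z ≟ x
  ... | yes _ = refl
  ... | no _ = refl
  av : ∀ {y z} → y ∈ BV t → z ≢ y → ren₁ x x′ z ≢ y
  av {y} {z} y∈ m with z ≟ x
  ... | yes _ = λ { refl → proj₂ (∈Vars t n) y∈ }
  ... | no _ = m
  inj : ∀ {z z′} → z ∈ FV t → z′ ∈ FV t → ren₁ x x′ z ≡ ren₁ x x′ z′ → z ≡ z′
  inj {z} {z′} p q e with z ≟ x | z′ ≟ x
  ... | yes refl | yes refl = refl
  ... | yes refl | no _ = ⊥-elim (proj₁ (∈Vars t n) (≡.subst (_∈ FV t) (sym e) q))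
  ... | no _ | yes refl = ⊥-elim (proj₁ (∈Vars t n) (≡.subst (_∈ FV t) e p))
  ... | no _ | no _ = e

α-lam : ∀ {x x′ t} → Lin (ƛ x ⇒ t) → x′ ∉ Vars t → ƛ x ⇒ t ≋ ƛ x′ ⇒ subst [ x ↦ ` x′ ] t
α-lam-Lin : ∀ {x x′ t} → Lin (ƛ x ⇒ t) → x′ ∉ Vars t → Lin (ƛ x′ ⇒ subst [ x ↦ ` x′ ] t)
α-lam-⊆ : ∀ {x x′ t} → x′ ∉ Vars t → ƛ x′ ⇒ subst [ x ↦ ` x′ ] t ⊆ᶠ ƛ x ⇒ t
α-lam-⊇ : ∀ {x x′ t} → x′ ∉ Vars t → ƛ x ⇒ t ⊆ᶠ ƛ x′ ⇒ subst [ x ↦ ` x′ ] t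
α-lam-Lin {x} {x′} {t} (l , x∈) n = lin l , ≡.subst (_∈ FV (subst [ x ↦ ` x′ ] t)) (ren₁-≡ x x′) (FV⁺ x∈)
  where open Renaming (rename₁ {x} {x′} {t} n)
α-lam-⊆ {x} {x′} {t} n {w} w∈ with ∈-remove⁻ (FV (subst [ x ↦ ` x′ ] t)) w∈
... | p , m with Renaming.FV⁻ (rename₁ {x} {x′} {t} n) p
...   | z , z∈ , e with z ≟ x
...     | yes refl = ⊥-elim (m e)
...     | no k = ≡.subst (_∈ remove x (FV t)) (sym e) (∈-remove⁺ z∈ k)
α-lam-⊇ {x} {x′} {t} n {w} w∈ with ∈-remove⁻ (FV t) w∈
... | p , m = ∈-remove⁺ (≡.subst (_∈ FV (subst [ x ↦ ` x′ ] t)) (ren₁-≢ m) (Renaming.FV⁺ (rename₁ {x} {x′} {t} n) p))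
                (λ { refl → proj₁ (∈Vars t n) p })
α-lam {x} {x′} {t} l n = raw⇒≋ (λ _ → α-lam-Lin l n) (λ _ → l) (α-lam-⊇ {t = t} n) (α-lam-⊆ {t = t} n) h h′ (αlam n)
  where
  open Renaming (rename₁ {x} {x′} {t} n)
  ext : ∀ {E A z} → z ∈ FV t → upd E x′ A (ren₁ x x′ z) ≡ upd E x A z
  ext {E} {A} {z} z∈ with z ≟ x
  ... | yes refl = upd-≡ E x′ A
  ... | no _ = upd-≢ E x′ A (λ { refl → proj₁ (∈Vars t n) z∈ })
  h : ∀ {E A} → HasTy E (ƛ x ⇒ t) A → HasTy E (ƛ x′ ⇒ subst [ x ↦ ` x′ ] t) A
  h (lam d) = lam (ty⁺ d ext)
  h′ : ∀ {E A} → HasTy E (ƛ x′ ⇒ subst [ x ↦ ` x′ ] t) A → HasTy E (ƛ x ⇒ t) A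
  h′ (lam d) = lam (ty⁻ (proj₁ l) d ext)

ren₂ : ℕ → ℕ → ℕ → ℕ → ℕ → ℕ
ren₂ x x′ y y′ z with z ≟ x
... | yes _ = x′
... | no _  = ren₁ y y′ z

[_↦_,_↦_] : ℕ → Tm → ℕ → Tm → Subst
[ x ↦ u , y ↦ v ] = (x , u) ∷ (y , v) ∷ []

rename₂ : ∀ {x x′ y y′ t} → x′ ∉ Vars t → y′ ∉ Vars t → x′ ≢ y′ →
  Renames [ x ↦ ` x′ , y ↦ ` y′ ] t (ren₂ x x′ y y′)
rename₂ {x} {x′} {y} {y′} {t} n m x′≢y′ =
  record { look-ρ = lk ; avoids = av ; injective = λ {z} {z′} → inj {z} {z′} }
  where
  module R = Renames (rename₁ {y} {y′} {t} m)
  lk : ∀ z → look [ x ↦ ` x′ , y ↦ ` y′ ] z ≡ ` ren₂ x x′ y y′ z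
  lk z with z ≟ x
  ... | yes _ = refl
  ... | no _ = R.look-ρ z
  av : ∀ {v z} → v ∈ BV t → z ≢ v → ren₂ x x′ y y′ z ≢ v
  av {v} {z} v∈ k with z ≟ x
  ... | yes _ = λ { refl → proj₂ (∈Vars t n) v∈ }
  ... | no _ = R.avoids v∈ k
  off : ∀ {z} → z ∈ FV t → x′ ≢ ren₁ y y′ z
  off {z} z∈ with z ≟ y
  ... | yes _ = x′≢y′
  ... | no _ = λ { refl → proj₁ (∈Vars t n) z∈ }
  inj : ∀ {z z′} → z ∈ FV t → z′ ∈ FV t → ren₂ x x′ y y′ z ≡ ren₂ x x′ y y′ z′ → z ≡ z′
  inj {z} {z′} p q e with z ≟ x | z′ ≟ x
  ... | yes refl | yes refl = refl
  ... | yes refl | no _ = ⊥-elim (off q e)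
  ... | no _ | yes refl = ⊥-elim (off p (sym e))
  ... | no _ | no _ = R.injective p q e

∈-remove₂⁺ : ∀ {z x y xs} → z ∈ xs → z ≢ x → z ≢ y → z ∈ remove x (remove y xs)
∈-remove₂⁺ p n m = ∈-remove⁺ (∈-remove⁺ p m) n

∈-remove₂⁻ : ∀ {z x y} xs → z ∈ remove x (remove y xs) → z ∈ xs × z ≢ x × z ≢ y
∈-remove₂⁻ {y = y} xs p with ∈-remove⁻ (remove y xs) p
... | q , n with ∈-remove⁻ xs q
...   | r , m = r , n , m

module αLet {x y x′ y′ : ℕ} {s t : Tm} (l : Lin (let⊗ x y s t)) (n : x′ ∉ Vars t) (m : y′ ∉ Vars t) (x′≢y′ : x′ ≢ y′) where
  σ : Subst
  σ = [ x ↦ ` x′ , y ↦ ` y′ ]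
  t′ : Tm
  t′ = subst σ t
  ρ : ℕ → ℕ
  ρ = ren₂ x x′ y y′
  open Renaming (rename₂ {x} {x′} {y} {y′} {t} n m x′≢y′)

  x≢y : x ≢ y
  x≢y = proj₁ (proj₂ (proj₂ l))

  ρx : ρ x ≡ x′
  ρx with x ≟ x
  ... | yes _ = refl
  ... | no k = ⊥-elim (k refl)
  ρy : ρ y ≡ y′
  ρy with y ≟ x
  ... | yes refl = ⊥-elim (x≢y refl)
  ... | no k = ren₁-≡ y y′
  ρ≢ : ∀ {z} → z ≢ x → z ≢ y → ρ z ≡ z
  ρ≢ {z} k j with z ≟ x
  ... | yes p = ⊥-elim (k p)
  ... | no _ = ren₁-≢ j

  ⊆₀ : ∀ {w} → w ∈ remove x′ (remove y′ (FV t′)) → w ∈ remove x (remove y (FV t))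
  ⊆₀ {w} w∈ with ∈-remove₂⁻ (FV t′) w∈
  ... | p , a , b with FV⁻ p
  ...   | z , z∈ , e = step (z ≟ x) (z ≟ y)
    where
    step : Dec (z ≡ x) → Dec (z ≡ y) → w ∈ remove x (remove y (FV t))
    step (yes refl) _ = ⊥-elim (a (trans e ρx))
    step (no _) (yes refl) = ⊥-elim (b (trans e ρy))
    step (no k) (no j) = ≡.subst (_∈ remove x (remove y (FV t))) (sym (trans e (ρ≢ k j))) (∈-remove₂⁺ z∈ k j)
  ⊇₀ : ∀ {w} → w ∈ remove x (remove y (FV t)) → w ∈ remove x′ (remove y′ (FV t′))
  ⊇₀ w∈ with ∈-remove₂⁻ (FV t) w∈
  ... | p , a , b = ∈-remove₂⁺ (≡.subst (_∈ FV t′) (ρ≢ a b) (FV⁺ p))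
        (λ { refl → proj₁ (∈Vars t n) p }) (λ { refl → proj₁ (∈Vars t m) p })
  ⊆ₗ : let⊗ x′ y′ s t′ ⊆ᶠ let⊗ x y s t
  ⊆ₗ w∈ with ∈-++⁻ (FV s) w∈
  ... | inj₁ p = ∈-++⁺ˡ p
  ... | inj₂ p = ∈-++⁺ʳ (FV s) (⊆₀ p)
  ⊇ₗ : let⊗ x y s t ⊆ᶠ let⊗ x′ y′ s t′
  ⊇ₗ w∈ with ∈-++⁻ (FV s) w∈
  ... | inj₁ p = ∈-++⁺ˡ p
  ... | inj₂ p = ∈-++⁺ʳ (FV s) (⊇₀ p)
  lin′ : Lin (let⊗ x′ y′ s t′)
  lin′ = let a , b , _ , x∈ , y∈ , d = l in a , lin b , x′≢y′ , ≡.subst (_∈ FV t′) ρx (FV⁺ x∈) ,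
        ≡.subst (_∈ FV t′) ρy (FV⁺ y∈) , λ p q → d p (⊆₀ q)
  ext : ∀ {E A B z} → z ∈ FV t → upd (upd E y′ B) x′ A (ρ z) ≡ upd (upd E y B) x A z
  ext {E} {A} {B} {z} z∈ = step (z ≟ x) (z ≟ y)
    where
    E₁ = upd (upd E y′ B) x′ A
    E₂ = upd (upd E y B) x A
    step : Dec (z ≡ x) → Dec (z ≡ y) → E₁ (ρ z) ≡ E₂ z
    step (yes refl) _ = trans (cong E₁ ρx) (trans (upd-≡ (upd E y′ B) x′ A) (sym (upd-≡ (upd E y B) x A)))
    step (no k) (yes refl) = trans (cong E₁ ρy)
      (trans (trans (upd-≢ (upd E y′ B) x′ A (λ e → x′≢y′ (sym e))) (upd-≡ E y′ B))
        (sym (trans (upd-≢ (upd E y B) x A k) (upd-≡ E y B))))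
    step (no k) (no j) = trans (cong E₁ (ρ≢ k j))
      (trans (trans (upd-≢ (upd E y′ B) x′ A {z} (λ { refl → proj₁ (∈Vars t n) z∈ })) (upd-≢ E y′ B {z} (λ { refl → proj₁ (∈Vars t m) z∈ })))
        (sym (trans (upd-≢ (upd E y B) x A k) (upd-≢ E y B j))))
  h : ∀ {E A} → HasTy E (let⊗ x y s t) A → HasTy E (let⊗ x′ y′ s t′) A
  h (letp d e) = letp d (ty⁺ e ext)
  h′ : ∀ {E A} → HasTy E (let⊗ x′ y′ s t′) A → HasTy E (let⊗ x y s t) A
  h′ (letp d e) = letp d (ty⁻ (proj₁ (proj₂ l)) e ext)
  α-let : let⊗ x y s t ≋ let⊗ x′ y′ s t′
  α-let = raw⇒≋ (λ _ → lin′) (λ _ → l) ⊇ₗ ⊆ₗ h h′ (αlet n m x′≢y′)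

-- Freshening bound variables

-- A copy of `t` with its bound variables moved off `L`. It supplies the capture conditions of `β`
-- and `βlet` on demand, so no convention on bound names has to be carried along.
record Variant (L : List ℕ) (t : Tm) : Set where
  constructor variant
  field
    term : Tm
    eq   : t ≋ term
    lin  : Lin term
    sub₁ : t ⊆ᶠ term
    sub₂ : term ⊆ᶠ t
    bv   : ∀ {y} → y ∈ BV term → y ∉ L

++-mono : ∀ {xs xs′ ys ys′ : List ℕ} → (∀ {z} → z ∈ xs → z ∈ xs′) → (∀ {z} → z ∈ ys → z ∈ ys′) →
  ∀ {z} → z ∈ xs ++ ys → z ∈ xs′ ++ ys′
++-mono {xs} {xs′} f g p with ∈-++⁻ xs p
... | inj₁ q = ∈-++⁺ˡ (f q)
... | inj₂ q = ∈-++⁺ʳ xs′ (g q)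

remove-mono : ∀ {x xs ys} → (∀ {z} → z ∈ xs → z ∈ ys) → ∀ {z} → z ∈ remove x xs → z ∈ remove x ys
remove-mono {xs = xs} f p = let q , n = ∈-remove⁻ xs p in ∈-remove⁺ (f q) n

freshen : ∀ L t → Lin t → Variant L t
freshen L (` x) l = variant (` x) ≋-refl tt id id (λ ())
freshen L (t · s) (l , m , d) with freshen L t l | freshen L s m
... | variant t′ e l′ f g b | variant s′ e₁ l₁ f₁ g₁ b₁ =
  variant (t′ · s′) (≋-app e e₁) (l′ , l₁ , λ p q → d (g p) (g₁ q)) (++-mono f f₁) (++-mono g g₁)
    (λ p q → case-∈ p q)
  where
  case-∈ : ∀ {y} → y ∈ BV t′ ++ BV s′ → y ∉ L
  case-∈ p with ∈-++⁻ (BV t′) p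
  ... | inj₁ q = b q
  ... | inj₂ q = b₁ q
freshen L ⟨ t , s ⟩ (l , m , d) with freshen L t l | freshen L s m
... | variant t′ e l′ f g b | variant s′ e₁ l₁ f₁ g₁ b₁ =
  variant ⟨ t′ , s′ ⟩ (≋-pair e e₁) (l′ , l₁ , λ p q → d (g p) (g₁ q)) (++-mono f f₁) (++-mono g g₁)
    (λ p q → case-∈ p q)
  where
  case-∈ : ∀ {y} → y ∈ BV t′ ++ BV s′ → y ∉ L
  case-∈ p with ∈-++⁻ (BV t′) p
  ... | inj₁ q = b q
  ... | inj₂ q = b₁ q
freshen L (ƛ x ⇒ t) (l , x∈) with freshen L t l
... | variant t₁ e l₁ f g b with fresh (L ++ Vars t₁)
...   | x′ , n = variant (ƛ x′ ⇒ t₂) (ƛ x ⇒ t ≋⟨ ≋-lam e ⟩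
    ƛ x ⇒ t₁ ≋⟨ α-lam lin₁ n′ ⟩
    ƛ x′ ⇒ t₂ ∎) (α-lam-Lin lin₁ n′)
        (λ p → α-lam-⊇ {t = t₁} n′ (remove-mono f p)) (λ p → remove-mono g (α-lam-⊆ {t = t₁} n′ p)) bv
  where
  n′ = ∉ʳ L n
  t₂ = subst [ x ↦ ` x′ ] t₁
  lin₁ : Lin (ƛ x ⇒ t₁)
  lin₁ = l₁ , f x∈
  bv : ∀ {y} → y ∈ BV (ƛ x′ ⇒ t₂) → y ∉ L
  bv (here refl) = ∉ˡ n
  bv {y} (there p) = b (≡.subst (y ∈_) (BV-rename t₁ {[ x ↦ ` x′ ]} (λ z → look-↦ {x} {` x′} {λ _ u → BV u ≡ []} refl (λ _ → refl) z)) p)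
freshen L (let⊗ x y s t) (m , l , x≢y , x∈ , y∈ , d) with freshen L s m | freshen L t l
... | variant s₁ e₁ m₁ f₁ g₁ b₁ | variant t₁ e l₁ f g b with fresh (L ++ Vars t₁)
...   | x′ , n with fresh (x′ ∷ L ++ Vars t₁)
...   | y′ , k = variant (let⊗ x′ y′ s₁ t′) (let⊗ x y s t ≋⟨ ≋-let e₁ e ⟩
    let⊗ x y s₁ t₁ ≋⟨ α-let ⟩
    let⊗ x′ y′ s₁ t′ ∎) lin′
        (λ p → ⊇ₗ (++-mono f₁ (remove-mono (remove-mono f)) p)) (λ p → ++-mono g₁ (remove-mono (remove-mono g)) (⊆ₗ p)) bv
  where
  lin₁ : Lin (let⊗ x y s₁ t₁)
  lin₁ = m₁ , l₁ , x≢y , f x∈ , f y∈ , λ p q → d (g₁ p) (remove-mono (remove-mono g) q)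
  open αLet lin₁ (∉ʳ L n) (∉ʳ L (k ∘ there)) (λ e → k (here (sym e)))
  eqBV : BV t′ ≡ BV t₁
  eqBV = BV-rename t₁ {σ} (λ z → lk z)
    where
    lk : ∀ z → BV (look σ z) ≡ []
    lk z = cong BV (Renames.look-ρ (rename₂ {x} {x′} {y} {y′} {t₁} (∉ʳ L n) (∉ʳ L (k ∘ there)) (λ e → k (here (sym e)))) z)
  bv : ∀ {v} → v ∈ BV (let⊗ x′ y′ s₁ t′) → v ∉ L
  bv (here refl) = ∉ˡ n
  bv (there (here refl)) = ∉ˡ (k ∘ there)
  bv {v} (there (there p)) with ∈-++⁻ (BV s₁) p
  ... | inj₁ q = b₁ q
  ... | inj₂ q = b (≡.subst (v ∈_) eqBV q)

Lin-λ· : ∀ {x t t′ s} → Lin ((ƛ x ⇒ t) · s) → Lin t′ → t ⊆ᶠ t′ → t′ ⊆ᶠ t → Lin ((ƛ x ⇒ t′) · s)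
Lin-λ· ((l , x∈) , m , d) l′ f g = (l′ , f x∈) , m , λ p q → d (remove-mono g p) q

noCapture : ∀ {t s} → (∀ {y} → y ∈ BV t → y ∉ FV s) → NoCapture t s
noCapture h = All.tabulate h

-- Commuting explicit substitutions and lets with applications and pairs

-- Applications and pairs have the same free variables and linearity
-- conditions, so the commutation lemmas are proved once for both.

data Node : Set where
  ap pr : Node

node : Node → Tm → Tm → Tm
node ap = _·_
node pr = ⟨_,_⟩

node-FV : ∀ b {t s} → FV (node b t s) ≡ FV t ++ FV s
node-FV ap = refl
node-FV pr = refl

node-BV : ∀ b {t s} → BV (node b t s) ≡ BV t ++ BV s
node-BV ap = refl
node-BV pr = refl

node-Lin : ∀ b {t s} → Lin (node b t s) ≡ (Lin t × Lin s × Disj (FV t) (FV s))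
node-Lin ap = refl
node-Lin pr = refl

node-subst : ∀ b {σ t s} → subst σ (node b t s) ≡ node b (subst σ t) (subst σ s)
node-subst ap = refl
node-subst pr = refl

node-≋ : ∀ b {t t′ s s′} → t ≋ t′ → s ≋ s′ → node b t s ≋ node b t′ s′
node-≋ ap = ≋-app
node-≋ pr = ≋-pair

node-HasTy : ∀ b {E t s A} → HasTy E (node b t s) A → ∃[ A₁ ] ∃[ A₂ ] (HasTy E t A₁ × HasTy E s A₂ ×
  (∀ {E′ t′ s′} → HasTy E′ t′ A₁ → HasTy E′ s′ A₂ → HasTy E′ (node b t′ s′) A))
node-HasTy ap (app d e) = _ , _ , d , e , app
node-HasTy pr (pair d e) = _ , _ , d , e , pair

-- The redex (ƛ x ⇒ t) · s serves as an explicit substitution; moving it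
-- through a term avoids all side conditions on bound variables.

Lin-node : ∀ b {t s} → Lin t → Lin s → Disj (FV t) (FV s) → Lin (node b t s)
Lin-node b l m d = ≡.subst id (sym (node-Lin b)) (l , m , d)

Lin-node⁻ : ∀ b {t s} → Lin (node b t s) → Lin t × Lin s × Disj (FV t) (FV s)
Lin-node⁻ b = ≡.subst id (node-Lin b)

∈-node : ∀ b {t s z} → z ∈ FV t ++ FV s → z ∈ FV (node b t s)
∈-node b = ≡.subst (_ ∈_) (sym (node-FV b))

∈-node⁻ : ∀ b {t s z} → z ∈ FV (node b t s) → z ∈ FV t ++ FV s
∈-node⁻ b = ≡.subst (_ ∈_) (node-FV b)

β-≋ : ∀ {x t t′ s r} → Lin ((ƛ x ⇒ t′) · s) → t ≋ t′ → (∀ {y} → y ∈ BV t′ → y ∉ FV s) →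
  subst [ x ↦ s ] t′ ≡ r → (ƛ x ⇒ t) · s ≋ r
β-≋ {x} {t} {t′} {s} l e b refl =
    (ƛ x ⇒ t) · s ≋⟨ ≋-app (≋-lam e) ≋-refl ⟩
    (ƛ x ⇒ t′) · s ≋⟨ β≋ l (noCapture {t′} {s} b) ⟩
    subst [ x ↦ s ] t′ ∎

module LetNode (b : Node) {x : ℕ} {t s u : Tm} (x∉u : x ∉ FV u) where

  Linˡ : Lin (node b ((ƛ x ⇒ t) · s) u) → Lin ((ƛ x ⇒ node b t u) · s)
  Linˡ l with Lin-node⁻ b {((ƛ x ⇒ t) · s)} {u} l
  ... | ((lt , x∈) , ls , d) , lu , e =
    (Lin-node b {t} {u} lt lu (λ { p q → e (∈-++⁺ˡ (∈-remove⁺ p (λ { refl → x∉u q }))) q }) , ∈-node b {t} {u} (∈-++⁺ˡ x∈)) , ls , f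
    where
    f : Disj (remove x (FV (node b t u))) (FV s)
    f p q with ∈-remove⁻ (FV (node b t u)) p
    ... | p′ , n with ∈-++⁻ (FV t) (∈-node⁻ b {t} {u} p′)
    ...   | inj₁ r = d (∈-remove⁺ r n) q
    ...   | inj₂ r = e (∈-++⁺ʳ (remove x (FV t)) q) r

  Linˡ⁻ : Lin ((ƛ x ⇒ node b t u) · s) → Lin (node b ((ƛ x ⇒ t) · s) u)
  Linˡ⁻ ((l , x∈) , ls , d) with Lin-node⁻ b {t} {u} l | ∈-++⁻ (FV t) (∈-node⁻ b {t} {u} x∈)
  ... | lt , lu , e | inj₂ p = ⊥-elim (x∉u p)
  ... | lt , lu , e | inj₁ x∈t = Lin-node b {((ƛ x ⇒ t) · s)} {u}
    ((lt , x∈t) , ls , λ p q → d (remove-mono {xs = FV t} (∈-node b {t} {u} ∘ ∈-++⁺ˡ) p) q) lu f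
    where
    f : Disj (remove x (FV t) ++ FV s) (FV u)
    f p q with ∈-++⁻ (remove x (FV t)) p
    ... | inj₁ r = e (proj₁ (∈-remove⁻ (FV t) r)) q
    ... | inj₂ r = d (∈-remove⁺ (∈-node b {t} {u} (∈-++⁺ʳ (FV t) q)) (λ { refl → x∉u q })) r

  Linʳ : Lin (node b u ((ƛ x ⇒ t) · s)) → Lin ((ƛ x ⇒ node b u t) · s)
  Linʳ l with Lin-node⁻ b {u} {((ƛ x ⇒ t) · s)} l
  ... | lu , ((lt , x∈) , ls , d) , e =
    (Lin-node b {u} {t} lu lt (λ { p q → e p (∈-++⁺ˡ (∈-remove⁺ q (λ { refl → x∉u p }))) }) , ∈-node b {u} {t} (∈-++⁺ʳ (FV u) x∈)) , ls , f
    where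
    f : Disj (remove x (FV (node b u t))) (FV s)
    f p q with ∈-remove⁻ (FV (node b u t)) p
    ... | p′ , n with ∈-++⁻ (FV u) (∈-node⁻ b {u} {t} p′)
    ...   | inj₂ r = d (∈-remove⁺ r n) q
    ...   | inj₁ r = e r (∈-++⁺ʳ (remove x (FV t)) q)

  Linʳ⁻ : Lin ((ƛ x ⇒ node b u t) · s) → Lin (node b u ((ƛ x ⇒ t) · s))
  Linʳ⁻ ((l , x∈) , ls , d) with Lin-node⁻ b {u} {t} l | ∈-++⁻ (FV u) (∈-node⁻ b {u} {t} x∈)
  ... | lu , lt , e | inj₁ p = ⊥-elim (x∉u p)
  ... | lu , lt , e | inj₂ x∈t = Lin-node b {u} {((ƛ x ⇒ t) · s)} lu
    ((lt , x∈t) , ls , λ p q → d (remove-mono {xs = FV t} (∈-node b {u} {t} ∘ ∈-++⁺ʳ (FV u)) p) q) f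
    where
    f : Disj (FV u) (remove x (FV t) ++ FV s)
    f q p with ∈-++⁻ (remove x (FV t)) p
    ... | inj₁ r = e q (proj₁ (∈-remove⁻ (FV t) r))
    ... | inj₂ r = d (∈-remove⁺ (∈-node b {u} {t} (∈-++⁺ˡ q)) (λ { refl → x∉u q })) r

  -- After freshening away from `FV s`, both sides contract to the same term: `u` does not contain
  -- `x`, so the substitution leaves it alone.
  pushˡ : Lin (node b ((ƛ x ⇒ t) · s) u) → node b ((ƛ x ⇒ t) · s) u ≋ (ƛ x ⇒ node b t u) · s
  pushˡ l with Lin-node⁻ b {((ƛ x ⇒ t) · s)} {u} l
  ... | l₁@((lt , x∈) , ls , d) , lu , e with freshen (FV s) t lt | freshen (FV s) u lu
  ... | variant t′ et lt′ f g bt | variant u′ eu lu′ f′ g′ bu =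

        node b ((ƛ x ⇒ t) · s) u ≋⟨ node-≋ b {(ƛ x ⇒ t) · s} {subst [ x ↦ s ] t′} {u} {u′} (β-≋ (Lin-λ· l₁ lt′ f g) et bt refl) eu ⟩
        node b (subst [ x ↦ s ] t′) u′ ≋⟨ ≋-sym
          (β-≋ (Lin-λ· (Linˡ l) (Lin-node b {t′} {u′} lt′ lu′ (λ p q → dtu (g p) (g′ q))) nf ng) (node-≋ b {t} {t′} {u} {u′} et eu) nbv
            (trans (node-subst b {[ x ↦ s ]} {t′} {u′}) (cong (node b _) (subst-∉ u′ (x∉u ∘ g′))))) ⟩
        (ƛ x ⇒ node b t u) · s ∎
    where
    dtu : Disj (FV t) (FV u)
    dtu p q = e (∈-++⁺ˡ (∈-remove⁺ p (λ { refl → x∉u q }))) q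
    nf : node b t u ⊆ᶠ node b t′ u′
    nf p = ∈-node b {t′} {u′} (++-mono f f′ (∈-node⁻ b {t} {u} p))
    ng : node b t′ u′ ⊆ᶠ node b t u
    ng p = ∈-node b {t} {u} (++-mono g g′ (∈-node⁻ b {t′} {u′} p))
    nbv : ∀ {y} → y ∈ BV (node b t′ u′) → y ∉ FV s
    nbv p with ∈-++⁻ (BV t′) (≡.subst (_ ∈_) (node-BV b {t′} {u′}) p)
    ... | inj₁ q = bt q
    ... | inj₂ q = bu q

  pushʳ : Lin (node b u ((ƛ x ⇒ t) · s)) → node b u ((ƛ x ⇒ t) · s) ≋ (ƛ x ⇒ node b u t) · s
  pushʳ l with Lin-node⁻ b {u} {((ƛ x ⇒ t) · s)} l
  ... | lu , l₁@((lt , x∈) , ls , d) , e with freshen (FV s) t lt | freshen (FV s) u lu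
  ... | variant t′ et lt′ f g bt | variant u′ eu lu′ f′ g′ bu =

        node b u ((ƛ x ⇒ t) · s) ≋⟨ node-≋ b {u} {u′} {(ƛ x ⇒ t) · s} {subst [ x ↦ s ] t′} eu (β-≋ (Lin-λ· l₁ lt′ f g) et bt refl) ⟩
        node b u′ (subst [ x ↦ s ] t′) ≋⟨ ≋-sym
          (β-≋ (Lin-λ· (Linʳ l) (Lin-node b {u′} {t′} lu′ lt′ (λ q p → dtu (g p) (g′ q))) nf ng) (node-≋ b {u} {u′} {t} {t′} eu et) nbv
            (trans (node-subst b {[ x ↦ s ]} {u′} {t′}) (cong (λ r → node b r _) (subst-∉ u′ (x∉u ∘ g′))))) ⟩
        (ƛ x ⇒ node b u t) · s ∎
    where
    dtu : Disj (FV t) (FV u)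
    dtu p q = e q (∈-++⁺ˡ (∈-remove⁺ p (λ { refl → x∉u q })))
    nf : node b u t ⊆ᶠ node b u′ t′
    nf p = ∈-node b {u′} {t′} (++-mono f′ f (∈-node⁻ b {u} {t} p))
    ng : node b u′ t′ ⊆ᶠ node b u t
    ng p = ∈-node b {u} {t} (++-mono g′ g (∈-node⁻ b {u′} {t′} p))
    nbv : ∀ {y} → y ∈ BV (node b u′ t′) → y ∉ FV s
    nbv p with ∈-++⁻ (BV u′) (≡.subst (_ ∈_) (node-BV b {u′} {t′}) p)
    ... | inj₁ q = bu q
    ... | inj₂ q = bt q

-- Both halves of `t ≋ u` start from a typing of one side, and typed terms are linear. An equation
-- proved for linear `t` therefore holds outright once linearity passes from `u` to `t`.
unconditional : ∀ {t u} → (Lin u → Lin t) → (Lin t → t ≋ u) → t ≋ u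
unconditional h e = (λ d → proj₁ (e (h (proj₁ (names-FV d)))) d) ,
                    (λ d → proj₂ (e (proj₁ (names-FV d))) d)

push-nodeˡ : ∀ b {x t s u} → x ∉ FV u → node b ((ƛ x ⇒ t) · s) u ≋ (ƛ x ⇒ node b t u) · s
push-nodeˡ b n = unconditional (LetNode.Linˡ⁻ b n) (LetNode.pushˡ b n)

push-nodeʳ : ∀ b {x t s u} → x ∉ FV u → node b u ((ƛ x ⇒ t) · s) ≋ (ƛ x ⇒ node b u t) · s
push-nodeʳ b n = unconditional (LetNode.Linʳ⁻ b n) (LetNode.pushʳ b n)

module Let⊗Node (b : Node) {x y : ℕ} {s t u : Tm} (x∉u : x ∉ FV u) (y∉u : y ∉ FV u) where

  R : List ℕ → List ℕ
  R xs = remove x (remove y xs)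

  R-mono : ∀ {xs ys} → (∀ {z} → z ∈ xs → z ∈ ys) → ∀ {z} → z ∈ R xs → z ∈ R ys
  R-mono f = remove-mono (remove-mono f)

  into : ∀ {z xs} → z ∈ xs → z ∈ FV u → z ∈ R xs
  into p q = ∈-remove₂⁺ p (λ { refl → x∉u q }) (λ { refl → y∉u q })

  Linˡ : Lin (node b (let⊗ x y s t) u) → Lin (let⊗ x y s (node b t u))
  Linˡ l with Lin-node⁻ b {(let⊗ x y s t)} {u} l
  ... | (ls , lt , ne , x∈ , y∈ , d) , lu , e =
    ls , Lin-node b {t} {u} lt lu (λ p q → e (∈-++⁺ʳ (FV s) (into p q)) q) , ne ,
    ∈-node b {t} {u} (∈-++⁺ˡ x∈) , ∈-node b {t} {u} (∈-++⁺ˡ y∈) , f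
    where
    f : Disj (FV s) (R (FV (node b t u)))
    f q p with ∈-remove₂⁻ (FV (node b t u)) p
    ... | p′ , n , m with ∈-++⁻ (FV t) (∈-node⁻ b {t} {u} p′)
    ...   | inj₁ r = d q (∈-remove₂⁺ r n m)
    ...   | inj₂ r = e (∈-++⁺ˡ q) r

  Linˡ⁻ : Lin (let⊗ x y s (node b t u)) → Lin (node b (let⊗ x y s t) u)
  Linˡ⁻ (ls , l , ne , x∈ , y∈ , d) with Lin-node⁻ b {t} {u} l | ∈-++⁻ (FV t) (∈-node⁻ b {t} {u} x∈) | ∈-++⁻ (FV t) (∈-node⁻ b {t} {u} y∈)
  ... | _ | inj₂ p | _ = ⊥-elim (x∉u p)
  ... | _ | inj₁ _ | inj₂ p = ⊥-elim (y∉u p)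
  ... | lt , lu , e | inj₁ x∈t | inj₁ y∈t = Lin-node b {(let⊗ x y s t)} {u}
    (ls , lt , ne , x∈t , y∈t , λ q p → d q (R-mono {FV t} (∈-node b {t} {u} ∘ ∈-++⁺ˡ) p)) lu f
    where
    f : Disj (FV s ++ R (FV t)) (FV u)
    f p q with ∈-++⁻ (FV s) p
    ... | inj₂ r = e (proj₁ (∈-remove₂⁻ (FV t) r)) q
    ... | inj₁ r = d r (into (∈-node b {t} {u} (∈-++⁺ʳ (FV t) q)) q)

  Linʳ : Lin (node b u (let⊗ x y s t)) → Lin (let⊗ x y s (node b u t))
  Linʳ l with Lin-node⁻ b {u} {(let⊗ x y s t)} l
  ... | lu , (ls , lt , ne , x∈ , y∈ , d) , e =
    ls , Lin-node b {u} {t} lu lt (λ q p → e q (∈-++⁺ʳ (FV s) (into p q))) , ne ,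
    ∈-node b {u} {t} (∈-++⁺ʳ (FV u) x∈) , ∈-node b {u} {t} (∈-++⁺ʳ (FV u) y∈) , f
    where
    f : Disj (FV s) (R (FV (node b u t)))
    f q p with ∈-remove₂⁻ (FV (node b u t)) p
    ... | p′ , n , m with ∈-++⁻ (FV u) (∈-node⁻ b {u} {t} p′)
    ...   | inj₂ r = d q (∈-remove₂⁺ r n m)
    ...   | inj₁ r = e r (∈-++⁺ˡ q)

  Linʳ⁻ : Lin (let⊗ x y s (node b u t)) → Lin (node b u (let⊗ x y s t))
  Linʳ⁻ (ls , l , ne , x∈ , y∈ , d) with Lin-node⁻ b {u} {t} l | ∈-++⁻ (FV u) (∈-node⁻ b {u} {t} x∈) | ∈-++⁻ (FV u) (∈-node⁻ b {u} {t} y∈)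
  ... | _ | inj₁ p | _ = ⊥-elim (x∉u p)
  ... | _ | inj₂ _ | inj₁ p = ⊥-elim (y∉u p)
  ... | lu , lt , e | inj₂ x∈t | inj₂ y∈t = Lin-node b {u} {(let⊗ x y s t)} lu
    (ls , lt , ne , x∈t , y∈t , λ q p → d q (R-mono {FV t} (∈-node b {u} {t} ∘ ∈-++⁺ʳ (FV u)) p)) f
    where
    f : Disj (FV u) (FV s ++ R (FV t))
    f q p with ∈-++⁻ (FV s) p
    ... | inj₂ r = e q (proj₁ (∈-remove₂⁻ (FV t) r))
    ... | inj₁ r = d r (into (∈-node b {u} {t} (∈-++⁺ˡ q)) q)

  same : ∀ {E A B z} → z ∈ FV u → E z ≡ upd (upd E y B) x A z
  same {E} {A} {B} {z} z∈ = sym (trans (upd-≢ (upd E y B) x A {z} (λ { refl → x∉u z∈ })) (upd-≢ E y B {z} (λ { refl → y∉u z∈ })))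

  FVˡ⁺ : node b (let⊗ x y s t) u ⊆ᶠ let⊗ x y s (node b t u)
  FVˡ⁺ p with ∈-++⁻ (FV s ++ R (FV t)) (∈-node⁻ b {(let⊗ x y s t)} {u} p)
  ... | inj₂ q = ∈-++⁺ʳ (FV s) (into (∈-node b {t} {u} (∈-++⁺ʳ (FV t) q)) q)
  ... | inj₁ q = ++-mono id (R-mono {FV t} (∈-node b {t} {u} ∘ ∈-++⁺ˡ)) q

  FVˡ⁻ : let⊗ x y s (node b t u) ⊆ᶠ node b (let⊗ x y s t) u
  FVˡ⁻ p with ∈-++⁻ (FV s) p
  ... | inj₁ q = ∈-node b {(let⊗ x y s t)} {u} (∈-++⁺ˡ (∈-++⁺ˡ q))
  ... | inj₂ q with ∈-remove₂⁻ (FV (node b t u)) q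
  ...   | r , n , m with ∈-++⁻ (FV t) (∈-node⁻ b {t} {u} r)
  ...     | inj₁ r′ = ∈-node b {(let⊗ x y s t)} {u} (∈-++⁺ˡ (∈-++⁺ʳ (FV s) (∈-remove₂⁺ r′ n m)))
  ...     | inj₂ r′ = ∈-node b {(let⊗ x y s t)} {u} (∈-++⁺ʳ (FV s ++ R (FV t)) r′)

  FVʳ⁺ : node b u (let⊗ x y s t) ⊆ᶠ let⊗ x y s (node b u t)
  FVʳ⁺ p with ∈-++⁻ (FV u) (∈-node⁻ b {u} {(let⊗ x y s t)} p)
  ... | inj₁ q = ∈-++⁺ʳ (FV s) (into (∈-node b {u} {t} (∈-++⁺ˡ q)) q)
  ... | inj₂ q = ++-mono id (R-mono {FV t} (∈-node b {u} {t} ∘ ∈-++⁺ʳ (FV u))) q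

  FVʳ⁻ : let⊗ x y s (node b u t) ⊆ᶠ node b u (let⊗ x y s t)
  FVʳ⁻ p with ∈-++⁻ (FV s) p
  ... | inj₁ q = ∈-node b {u} {(let⊗ x y s t)} (∈-++⁺ʳ (FV u) (∈-++⁺ˡ q))
  ... | inj₂ q with ∈-remove₂⁻ (FV (node b u t)) q
  ...   | r , n , m with ∈-++⁻ (FV u) (∈-node⁻ b {u} {t} r)
  ...     | inj₂ r′ = ∈-node b {u} {(let⊗ x y s t)} (∈-++⁺ʳ (FV u) (∈-++⁺ʳ (FV s) (∈-remove₂⁺ r′ n m)))
  ...     | inj₁ r′ = ∈-node b {u} {(let⊗ x y s t)} (∈-++⁺ˡ r′)

  tyˡ : ∀ {E A} → HasTy E (node b (let⊗ x y s t) u) A → HasTy E (let⊗ x y s (node b t u)) A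
  tyˡ d with node-HasTy b d
  ... | _ , _ , letp ds dt , du , k = letp ds (k dt (HasTy-ext same du))
  tyˡ⁻ : ∀ {E A} → HasTy E (let⊗ x y s (node b t u)) A → HasTy E (node b (let⊗ x y s t) u) A
  tyˡ⁻ (letp ds d) with node-HasTy b d
  ... | _ , _ , dt , du , k = k (letp ds dt) (HasTy-ext (λ p → sym (same p)) du)
  tyʳ : ∀ {E A} → HasTy E (node b u (let⊗ x y s t)) A → HasTy E (let⊗ x y s (node b u t)) A
  tyʳ d with node-HasTy b d
  ... | _ , _ , du , letp ds dt , k = letp ds (k (HasTy-ext same du) dt)
  tyʳ⁻ : ∀ {E A} → HasTy E (let⊗ x y s (node b u t)) A → HasTy E (node b u (let⊗ x y s t)) A
  tyʳ⁻ (letp ds d) with node-HasTy b d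
  ... | _ , _ , du , dt , k = k (HasTy-ext (λ p → sym (same p)) du) (letp ds dt)

  noBinders : ∀ {xs : List ℕ} → All (_∉ []) xs
  noBinders = All.universal (λ _ ()) _

  rawˡ : ∀ b → node b (let⊗ x y s t) u ~ let⊗ x y s (node b t u)
  rawˡ ap = comm (□ ·ₗ u) x∉u y∉u noBinders
  rawˡ pr = comm ⟨ □ , u ⟩ₗ x∉u y∉u noBinders

  rawʳ : ∀ b → node b u (let⊗ x y s t) ~ let⊗ x y s (node b u t)
  rawʳ ap = comm (u ·ᵣ □) (x∉u ∘ un) (y∉u ∘ un) noBinders
    where
    un : ∀ {z} → z ∈ FV u ++ [] → z ∈ FV u
    un = ≡.subst (_ ∈_) (++-identityʳ (FV u))
  rawʳ pr = comm ⟨ u , □ ⟩ᵣ (x∉u ∘ un) (y∉u ∘ un) noBinders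
    where
    un : ∀ {z} → z ∈ FV u ++ [] → z ∈ FV u
    un = ≡.subst (_ ∈_) (++-identityʳ (FV u))

  commˡ : node b (let⊗ x y s t) u ≋ let⊗ x y s (node b t u)
  commˡ = raw⇒≋ Linˡ Linˡ⁻ FVˡ⁺ FVˡ⁻ tyˡ tyˡ⁻ (rawˡ b)

  commʳ : node b u (let⊗ x y s t) ≋ let⊗ x y s (node b u t)
  commʳ = raw⇒≋ Linʳ Linʳ⁻ FVʳ⁺ FVʳ⁻ tyʳ tyʳ⁻ (rawʳ b)

open Let⊗Node public using (commˡ; commʳ)

-- Derived equations for redexes and lets

β-var : ∀ {x t} → Lin t → x ∈ FV t → (ƛ x ⇒ t) · ` x ≋ t
β-var {x} {t} l x∈ with freshen [ x ] t l
... | variant t′ e l′ f g b =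
    (ƛ x ⇒ t) · ` x ≋⟨ β-≋ ((l′ , f x∈) , tt , λ { p (here refl) → proj₂ (∈-remove⁻ (FV t′) p) refl }) e b (subst-id t′ (λ {z} _ → look-↦ {x} {` x} {λ z u → u ≡ ` z} refl (λ _ → refl) z)) ⟩
    t′ ≋⟨ ≋-sym e ⟩
    t ∎

β-id : ∀ {x s} → Lin s → (ƛ x ⇒ ` x) · s ≋ s
β-id {x} {s} l = β-≋ ((tt , here refl) , l , λ p → ⊥-elim (proj₂ (∈-remove⁻ [ x ] p) (∈-[-] (proj₁ (∈-remove⁻ [ x ] p)))))
  ≋-refl (λ ()) (look-≡ x s [])

η-Lin : ∀ {x t} → x ∉ FV t → Lin t → Lin (ƛ x ⇒ (t · ` x))
η-Lin {t = t} n l = (l , tt , λ { p (here refl) → n p }) , ∈-++⁺ʳ (FV t) (here refl)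

-- Only this direction holds: a variable also has types that are not arrows, whereas its η-expansion
-- does not.
η⊒ : ∀ {x t} → x ∉ FV t → t ⊒ ƛ x ⇒ (t · ` x)
η⊒ {x} {t} n d = ≈sym (≈ax d (transfer l f g h d) η)
  where
  l : Lin (ƛ x ⇒ (t · ` x)) → Lin t
  l ((a , _) , _) = a
  f : t ⊆ᶠ (ƛ x ⇒ (t · ` x))
  f p = ∈-remove⁺ (∈-++⁺ˡ p) (λ { refl → n p })
  g : (ƛ x ⇒ (t · ` x)) ⊆ᶠ t
  g p with ∈-remove⁻ (FV t ++ [ x ]) p
  ... | q , m with ∈-++⁻ (FV t) q
  ...   | inj₁ r = r
  ...   | inj₂ (here refl) = ⊥-elim (m refl)
  h : ∀ {E A} → HasTy E (ƛ x ⇒ (t · ` x)) A → HasTy E t A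
  h {E} (lam {A = A} (app d (var e))) with trans (sym (upd-≡ E x A)) e
  ... | refl = HasTy-ext (λ z∈ → upd-≢ E x A (λ { refl → n z∈ })) d

-- Unlike η⊒ this works in both directions, because the application forces t to
-- have a function type.
η·≋ : ∀ {x t s} → x ∉ FV t → (ƛ x ⇒ (t · ` x)) · s ≋ t · s
η·≋ {x} {t} {s} n = unconditional
  (λ (l , m , d) → η-Lin n l , m , λ p → d (un p))
  (λ { l@((a , _) , m , d) → ((ƛ x ⇒ (t · ` x)) · s ≋⟨ ≋-sym (push-nodeʳ ap n) ⟩
      t · ((ƛ x ⇒ ` x) · s) ≋⟨ ≋-appʳ (β-id m) ⟩
      t · s ∎) })
  where
  un : ∀ {z} → z ∈ remove x (FV t ++ [ x ]) → z ∈ FV t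
  un p with ∈-remove⁻ (FV t ++ [ x ]) p
  ... | q , k with ∈-++⁻ (FV t) q
  ...   | inj₁ r = r
  ...   | inj₂ (here refl) = ⊥-elim (k refl)

-- For a body that applies `F` to `x` and `y`, neither of them free in `F`, naive simultaneous
-- substitution touches only the two arguments, so its result is known outright.
module BetaLet {x y : ℕ} {u v F : Tm} (x≢y : x ≢ y) (x∉ : x ∉ FV F) (y∉ : y ∉ FV F) (l : Lin (F · u · v))
  (bv : ∀ {z} → z ∈ BV F → z ∉ FV u ++ FV v) where
  lF : Lin F
  lF = proj₁ (proj₁ l)
  lu : Lin u
  lu = proj₁ (proj₂ (proj₁ l))
  lv : Lin v
  lv = proj₁ (proj₂ l)
  d₁ : Disj (FV F) (FV u)
  d₁ = proj₂ (proj₂ (proj₁ l))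
  d₂ : Disj (FV F ++ FV u) (FV v)
  d₂ = proj₂ (proj₂ l)
  lhs : Tm
  lhs = let⊗ x y ⟨ u , v ⟩ (F · ` x · ` y)
  eq : subst [ x ↦ u , y ↦ v ] (F · ` x · ` y) ≡ F · u · v
  eq = cong₂ _·_ (cong₂ _·_ (subst-id F σF) (look-≡ x u _)) (trans (look-≢ (λ e → x≢y (sym e))) (look-≡ y v []))
    where
    σF : ∀ {z} → z ∈ FV F → look [ x ↦ u , y ↦ v ] z ≡ ` z
    σF {z} p = trans (look-≢ {z = z} (λ { refl → x∉ p })) (look-≢ {z = z} (λ { refl → y∉ p }))
  nc : ∀ {w} → (∀ {z} → z ∈ FV w → z ∈ FV u ++ FV v) → NoCapture (F · ` x · ` y) w
  nc {w} k = noCapture {F · ` x · ` y} {w} (λ p q → bv (un p) (k q))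
    where
    un : ∀ {z} → z ∈ (BV F ++ []) ++ [] → z ∈ BV F
    un p rewrite ++-identityʳ (BV F ++ []) | ++-identityʳ (BV F) = p
  l′ : Lin lhs
  l′ = (lu , lv , λ p q → d₂ (∈-++⁺ʳ (FV F) p) q) ,
    ((lF , tt , λ { p (here refl) → x∉ p }) , tt , λ p → λ { (here refl) → y∉xF p }) , x≢y ,
    ∈-++⁺ˡ (∈-++⁺ʳ (FV F) (here refl)) , ∈-++⁺ʳ (FV F ++ [ x ]) (here refl) , dj
    where
    y∉xF : y ∉ FV F ++ [ x ]
    y∉xF = ∉-++ (FV F) y∉ (λ { (here e) → x≢y (sym e) })
    dj : Disj (FV u ++ FV v) (remove x (remove y (FV (F · ` x · ` y))))
    dj p q with ∈-remove₂⁻ (FV (F · ` x · ` y)) q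
    ... | r , n , m with ∈-++⁻ (FV F ++ [ x ]) r
    ...   | inj₂ (here e) = m e
    ...   | inj₁ r′ with ∈-++⁻ (FV F) r′
    ...     | inj₂ (here e) = n e
    ...     | inj₁ r″ with ∈-++⁻ (FV u) p
    ...       | inj₁ p′ = d₁ r″ p′
    ...       | inj₂ p′ = d₂ (∈-++⁺ˡ r″) p′
  f : lhs ⊆ᶠ F · u · v
  f p with ∈-++⁻ (FV u ++ FV v) p
  ... | inj₁ q with ∈-++⁻ (FV u) q
  ...   | inj₁ r = ∈-++⁺ˡ (∈-++⁺ʳ (FV F) r)
  ...   | inj₂ r = ∈-++⁺ʳ (FV F ++ FV u) r
  f p | inj₂ q with ∈-remove₂⁻ (FV (F · ` x · ` y)) q
  ... | r , n , m with ∈-++⁻ (FV F ++ [ x ]) r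
  ...   | inj₂ (here e) = ⊥-elim (m e)
  ...   | inj₁ r′ with ∈-++⁻ (FV F) r′
  ...     | inj₂ (here e) = ⊥-elim (n e)
  ...     | inj₁ r″ = ∈-++⁺ˡ (∈-++⁺ˡ r″)
  g : F · u · v ⊆ᶠ lhs
  g p with ∈-++⁻ (FV F ++ FV u) p
  ... | inj₂ q = ∈-++⁺ˡ (∈-++⁺ʳ (FV u) q)
  ... | inj₁ q with ∈-++⁻ (FV F) q
  ...   | inj₂ r = ∈-++⁺ˡ (∈-++⁺ˡ r)
  ...   | inj₁ r = ∈-++⁺ʳ (FV u ++ FV v) (∈-remove₂⁺ (∈-++⁺ˡ (∈-++⁺ˡ r)) (λ { refl → x∉ r }) (λ { refl → y∉ r }))
  same : ∀ {E A B z} → z ∈ FV F → upd (upd E y B) x A z ≡ E z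
  same {E} {A} {B} {z} p = trans (upd-≢ (upd E y B) x A {z} (λ { refl → x∉ p })) (upd-≢ E y B {z} (λ { refl → y∉ p }))
  h : ∀ {E A} → HasTy E lhs A → HasTy E (F · u · v) A
  h {E} (letp {A = A} {B} (pair du dv) (app (app dF (var e₁)) (var e₂)))
    with trans (sym (upd-≡ (upd E y B) x A)) e₁
       | trans (sym (trans (upd-≢ (upd E y B) x A (λ e → x≢y (sym e))) (upd-≡ E y B))) e₂
  ... | refl | refl = app (app (HasTy-ext same dF) du) dv
  h′ : ∀ {E A} → HasTy E (F · u · v) A → HasTy E lhs A
  h′ {E} (app (app {A = A} dF du) dv) = letp (pair du dv)
    (app (app (HasTy-ext (λ p → sym (same p)) dF) (var (upd-≡ _ x A)))
      (var (trans (upd-≢ _ x A (λ e → x≢y (sym e))) (upd-≡ E y _))))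
  raw : lhs ~ (F · u · v)
  raw = ≡.subst (lhs ~_) eq (βlet (nc {u} ∈-++⁺ˡ) (nc {v} (∈-++⁺ʳ (FV u))))

βlet-η : ∀ {x y u v F} → x ≢ y → x ∉ FV F → y ∉ FV F → Lin (F · u · v) →
  (∀ {z} → z ∈ BV F → z ∉ FV u ++ FV v) → let⊗ x y ⟨ u , v ⟩ (F · ` x · ` y) ≋ F · u · v
βlet-η {x} {y} {u} {v} {F} n x∉ y∉ l bv = raw⇒≋ {let⊗ x y ⟨ u , v ⟩ (F · ` x · ` y)} {F · u · v} (λ _ → l) (λ _ → l′) f g h h′ raw
  where open BetaLet {x} {y} {u} {v} {F} n x∉ y∉ l bv

-- Reduces a let on a pair to two ordinary β-redexes, so that later evaluation only has to deal with
-- one variable at a time.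
βlet≋ : ∀ {x y u v t} → let⊗ x y ⟨ u , v ⟩ t ≋ (ƛ x ⇒ (ƛ y ⇒ t)) · u · v
βlet≋ {x} {y} {u} {v} {t} = unconditional lin⁻ go
  where
  F = ƛ x ⇒ (ƛ y ⇒ t)
  lin⁻ : Lin (F · u · v) → Lin (let⊗ x y ⟨ u , v ⟩ t)
  lin⁻ ((((lt , y∈) , x∈) , lu , d₁) , lv , d₂) with ∈-remove⁻ (FV t) x∈
  ... | x∈t , n = (lu , lv , λ p q → d₂ (∈-++⁺ʳ (FV F) p) q) , lt , n , x∈t , y∈ , dj
    where
    dj : Disj (FV u ++ FV v) (FV F)
    dj p q with ∈-++⁻ (FV u) p
    ... | inj₁ r = d₁ q r
    ... | inj₂ r = d₂ (∈-++⁺ˡ q) r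
  go : Lin (let⊗ x y ⟨ u , v ⟩ t) → let⊗ x y ⟨ u , v ⟩ t ≋ F · u · v
  go ((lu , lv , e) , lt , x≢y , x∈ , y∈ , d) = step (freshen (FV u ++ FV v) F ((lt , y∈) , x∈′))
    where
    x∈′ : x ∈ FV (ƛ y ⇒ t)
    x∈′ = ∈-remove⁺ x∈ x≢y
    expand : F · ` x · ` y ≋ t
    expand =
        F · ` x · ` y ≋⟨ ≋-app (β-var (lt , y∈) x∈′) ≋-refl ⟩
        (ƛ y ⇒ t) · ` y ≋⟨ β-var lt y∈ ⟩
        t ∎
    step : Variant (FV u ++ FV v) F → let⊗ x y ⟨ u , v ⟩ t ≋ F · u · v
    step (variant F′ eF lF f g bv) =
        -- Expanding `t` to an application of `F` brings the body into the shape treated by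
        -- `βlet-η`; the binders of `F` are renamed away from `u` and `v` at the same time.
        let⊗ x y ⟨ u , v ⟩ t ≋⟨ ≋-let ≋-refl (t ≋⟨ ≋-sym expand ⟩ F · ` x · ` y ≋⟨ F≋ (` x) (` y) ⟩ F′ · ` x · ` y ∎) ⟩
        let⊗ x y ⟨ u , v ⟩ (F′ · ` x · ` y) ≋⟨ βlet-η {x} {y} {u} {v} {F′} x≢y (λ p → proj₁ (proj₂ (∈-remove₂⁻ (FV t) (g p))) refl) (λ p → proj₂ (proj₂ (∈-remove₂⁻ (FV t) (g p))) refl) lin′ bv ⟩
        F′ · u · v ≋⟨ ≋-sym {F · u · v} {F′ · u · v} (F≋ u v) ⟩
        F · u · v ∎
      where
      F≋ : ∀ a b → F · a · b ≋ F′ · a · b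
      F≋ a b = ≋-app (≋-app eF ≋-refl) ≋-refl
      dj₁ : Disj (FV F′) (FV u)
      dj₁ p q = d (∈-++⁺ˡ q) (g p)
      dj : Disj (FV F′ ++ FV u) (FV v)
      dj p q with ∈-++⁻ (FV F′) p
      ... | inj₁ r = d (∈-++⁺ʳ (FV u) q) (g r)
      ... | inj₂ r = e r q
      lin′ : Lin (F′ · u · v)
      lin′ = (lF , lu , dj₁) , lv , dj

ηlet⊒ : ∀ {a b s} → a ≢ b → s ⊒ let⊗ a b s ⟨ ` a , ` b ⟩
ηlet⊒ {a} {b} {s} a≢b d = ≈sym (≈ax d (transfer proj₁ ∈-++⁺ˡ g h d) ηlet)
  where
  g : let⊗ a b s ⟨ ` a , ` b ⟩ ⊆ᶠ s
  g p with ∈-++⁻ (FV s) p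
  ... | inj₁ q = q
  ... | inj₂ q with ∈-remove₂⁻ (a ∷ b ∷ []) q
  ...   | here e , n , _ = ⊥-elim (n e)
  ...   | there (here e) , _ , m = ⊥-elim (m e)
  h : ∀ {E A} → HasTy E (let⊗ a b s ⟨ ` a , ` b ⟩) A → HasTy E s A
  h {E} (letp {A = A} {B} d (pair (var e₁) (var e₂)))
    with trans (sym (upd-≡ (upd E b B) a A)) e₁
       | trans (sym (trans (upd-≢ (upd E b B) a A (λ e → a≢b (sym e))) (upd-≡ E b B))) e₂
  ... | refl | refl = d

-- Surjective pairing followed by a commuting conversion. A function on a tensor is thereby
-- determined by its values on pairs of variables, which gives extensionality for the tensor left
-- rule.
split-arg : ∀ {a b t s} → a ≢ b → a ∉ FV t → b ∉ FV t → t · s ⊒ let⊗ a b s (t · ⟨ ` a , ` b ⟩)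
split-arg {a} {b} {t} {s} n a∉ b∉ =
    t · s ⊒⟨ ⊒-appʳ (ηlet⊒ n) ⟩
    t · let⊗ a b s ⟨ ` a , ` b ⟩ ⊒⟨ proj₁ (commʳ ap a∉ b∉) ⟩
    let⊗ a b s (t · ⟨ ` a , ` b ⟩) ∎⊒

comp≋ : ∀ {w t s v} → w ∉ FV t → w ∉ FV s → (ƛ w ⇒ (t · (s · ` w))) · v ≋ t · (s · v)
comp≋ {w} {t} {s} {v} n m =
    (ƛ w ⇒ (t · (s · ` w))) · v ≋⟨ ≋-sym (push-nodeʳ ap n) ⟩
    t · ((ƛ w ⇒ (s · ` w)) · v) ≋⟨ ≋-appʳ (η·≋ m) ⟩
    t · (s · v) ∎

-- Dividing contexts

names-↭ : ∀ {Γ Δ : Ctx} → Γ ↭ Δ → names Γ ↭ names Δ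
names-↭ = ↭.map⁺ proj₁

U-↭ : ∀ {Γ Δ : Ctx} → Γ ↭ Δ → Unique (names Γ) → Unique (names Δ)
U-↭ p = Unique-resp-↭ (names-↭ p)

U-++⁻ : ∀ (Γ : Ctx) {Δ} → Unique (names (Γ ++ Δ)) → Unique (names Γ) × Unique (names Δ) × Disj (names Γ) (names Δ)
U-++⁻ Γ {Δ} u = Unique-++⁻ (names Γ) (≡.subst Unique (map-++ proj₁ Γ Δ) u)

U-∷ : ∀ {x : ℕ} {xs} → x ∉ xs → Unique xs → Unique (x ∷ xs)
U-∷ n u = ∉⇒All≢ n ∷ u

∈-names : ∀ {x A} {Γ : Ctx} → (x , A) ∈ Γ → x ∈ names Γ
∈-names = ∈-map⁺ proj₁

∈-names-++⁻ : ∀ (Γ : Ctx) {Δ z} → z ∈ names (Γ ++ Δ) → z ∈ names Γ ⊎ z ∈ names Δ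
∈-names-++⁻ Γ {Δ} p = ∈-++⁻ (names Γ) (≡.subst (_ ∈_) (map-++ proj₁ Γ Δ) p)

∈-names-++ˡ : ∀ (Γ : Ctx) {Δ z} → z ∈ names Γ → z ∈ names (Γ ++ Δ)
∈-names-++ˡ Γ {Δ} p = ≡.subst (_ ∈_) (sym (map-++ proj₁ Γ Δ)) (∈-++⁺ˡ p)

∈-names-++ʳ : ∀ (Γ : Ctx) {Δ z} → z ∈ names Δ → z ∈ names (Γ ++ Δ)
∈-names-++ʳ Γ {Δ} p = ≡.subst (_ ∈_) (sym (map-++ proj₁ Γ Δ)) (∈-++⁺ʳ (names Γ) p)

⊢-∉ : ∀ {Γ t A z} → Γ ⊢ t ∶ A → z ∉ names Γ → z ∉ FV t
⊢-∉ d n p = n (∈-resp-↭ (proj₂ (names-FV d)) p)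

⊢-Lin : ∀ {Γ t A} → Γ ⊢ t ∶ A → Lin t
⊢-Lin d = proj₁ (names-FV d)

module _ {ℓ} {X : Set ℓ} where

  ↭∷⁻ : ∀ (xs ys : List X) {x zs} → xs ++ ys ↭ x ∷ zs →
    (∃[ xs′ ] (xs ↭ x ∷ xs′ × xs′ ++ ys ↭ zs)) ⊎ (∃[ ys′ ] (ys ↭ x ∷ ys′ × xs ++ ys′ ↭ zs))
  ↭∷⁻ xs ys {x} p with ∈-++⁻ xs (∈-resp-↭ (↭-sym p) (here refl))
  ... | inj₁ q with ∈-∃++ q
  ...   | as , bs , refl = inj₁ (as ++ bs , shift x as bs , drop-∷ (↭-trans (++⁺ʳ ys (↭-sym (shift x as bs))) p))
  ↭∷⁻ xs ys {x} p | inj₂ q with ∈-∃++ q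
  ...   | as , bs , refl = inj₂ (as ++ bs , shift x as bs ,
    drop-∷ (↭-trans (↭-sym (↭-trans (++⁺ˡ xs (shift x as bs)) (shift x xs (as ++ bs)))) p))

  ∷↭∷⁻ : ∀ {y x : X} {ys zs} → y ∷ ys ↭ x ∷ zs →
    (y ≡ x × ys ↭ zs) ⊎ (∃[ ys′ ] (ys ↭ x ∷ ys′ × y ∷ ys′ ↭ zs))
  ∷↭∷⁻ {y} {x} {ys} p with ↭∷⁻ [ y ] ys p
  ... | inj₂ r = inj₂ r
  ... | inj₁ (xs′ , q , r) with ↭.↭-singleton-inv (↭-sym q)
  ...   | refl = inj₁ (refl , r)

-- Inverts the η-style premise of the arrow right rule. The context has no duplicates, so the
-- argument uses up exactly the head entry and leaves `Γ` to `t`.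
strip-var : ∀ {y A Γ t B} → ((y , A) ∷ Γ) ⊢ t · ` y ∶ B → Γ ⊢ t ∶ A ⊸ B
strip-var {y} {A} {Γ} d with inv-app d
... | Γ₁ , Γ₂ , A′ , p , u , d₁ , d₂ with inv-var d₂
...   | refl with ∷↭∷⁻ (↭-trans (↭-sym p) (++-comm Γ₁ _))
...     | inj₁ (refl , q) = perm (↭-sym q) d₁
...     | inj₂ (Γ′ , q , _) with ⊢-Unique d
...       | a ∷ _ = ⊥-elim (All≢⇒∉ a (∈-names (∈-resp-↭ (↭-sym q) (here refl))))

U-tail : ∀ {x : ℕ} {xs} → Unique (x ∷ xs) → Unique xs
U-tail (_ ∷ u) = u

U-head : ∀ {x : ℕ} {xs} → Unique (x ∷ xs) → x ∉ xs
U-head (a ∷ _) = All≢⇒∉ a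

∷-cancel : ∀ {x A A′} {Γ Γ′ : Ctx} → Unique (names ((x , A) ∷ Γ)) → (x , A) ∷ Γ ↭ (x , A′) ∷ Γ′ → A ≡ A′ × Γ ↭ Γ′
∷-cancel (a ∷ _) p with ∷↭∷⁻ p
... | inj₁ (refl , q) = refl , q
... | inj₂ (_ , q , _) = ⊥-elim (All≢⇒∉ a (∈-names (∈-resp-↭ (↭-sym q) (here refl))))

strip-pair : ∀ {a b A B Γ t C} → ((a , A) ∷ (b , B) ∷ Γ) ⊢ t · ⟨ ` a , ` b ⟩ ∶ C → Γ ⊢ t ∶ A ⊗ B ⊸ C
strip-pair {a} {b} {A} {B} {Γ} d with inv-app d
... | Γ₁ , Γ₂ , T , p , u , d₁ , d₂ with inv-pair d₂
...   | Γ₃ , Γ₄ , A′ , B′ , refl , q , _ , d₃ , d₄ with inv-var d₃ | inv-var d₄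
...     | refl | refl with ∷-cancel (⊢-Unique d) (↭-trans (↭-sym p) (↭-trans (++⁺ˡ Γ₁ (↭-sym q)) (++-comm Γ₁ _)))
...       | refl , r with ⊢-Unique d
...         | _ ∷ u′ with ∷-cancel u′ r
...           | refl , r′ = perm (↭-sym r′) d₁

-- Cut-free sequent calculus with proof terms

-- Cut-free sequent proofs with binder-free proof terms: abstraction is
-- expressed by η, and a left rule plugs its proof term into a function.

data CF : Ctx → Tm → Ty → Set where
  cax   : ∀ {x a} → CF [ x , tv a ] (` x) (tv a)
  cperm : ∀ {Γ Γ′ t C} → Γ ↭ Γ′ → CF Γ t C → CF Γ′ t C
  cconv : ∀ {Γ t t′ C} → t ⊒ t′ → CF Γ t′ C → CF Γ t C
  c⊸R   : ∀ {Γ t A B} L → (∀ y → y ∉ L → CF ((y , A) ∷ Γ) (t · ` y) B) → CF Γ t (A ⊸ B)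
  c⊗R   : ∀ {Γ Δ s t A B} → CF Γ s A → CF Δ t B → Unique (names (Γ ++ Δ)) → CF (Γ ++ Δ) ⟨ s , t ⟩ (A ⊗ B)
  c⊗L   : ∀ {Γ t z A B C} L →
          (∀ a b → a ∉ L → b ∉ L → a ≢ b → CF ((a , A) ∷ (b , B) ∷ Γ) (t · ⟨ ` a , ` b ⟩) C) →
          z ∉ names Γ → CF ((z , A ⊗ B) ∷ Γ) (t · ` z) C
  c⊸L   : ∀ {Γ Δ s t f A B C} → CF Γ s A → ∀ L →
          (∀ x → x ∉ L → CF ((x , B) ∷ Δ) (t · ` x) C) →
          Unique (names ((f , A ⊸ B) ∷ Γ ++ Δ)) → CF ((f , A ⊸ B) ∷ Γ ++ Δ) (t · (` f · s)) C

fresh₂ : ∀ L → ∃[ a ] ∃[ b ] (a ∉ L × b ∉ L × a ≢ b)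
fresh₂ L with fresh L
... | a , n with fresh (a ∷ L)
...   | b , m = a , b , n , m ∘ there , λ e → m (here (sym e))

⊢-⊗L : ∀ {Γ t z A B C} → Γ ⊢ t ∶ A ⊗ B ⊸ C → z ∉ names Γ → ((z , A ⊗ B) ∷ Γ) ⊢ t · ` z ∶ C
⊢-⊗L {Γ} d z∉ = perm (++-comm Γ _) (app d ax (U-↭ (++-comm [ _ ] Γ) (U-∷ z∉ (⊢-Unique d))))

⊢-⊸L : ∀ {Γ Δ s t f A B C} → Γ ⊢ s ∶ A → Δ ⊢ t ∶ B ⊸ C → Unique (names ((f , A ⊸ B) ∷ Γ ++ Δ)) →
  ((f , A ⊸ B) ∷ Γ ++ Δ) ⊢ t · (` f · s) ∶ C
⊢-⊸L {Γ} {Δ} {f = f} {A} {B} d e u =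
  perm p (app e (app ax d (proj₁ (U-++⁻ ([ f , A ⊸ B ] ++ Γ) u))) (U-↭ (↭-sym p) u))
  where
  p : Δ ++ (f , A ⊸ B) ∷ Γ ↭ (f , A ⊸ B) ∷ Γ ++ Δ
  p = ++-comm Δ ((f , A ⊸ B) ∷ Γ)

CF⇒⊢ : ∀ {Γ t C} → CF Γ t C → Γ ⊢ t ∶ C
CF-c⊗L : ∀ {Γ t A B C} L →
  (∀ a b → a ∉ L → b ∉ L → a ≢ b → CF ((a , A) ∷ (b , B) ∷ Γ) (t · ⟨ ` a , ` b ⟩) C) → Γ ⊢ t ∶ A ⊗ B ⊸ C
-- One fresh name is enough here; the premise is demanded for all names outside `L` for the sake of
-- inductions on `CF`, which choose names fresh for their own contexts.
CF-c⊸ : ∀ {Γ t A B} L → (∀ y → y ∉ L → CF ((y , A) ∷ Γ) (t · ` y) B) → Γ ⊢ t ∶ A ⊸ B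
CF-c⊗L L h = let a , b , n , m , ne = fresh₂ L in strip-pair (CF⇒⊢ (h a b n m ne))
CF-c⊸ L h = let y , n = fresh L in strip-var (CF⇒⊢ (h y n))
CF⇒⊢ cax = ax
CF⇒⊢ (cperm p d) = perm p (CF⇒⊢ d)
CF⇒⊢ (cconv e d) = ≈⇒ˡ (e (CF⇒⊢ d))
CF⇒⊢ (c⊸R L h) = CF-c⊸ L h
CF⇒⊢ (c⊗R d e u) = pair (CF⇒⊢ d) (CF⇒⊢ e) u
CF⇒⊢ (c⊗L L h z∉) = ⊢-⊗L (CF-c⊗L L h) z∉
CF⇒⊢ (c⊸L d L h u) = ⊢-⊸L (CF⇒⊢ d) (CF-c⊸ L h) u

CF-Unique : ∀ {Γ t C} → CF Γ t C → Unique (names Γ)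
CF-Unique d = ⊢-Unique (CF⇒⊢ d)

-- Cut elimination

-- What the first premise of a cut on a compound formula can still be after its left rules have been
-- commuted out: the conclusion of a right rule.
data Intro : Ctx → Tm → Ty → Set where
  i⊸ : ∀ {Γ t A B} L → (∀ y → y ∉ L → CF ((y , A) ∷ Γ) (t · ` y) B) → Intro Γ t (A ⊸ B)
  i⊗ : ∀ {Γ Δ s t A B} → CF Γ s A → CF Δ t B → Unique (names (Γ ++ Δ)) → Intro (Γ ++ Δ) ⟨ s , t ⟩ (A ⊗ B)

-- Left rules of the first premise commute with a cut on a compound formula.
left : ∀ {Δ s A Γ Q C} → CF Δ s A → (∀ {a} → A ≢ tv a) →
  (∀ {Δ₀ s₀} → Intro Δ₀ s₀ A → Unique (names (Δ₀ ++ Γ)) → CF (Δ₀ ++ Γ) (Q · s₀) C) →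
  Unique (names (Δ ++ Γ)) → CF (Δ ++ Γ) (Q · s) C
left cax n R u = ⊥-elim (n refl)
left {Γ = Γ} (cperm p d) n R u = cperm (++⁺ʳ Γ p) (left d n R (U-↭ (++⁺ʳ Γ (↭-sym p)) u))
left {Q = Q} (cconv e d) n R u = cconv (⊒-appʳ e) (left d n R u)
left (c⊸R L h) n R u = R (i⊸ L h) u
left (c⊗R d e u′) n R u = R (i⊗ d e u′) u
left {Γ = Γ} {Q} {C} (c⊗L {Δ′} {t} {z} {A} {B} L h z∉) n R u@(z∉′ ∷ u′) with fresh (FV Q ++ FV t)
-- The left rule wants a single function applied to `z`, so `Q` and `t` are first composed into one
-- abstraction.
... | w , w∉ = cconv (proj₂ (comp (` z)))
    (c⊗L (L ++ names (Δ′ ++ Γ))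
      (λ a b a∉ b∉ a≢b → cconv (proj₁ (comp ⟨ ` a , ` b ⟩))
        (left (h a b (∉ˡ a∉) (∉ˡ b∉) a≢b) n R (U-∷ (∉-∷ a≢b (∉ʳ L a∉)) (U-∷ (∉ʳ L b∉) u′))))
      (All≢⇒∉ z∉′))
  where
  comp : ∀ v → (ƛ w ⇒ (Q · (t · ` w))) · v ≋ Q · (t · v)
  comp v = comp≋ (∉ˡ w∉) (∉ʳ (FV Q) w∉)
left {Γ = Γ} {Q} {C} (c⊸L {Δ₁} {Δ₂} {s} {t} {f} {A} {B} d L h u₁) n R u@(f∉ ∷ u′) with fresh (FV Q ++ FV t)
... | w , w∉ = cconv (proj₂ (comp (` f · s)))
    (cperm (prep _ (↭-sym p))
      (c⊸L d (L ++ names (Δ₂ ++ Γ))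
        (λ x x∉ → cconv (proj₁ (comp (` x)))
          (left (h x (∉ˡ x∉)) n R (U-∷ (∉ʳ L x∉) (proj₁ (proj₂ (U-++⁻ Δ₁ (U-↭ p u′)))))))
        (U-↭ (prep (f , A ⊸ B) p) u)))
  where
  comp : ∀ v → (ƛ w ⇒ (Q · (t · ` w))) · v ≋ Q · (t · v)
  comp v = comp≋ (∉ˡ w∉) (∉ʳ (FV Q) w∉)
  p : (Δ₁ ++ Δ₂) ++ Γ ↭ Δ₁ ++ (Δ₂ ++ Γ)
  p = ↭-reflexive (++-assoc Δ₁ Δ₂ Γ)

-- The principal tensor cut at the level of terms: cuts on the two components reassemble the
-- application to a pair.
two-cuts≋ : ∀ {a b t s₁ s₂} → a ≢ b → a ∉ FV t → b ∉ FV t → b ∉ FV s₁ → Lin s₁ → Lin s₂ →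
  (ƛ b ⇒ ((ƛ a ⇒ (t · ⟨ ` a , ` b ⟩)) · s₁)) · s₂ ≋ t · ⟨ s₁ , s₂ ⟩
two-cuts≋ {a} {b} {t} {s₁} {s₂} n a∉ b∉ b∉₁ l₁ l₂ =

      (ƛ b ⇒ ((ƛ a ⇒ (t · ⟨ ` a , ` b ⟩)) · s₁)) · s₂ ≋⟨ ≋-app (≋-lam inner) ≋-refl ⟩
      (ƛ b ⇒ (t · ⟨ s₁ , ` b ⟩)) · s₂ ≋⟨ outer ⟩
      t · ⟨ s₁ , s₂ ⟩ ∎
  where
  inner : (ƛ a ⇒ (t · ⟨ ` a , ` b ⟩)) · s₁ ≋ t · ⟨ s₁ , ` b ⟩
  inner =
      (ƛ a ⇒ (t · ⟨ ` a , ` b ⟩)) · s₁ ≋⟨ ≋-sym (push-nodeʳ ap a∉) ⟩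
      t · ((ƛ a ⇒ ⟨ ` a , ` b ⟩) · s₁) ≋⟨ ≋-appʳ
        ((ƛ a ⇒ ⟨ ` a , ` b ⟩) · s₁ ≋⟨ ≋-sym (push-nodeˡ pr (λ { (here e) → n e })) ⟩ ⟨ (ƛ a ⇒ ` a) · s₁ , ` b ⟩ ≋⟨ ≋-pair (β-id l₁) ≋-refl ⟩ ⟨ s₁ , ` b ⟩ ∎) ⟩
      t · ⟨ s₁ , ` b ⟩ ∎
  outer : (ƛ b ⇒ (t · ⟨ s₁ , ` b ⟩)) · s₂ ≋ t · ⟨ s₁ , s₂ ⟩
  outer =
      (ƛ b ⇒ (t · ⟨ s₁ , ` b ⟩)) · s₂ ≋⟨ ≋-sym (push-nodeʳ ap b∉) ⟩
      t · ((ƛ b ⇒ ⟨ s₁ , ` b ⟩) · s₂) ≋⟨ ≋-appʳ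
        ((ƛ b ⇒ ⟨ s₁ , ` b ⟩) · s₂ ≋⟨ ≋-sym (push-nodeʳ pr b∉₁) ⟩ ⟨ s₁ , (ƛ b ⇒ ` b) · s₂ ⟩ ≋⟨ ≋-pair ≋-refl (β-id l₂) ⟩ ⟨ s₁ , s₂ ⟩ ∎) ⟩
      t · ⟨ s₁ , s₂ ⟩ ∎

apply≋ : ∀ {x t r s} → x ∉ FV t → x ∉ FV r → Lin s → (ƛ x ⇒ (t · (` x · r))) · s ≋ t · (s · r)
apply≋ {x} {t} {r} {s} n m l =

      (ƛ x ⇒ (t · (` x · r))) · s ≋⟨ ≋-sym (push-nodeʳ ap n) ⟩
      t · ((ƛ x ⇒ (` x · r)) · s) ≋⟨ ≋-appʳ ((ƛ x ⇒ (` x · r)) · s ≋⟨ ≋-sym (push-nodeˡ ap m) ⟩ ((ƛ x ⇒ ` x) · s) · r ≋⟨ ≋-app (β-id l) ≋-refl ⟩ s · r ∎) ⟩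
      t · (s · r) ∎

open module CtxSolver = CommutativeMonoidSolver (++-commutativeMonoid {A = ℕ × Ty}) public using (prove; _⊕_) renaming (var to evar)

v0 : ∀ {n} → CtxSolver.Expr (suc n)
v0 = evar (# 0)
v1 : ∀ {n} → CtxSolver.Expr (suc (suc n))
v1 = evar (# 1)
v2 : ∀ {n} → CtxSolver.Expr (suc (suc (suc n)))
v2 = evar (# 2)
v3 : ∀ {n} → CtxSolver.Expr (suc (suc (suc (suc n))))
v3 = evar (# 3)

-- Structural in the cut formula, then in the second premise, whose exchanges are absorbed by the
-- permutation argument. Rules that do not act on the cut formula are permuted below the cut. Where
-- the last rule does act on it, `left` brings a right rule to the front in the first premise, and
-- `R` replaces the cut by cuts on the two components.
cut : ∀ A {Δ s Γ x t C Θ} → CF Δ s A → CF Θ t C → Θ ↭ (x , A) ∷ Γ → Unique (names (Δ ++ Γ)) →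
  CF (Δ ++ Γ) ((ƛ x ⇒ t) · s) C
cut A {Δ} {s} ds cax p u with ↭.↭-singleton-inv (↭-sym p)
... | refl = cperm (↭-reflexive (sym (++-identityʳ Δ))) (cconv (proj₁ (β-id (⊢-Lin (CF⇒⊢ ds)))) ds)
cut A ds (cperm q d) p u = cut A ds d (↭-trans q p) u
cut A {x = x} ds (cconv {t = t} {t′} e d) p u = cconv (⊒-appˡ (⊒-lam e)) (cut A ds d p u)
cut A {Δ} {s} {Γ} {x} {t} ds (c⊸R {A = D} L h) p u =
  c⊸R (x ∷ L ++ names (Δ ++ Γ)) λ y y∉ →
    cconv (proj₁ (push-nodeˡ ap (λ { (here e) → y∉ (here (sym e)) })))
      (cperm (shift (y , D) Δ Γ)
        (cut A ds (h y (∉ˡ (y∉ ∘ there))) (↭-trans (prep _ p) (swap _ _ ↭-refl))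
          (U-↭ (↭-sym (shift (y , D) Δ Γ)) (U-∷ (∉ʳ L (y∉ ∘ there)) u))))
cut A {Δ} {s} {Γ} {x} ds (c⊗R {Γ₁} {Γ₂} {t₁} {t₂} d₁ d₂ u₁₂) p u with ↭∷⁻ Γ₁ Γ₂ p
... | inj₁ (Γ₁′ , q , r) = cperm r′
    (cconv (proj₂ (push-nodeˡ pr x∉))
      (c⊗R (cut A ds d₁ q (proj₁ (U-++⁻ (Δ ++ Γ₁′) u′))) d₂ u′))
  where
  r′ : (Δ ++ Γ₁′) ++ Γ₂ ↭ Δ ++ Γ
  r′ = ↭-trans (↭-reflexive (++-assoc Δ Γ₁′ Γ₂)) (++⁺ˡ Δ r)
  u′ = U-↭ (↭-sym r′) u
  x∉ : x ∉ FV t₂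
  x∉ = ⊢-∉ (CF⇒⊢ d₂) (λ z → proj₂ (proj₂ (U-++⁻ Γ₁ u₁₂)) (∈-resp-↭ (names-↭ (↭-sym q)) (here refl)) z)
... | inj₂ (Γ₂′ , q , r) = cperm r′
    (cconv (proj₂ (push-nodeʳ pr x∉))
      (c⊗R d₁ (cut A ds d₂ q (proj₁ (proj₂ (U-++⁻ Γ₁ u′)))) u′))
  where
  r′ : Γ₁ ++ (Δ ++ Γ₂′) ↭ Δ ++ Γ
  r′ = ↭-trans (prove 3 (v0 ⊕ (v1 ⊕ v2)) (v1 ⊕ (v0 ⊕ v2)) (Γ₁ ∷ Δ ∷ Γ₂′ ∷ [])) (++⁺ˡ Δ r)
  u′ = U-↭ (↭-sym r′) u
  x∉ : x ∉ FV t₁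
  x∉ = ⊢-∉ (CF⇒⊢ d₁) (λ z → proj₂ (proj₂ (U-++⁻ Γ₁ u₁₂)) z (∈-resp-↭ (names-↭ (↭-sym q)) (here refl)))
cut A {Δ} {s} {Γ} {x} ds (c⊗L {Γ₀} {t} {z} {D} {E} L h z∉) p u with ∷↭∷⁻ p
... | inj₂ (Γ₀′ , q , r) = cperm r′
    (cconv (proj₂ push)
      (c⊗L (x ∷ L ++ names (Δ ++ Γ₀′)) (λ a b a∉ b∉ a≢b →
        cconv (proj₁ (push-nodeˡ ap
                 (λ { (here e) → a∉ (here (sym e)) ; (there (here e)) → b∉ (here (sym e)) })))
          (cperm (prove 4 (v0 ⊕ (v1 ⊕ (v2 ⊕ v3))) (v1 ⊕ (v2 ⊕ (v0 ⊕ v3))) (Δ ∷ [ a , D ] ∷ [ b , E ] ∷ Γ₀′ ∷ []))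
            (cut A ds (h a b (∉ˡ (a∉ ∘ there)) (∉ˡ (b∉ ∘ there)) a≢b)
              (↭-trans (prep _ (prep _ q)) (prove 4 (v1 ⊕ (v2 ⊕ (v0 ⊕ v3))) (v0 ⊕ (v1 ⊕ (v2 ⊕ v3))) ([ x , A ] ∷ [ a , D ] ∷ [ b , E ] ∷ Γ₀′ ∷ [])) )
              (U-↭ (prove 4 (v1 ⊕ (v2 ⊕ (v0 ⊕ v3))) (v0 ⊕ (v1 ⊕ (v2 ⊕ v3))) (Δ ∷ [ a , D ] ∷ [ b , E ] ∷ Γ₀′ ∷ []))
                (U-∷ (∉-∷ a≢b (∉ʳ L (a∉ ∘ there))) (U-∷ (∉ʳ L (b∉ ∘ there)) u₀))))))
        (U-head u′)))
  where
  push : ((ƛ x ⇒ t) · s) · ` z ≋ (ƛ x ⇒ (t · ` z)) · s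
  push = push-nodeˡ ap (λ { (here refl) → z∉ (∈-names (∈-resp-↭ (↭-sym q) (here refl))) })
  r′ : (z , D ⊗ E) ∷ (Δ ++ Γ₀′) ↭ Δ ++ Γ
  r′ = ↭-trans (↭-sym (shift (z , D ⊗ E) Δ Γ₀′)) (++⁺ˡ Δ r)
  u′ = U-↭ (↭-sym r′) u
  u₀ : Unique (names (Δ ++ Γ₀′))
  u₀ = (U-tail u′)
... | inj₁ (refl , q) = cperm (++⁺ˡ Δ q) (left ds (λ ()) R (U-↭ (++⁺ˡ Δ (↭-sym q)) u))
  where
  x∉t : x ∉ FV t
  x∉t = ⊢-∉ (CF-c⊗L L h) z∉
  R : ∀ {Δ₀ s₀} → Intro Δ₀ s₀ (D ⊗ E) → Unique (names (Δ₀ ++ Γ₀)) → CF (Δ₀ ++ Γ₀) ((ƛ x ⇒ (t · ` x)) · s₀) _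
  R (i⊗ {Δ₁} {Δ₂} {s₁} {s₂} d₁ d₂ u₁₂) u₀ with fresh₂ (L ++ FV t ++ FV s₁ ++ names ((Δ₁ ++ Δ₂) ++ Γ₀))
  ... | a , b , a∉ , b∉ , a≢b =
    cconv ((ƛ x ⇒ (t · ` x)) · ⟨ s₁ , s₂ ⟩ ⊒⟨ proj₁ (η·≋ x∉t) ⟩
        t · ⟨ s₁ , s₂ ⟩ ⊒⟨ proj₂ (two-cuts≋ a≢b (∉ˡ (∉ʳ L a∉)) (∉ˡ (∉ʳ L b∉)) (∉ˡ (∉ʳ (FV t) (∉ʳ L b∉))) (⊢-Lin (CF⇒⊢ d₁)) (⊢-Lin (CF⇒⊢ d₂))) ⟩
        (ƛ b ⇒ ((ƛ a ⇒ (t · ⟨ ` a , ` b ⟩)) · s₁)) · s₂ ∎⊒)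
      (cperm (prove 3 (v1 ⊕ (v0 ⊕ v2)) ((v0 ⊕ v1) ⊕ v2) (Δ₁ ∷ Δ₂ ∷ Γ₀ ∷ []))
        (cut E d₂ (cut D d₁ (h a b (∉ˡ a∉) (∉ˡ b∉) a≢b) ↭-refl uc₁) (shift (b , E) Δ₁ Γ₀) uc₂))
    where
    uc₂ : Unique (names (Δ₂ ++ (Δ₁ ++ Γ₀)))
    uc₂ = U-↭ (prove 3 ((v0 ⊕ v1) ⊕ v2) (v1 ⊕ (v0 ⊕ v2)) (Δ₁ ∷ Δ₂ ∷ Γ₀ ∷ [])) u₀
    b∉′ : b ∉ names (Δ₁ ++ Γ₀)
    b∉′ p′ = ∉ʳ (FV s₁) (∉ʳ (FV t) (∉ʳ L b∉)) (∈-resp-↭ (names-↭ (prove 3 (v1 ⊕ (v0 ⊕ v2)) ((v0 ⊕ v1) ⊕ v2) (Δ₁ ∷ Δ₂ ∷ Γ₀ ∷ []))) (∈-names-++ʳ Δ₂ p′))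
    uc₁ : Unique (names (Δ₁ ++ (b , E) ∷ Γ₀))
    uc₁ = U-↭ (↭-sym (shift (b , E) Δ₁ Γ₀)) (U-∷ b∉′ (proj₁ (proj₂ (U-++⁻ Δ₂ uc₂))))
cut A {Δ} {s} {Γ} {x} ds (c⊸L {Γ₁} {Γ₂} {r} {t} {f} {D} {E} dr L h uf) p u with ∷↭∷⁻ p
... | inj₁ (refl , q) = cperm (++⁺ˡ Δ q) (left ds (λ ()) R (U-↭ (++⁺ˡ Δ (↭-sym q)) u))
  where
  x∉₁₂ : x ∉ names (Γ₁ ++ Γ₂)
  x∉₁₂ = U-head uf
  x∉t : x ∉ FV t
  x∉t = ⊢-∉ (CF-c⊸ L h) (x∉₁₂ ∘ ∈-names-++ʳ Γ₁)
  x∉r : x ∉ FV r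
  x∉r = ⊢-∉ (CF⇒⊢ dr) (x∉₁₂ ∘ ∈-names-++ˡ Γ₁)
  R : ∀ {Δ₀ s₀} → Intro Δ₀ s₀ (D ⊸ E) → Unique (names (Δ₀ ++ (Γ₁ ++ Γ₂))) →
    CF (Δ₀ ++ (Γ₁ ++ Γ₂)) ((ƛ x ⇒ (t · (` x · r))) · s₀) _
  R {Δ₀} {s₀} i@(i⊸ L′ h′) u₀ with fresh (L′ ++ FV s₀ ++ names Δ₀) | fresh (L ++ FV t)
  ... | y , y∉ | w , w∉ =
    cconv ((ƛ x ⇒ (t · (` x · r))) · s₀ ⊒⟨ proj₁ (apply≋ x∉t x∉r (⊢-Lin (CF-c⊸ L′ h′))) ⟩
        -- Both functions are η-expanded into redexes, the form in which `cut` delivers its proof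
        -- terms.
        t · (s₀ · r) ⊒⟨ ⊒-appʳ (proj₂ (η·≋ (∉ˡ (∉ʳ L′ y∉)))) ⟩
        t · ((ƛ y ⇒ (s₀ · ` y)) · r) ⊒⟨ proj₂ (η·≋ (∉ʳ L w∉)) ⟩
        (ƛ w ⇒ (t · ` w)) · ((ƛ y ⇒ (s₀ · ` y)) · r) ∎⊒)
      (cperm (prove 3 ((v1 ⊕ v0) ⊕ v2) (v0 ⊕ (v1 ⊕ v2)) (Δ₀ ∷ Γ₁ ∷ Γ₂ ∷ []))
        (cut E (cut D dr (h′ y (∉ˡ y∉)) ↭-refl (proj₁ (U-++⁻ (Γ₁ ++ Δ₀) uc))) (h w (∉ˡ w∉)) ↭-refl uc))
    where
    uc : Unique (names ((Γ₁ ++ Δ₀) ++ Γ₂))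
    uc = U-↭ (prove 3 (v0 ⊕ (v1 ⊕ v2)) ((v1 ⊕ v0) ⊕ v2) (Δ₀ ∷ Γ₁ ∷ Γ₂ ∷ [])) u₀
... | inj₂ (Θ , q , r′) with ↭∷⁻ Γ₁ Γ₂ q
...   | inj₁ (Γ₁′ , q₁ , q₂) = cperm p₁
    (cconv (proj₂ push)
      (c⊸L (cut A ds dr q₁ (proj₁ (U-++⁻ (Δ ++ Γ₁′) u₁))) L h uf′))
  where
  p₀ : (Δ ++ Γ₁′) ++ Γ₂ ↭ Δ ++ Θ
  p₀ = ↭-trans (↭-reflexive (++-assoc Δ Γ₁′ Γ₂)) (++⁺ˡ Δ q₂)
  p₁ : (f , D ⊸ E) ∷ (Δ ++ Γ₁′) ++ Γ₂ ↭ Δ ++ Γ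
  p₁ = ↭-trans (prep _ p₀) (↭-trans (↭-sym (shift _ Δ Θ)) (++⁺ˡ Δ r′))
  uf′ : Unique (names ((f , D ⊸ E) ∷ (Δ ++ Γ₁′) ++ Γ₂))
  uf′ = U-↭ (↭-sym p₁) u
  u₁ : Unique (names ((Δ ++ Γ₁′) ++ Γ₂))
  u₁ = (U-tail uf′)
  x∈₁ : x ∈ names Γ₁
  x∈₁ = ∈-resp-↭ (names-↭ (↭-sym q₁)) (here refl)
  x∉t : x ∉ FV t
  x∉t = ⊢-∉ (CF-c⊸ L h) (proj₂ (proj₂ (U-++⁻ Γ₁ (U-tail uf))) x∈₁)
  x≢f : x ∉ FV (` f)
  x≢f (here refl) = U-head uf (∈-names-++ˡ Γ₁ x∈₁)
  push : t · (` f · ((ƛ x ⇒ r) · s)) ≋ (ƛ x ⇒ (t · (` f · r))) · s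
  push =
      t · (` f · ((ƛ x ⇒ r) · s)) ≋⟨ ≋-appʳ (push-nodeʳ ap x≢f) ⟩
      t · ((ƛ x ⇒ (` f · r)) · s) ≋⟨ push-nodeʳ ap x∉t ⟩
      (ƛ x ⇒ (t · (` f · r))) · s ∎
...   | inj₂ (Γ₂′ , q₁ , q₂) = cperm p₁
    (cconv (proj₂ (push (` f · r) x∉fr))
      (c⊸L dr (x ∷ L ++ names (Δ ++ Γ₂′)) (λ y y∉ →
        cconv (proj₁ (push (` y) (λ { (here e) → y∉ (here (sym e)) })))
          (cperm (shift (y , E) Δ Γ₂′)
            (cut A ds (h y (∉ˡ (y∉ ∘ there))) (↭-trans (prep _ q₁) (swap _ _ ↭-refl))
              (U-↭ (↭-sym (shift (y , E) Δ Γ₂′)) (U-∷ (∉ʳ L (y∉ ∘ there)) u₂))))) uf′))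
  where
  p₁ : (f , D ⊸ E) ∷ Γ₁ ++ (Δ ++ Γ₂′) ↭ Δ ++ Γ
  p₁ = ↭-trans (prep _ (↭-trans (prove 3 (v0 ⊕ (v1 ⊕ v2)) (v1 ⊕ (v0 ⊕ v2)) (Γ₁ ∷ Δ ∷ Γ₂′ ∷ [])) (++⁺ˡ Δ q₂)))
         (↭-trans (↭-sym (shift _ Δ Θ)) (++⁺ˡ Δ r′))
  uf′ : Unique (names ((f , D ⊸ E) ∷ Γ₁ ++ (Δ ++ Γ₂′)))
  uf′ = U-↭ (↭-sym p₁) u
  u₂ : Unique (names (Δ ++ Γ₂′))
  u₂ = proj₁ (proj₂ (U-++⁻ Γ₁ (U-tail uf′)))
  x∈₂ : x ∈ names Γ₂
  x∈₂ = ∈-resp-↭ (names-↭ (↭-sym q₁)) (here refl)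
  x∉fr : x ∉ FV (` f · r)
  x∉fr (here refl) = U-head uf (∈-names-++ʳ Γ₁ x∈₂)
  x∉fr (there z) = proj₂ (proj₂ (U-++⁻ Γ₁ (U-tail uf))) (∈-resp-↭ (proj₂ (names-FV (CF⇒⊢ dr))) z) x∈₂
  push : ∀ v → x ∉ FV v → ((ƛ x ⇒ t) · s) · v ≋ (ƛ x ⇒ (t · v)) · s
  push v n = push-nodeˡ ap n

-- From typing derivations to cut-free proofs

I : Tm
I = ƛ 0 ⇒ ` 0

I≋ : ∀ {t} → Lin t → I · t ≋ t
I≋ = β-id

-- The axiom is restricted to atoms, so identities at compound types are η-expanded; `I` is the
-- trivial function into which the left rules plug.
CF-id : ∀ A x → CF [ x , A ] (` x) A
CF-id (tv a) x = cax
CF-id (A ⊗ B) x = cconv (proj₂ (I≋ tt))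
  (c⊗L [] (λ a b _ _ a≢b → cconv (proj₁ (I≋ (tt , tt , λ { (here e) (here e′) → a≢b (trans (sym e) e′) })))
    (c⊗R (CF-id A a) (CF-id B b) ((a≢b ∷ []) ∷ [] ∷ []))) (λ ()))
CF-id (A ⊸ B) x = c⊸R [ x ] λ y y∉ →
  cconv (proj₂ (I≋ (tt , tt , λ { (here refl) (here e) → y∉ (here (sym e)) })))
    (cperm (swap _ _ ↭-refl)
      (c⊸L (CF-id A y) [] (λ z _ → cconv (proj₁ (I≋ tt)) (CF-id B z))
        (((λ e → y∉ (here (sym e))) ∷ []) ∷ [] ∷ [])))

CF-lam : ∀ {x A Γ t B} → CF ((x , A) ∷ Γ) t B → CF Γ (ƛ x ⇒ t) (A ⊸ B)
CF-lam {x} {A} {Γ} d = c⊸R (names Γ) λ y y∉ → cut A (CF-id A y) d ↭-refl (U-∷ y∉ (U-tail (CF-Unique d)))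

-- An application is a cut of `t` against the arrow left rule for a fresh `f`, with `I` as
-- continuation.
CF-app : ∀ {Γ Δ t s A B} → CF Γ t (A ⊸ B) → CF Δ s A → Unique (names (Γ ++ Δ)) → CF (Γ ++ Δ) (t · s) B
CF-app {Γ} {Δ} {t} {s} {A} {B} d e u with fresh (names Δ ++ FV s)
... | f , f∉ = cconv (t · s ⊒⟨ proj₂ (I≋ l) ⟩
    I · (t · s) ⊒⟨ proj₂ (apply≋ (λ ()) (∉ʳ (names Δ) f∉) (proj₁ l)) ⟩
    (ƛ f ⇒ (I · (` f · s))) · t ∎⊒)
  (cut (A ⊸ B) d (cperm (prep _ (↭-reflexive (++-identityʳ Δ)))
    (c⊸L {f = f} e [] (λ z _ → cconv (proj₁ (I≋ tt)) (CF-id B z))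
      (U-∷ f∉′ (U-↭ (↭-reflexive (sym (++-identityʳ Δ))) (CF-Unique e))))) ↭-refl u)
  where
  f∉′ : f ∉ names (Δ ++ [])
  f∉′ = ≡.subst (λ Γ → f ∉ names Γ) (sym (++-identityʳ Δ)) (∉ˡ f∉)
  l : Lin (t · s)
  l = ⊢-Lin (app (CF⇒⊢ d) (CF⇒⊢ e) u)

-- Presents a let as a function applied to its scrutinee, the form that the left rules and `cut`
-- require.
β-let : ∀ {w x y s t} → w ∉ FV t → (ƛ w ⇒ let⊗ x y (` w) t) · s ≋ let⊗ x y s t
β-let {w} {x} {y} {s} {t} w∉ = unconditional {(ƛ w ⇒ let⊗ x y (` w) t) · s} {let⊗ x y s t} lin λ l → go (lin⁻ l)
  where
  K = let⊗ x y (` w) t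
  R = remove x (remove y (FV t))
  lin : Lin (let⊗ x y s t) → Lin ((ƛ w ⇒ K) · s)
  lin (ls , lt , n , x∈ , y∈ , d) =
    ((tt , lt , n , x∈ , y∈ , λ { (here refl) q → w∉ (proj₁ (∈-remove₂⁻ (FV t) q)) }) , here refl) , ls , dj
    where
    dj : Disj (remove w (w ∷ R)) (FV s)
    dj p q with ∈-remove⁻ (w ∷ R) p
    ... | here e , k = k e
    ... | there p′ , _ = d q p′
  lin⁻ : Lin ((ƛ w ⇒ K) · s) → Lin (let⊗ x y s t)
  lin⁻ (((_ , lt , n , x∈ , y∈ , _) , _) , ls , d) = ls , lt , n , x∈ , y∈ ,
    λ p q → d (∈-remove⁺ {xs = w ∷ R} (there q) (λ { refl → w∉ (proj₁ (∈-remove₂⁻ (FV t) q)) })) p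
  go : Lin (let⊗ x y s t) → (ƛ w ⇒ K) · s ≋ let⊗ x y s t
  go l@(ls , lt , n , x∈ , y∈ , d) = step (freshen (FV s) t lt)
    where
    step : Variant (FV s) t → (ƛ w ⇒ K) · s ≋ let⊗ x y s t
    step (variant t₁ e₁ l₁ f g b) with fresh₂ (w ∷ FV s ++ Vars t₁)
    ... | x′ , y′ , x′∉ , y′∉ , x′≢y′ =

          (ƛ w ⇒ K) · s ≋⟨ β-≋ (Lin-λ· {w} {K} {let⊗ x′ y′ (` w) t₂} {s} (lin l) Lw.lin′ K⊆ K⊇) (K ≋⟨ ≋-let ≋-refl e₁ ⟩ let⊗ x y (` w) t₁ ≋⟨ Lw.α-let ⟩ let⊗ x′ y′ (` w) t₂ ∎) bv eq ⟩
          let⊗ x′ y′ s t₂ ≋⟨ ≋-sym Ls.α-let ⟩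
          let⊗ x y s t₁ ≋⟨ ≋-let ≋-refl (≋-sym e₁) ⟩
          let⊗ x y s t ∎
      where
      lin-s : Lin (let⊗ x y s t₁)
      lin-s = ls , l₁ , n , f x∈ , f y∈ , λ p q → d p (remove-mono (remove-mono g) q)
      lin-w : Lin (let⊗ x y (` w) t₁)
      lin-w = tt , l₁ , n , f x∈ , f y∈ , λ { (here refl) q → w∉ (g (proj₁ (∈-remove₂⁻ (FV t₁) q))) }
      x′∉₁ : x′ ∉ Vars t₁
      x′∉₁ = ∉ʳ (FV s) (x′∉ ∘ there)
      y′∉₁ : y′ ∉ Vars t₁
      y′∉₁ = ∉ʳ (FV s) (y′∉ ∘ there)
      module Ls = αLet {x} {y} {x′} {y′} {s} {t₁} lin-s x′∉₁ y′∉₁ x′≢y′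
      module Lw = αLet {x} {y} {x′} {y′} {` w} {t₁} lin-w x′∉₁ y′∉₁ x′≢y′
      t₂ : Tm
      t₂ = Lw.t′
      K⊆ : K ⊆ᶠ let⊗ x′ y′ (` w) t₂
      K⊆ p = Lw.⊇ₗ (++-mono {[ w ]} {[ w ]} id (remove-mono (remove-mono f)) p)
      K⊇ : let⊗ x′ y′ (` w) t₂ ⊆ᶠ K
      K⊇ p = ++-mono {[ w ]} {[ w ]} id (remove-mono (remove-mono g)) (Lw.⊆ₗ p)
      w∉₂ : w ∉ remove x′ (remove y′ (FV t₂))
      w∉₂ p = w∉ (g (proj₁ (∈-remove₂⁻ (FV t₁) (Lw.⊆₀ p))))
      bv : ∀ {z} → z ∈ BV (let⊗ x′ y′ (` w) t₂) → z ∉ FV s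
      bv (here refl) = ∉ˡ (x′∉ ∘ there)
      bv (there (here refl)) = ∉ˡ (y′∉ ∘ there)
      bv {z} (there (there p)) = b (≡.subst (z ∈_) (BV-rename t₁ {Lw.σ}
        (λ v → cong BV (Renames.look-ρ (rename₂ {x} {x′} {y} {y′} {t₁} x′∉₁ y′∉₁ x′≢y′) v))) p)
      eq : subst [ w ↦ s ] (let⊗ x′ y′ (` w) t₂) ≡ let⊗ x′ y′ s t₂
      eq = cong₂ (let⊗ x′ y′) (look-≡ w s []) (subst-id t₂ lk)
        where
        lk : ∀ {z} → z ∈ FV t₂ → look (dropS x′ (dropS y′ [ w ↦ s ])) z ≡ ` z
        lk {z} z∈ with z ≟ x′
        ... | yes refl = look-drop-≡ x′ (dropS y′ [ w ↦ s ])
        ... | no k with z ≟ y′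
        ...   | yes refl = trans (look-drop-≢ (dropS y′ [ w ↦ s ]) k) (look-drop-≡ y′ [ w ↦ s ])
        ...   | no j = trans (look-drop-≢ (dropS y′ [ w ↦ s ]) k) (trans (look-drop-≢ [ w ↦ s ] j)
                  (look-≢ {u = s} {[]} (λ { refl → w∉₂ (∈-remove₂⁺ z∈ k j) })))

-- Introductions become right rules, eliminations become cuts against left rules.
fundamental : ∀ {Γ t A} → Γ ⊢ t ∶ A → CF Γ t A
fundamental {A = A} ax = CF-id A _
fundamental (exch Γ Δ d) = cperm (swap-mid Γ) (fundamental d)
fundamental (lam d) = CF-lam (fundamental d)
fundamental (app d e u) = CF-app (fundamental d) (fundamental e) u
fundamental (pair d e u) = c⊗R (fundamental d) (fundamental e) u
fundamental (letp {Γ} {Δ} {x} {y} {s} {t} {A} {B} {C} d e u) with fresh (names Δ ++ FV t)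
... | z , z∉ = cconv (let⊗ x y s t ⊒⟨ proj₂ (β-let (∉ʳ (names Δ) z∉)) ⟩
    G · s ⊒⟨ proj₂ (η·≋ z∉G) ⟩
    (ƛ z ⇒ (G · ` z)) · s ∎⊒)
  (cut (A ⊗ B) (fundamental d) (c⊗L (names Δ) branch (∉ˡ z∉)) ↭-refl u)
  where
  G = ƛ z ⇒ let⊗ x y (` z) t
  F = ƛ x ⇒ (ƛ y ⇒ t)
  z∉G : z ∉ FV G
  z∉G p = proj₂ (∈-remove⁻ (z ∷ remove x (remove y (FV t))) p) refl
  cF : CF Δ F (A ⊸ B ⊸ C)
  cF = CF-lam (CF-lam (cperm (swap _ _ ↭-refl) (fundamental e)))
  branch : ∀ a b → a ∉ names Δ → b ∉ names Δ → a ≢ b → CF ((a , A) ∷ (b , B) ∷ Δ) (G · ⟨ ` a , ` b ⟩) C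
  branch a b a∉ b∉ a≢b = cconv
    (G · ⟨ ` a , ` b ⟩ ⊒⟨ proj₁ (β-let (∉ʳ (names Δ) z∉)) ⟩
        let⊗ x y ⟨ ` a , ` b ⟩ t ⊒⟨ proj₁ (βlet≋) ⟩
        F · ` a · ` b ∎⊒)
    (cperm p (CF-app (CF-app cF (CF-id A a) (proj₁ (U-++⁻ (Δ ++ [ a , A ]) ub))) (CF-id B b) ub))
    where
    p : (Δ ++ [ a , A ]) ++ [ b , B ] ↭ (a , A) ∷ (b , B) ∷ Δ
    p = prove 3 ((v0 ⊕ v1) ⊕ v2) (v1 ⊕ (v2 ⊕ v0)) (Δ ∷ [ a , A ] ∷ [ b , B ] ∷ [])
    ub : Unique (names ((Δ ++ [ a , A ]) ++ [ b , B ]))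
    ub = U-↭ (↭-sym p) (U-∷ (∉-∷ a≢b a∉) (U-∷ b∉ (U-tail (U-tail (⊢-Unique e)))))

-- Type variables: disjoint copies and signed occurrences

-- Even and odd indices serve as two disjoint copies of the supply of type variables; `interleave`
-- combines one substitution on each copy. Nesting gives further copies.
ev od : ℕ → ℕ
ev zero    = 0
ev (suc n) = suc (suc (ev n))
od n = suc (ev n)

interleave : ∀ {ℓ} {X : Set ℓ} → (ℕ → X) → (ℕ → X) → ℕ → X
interleave f g zero          = f 0
interleave f g (suc zero)    = g 0
interleave f g (suc (suc n)) = interleave (f ∘ suc) (g ∘ suc) n

interleave-ev : ∀ {ℓ} {X : Set ℓ} (f g : ℕ → X) n → interleave f g (ev n) ≡ f n
interleave-ev f g zero = refl
interleave-ev f g (suc n) = interleave-ev (f ∘ suc) (g ∘ suc) n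

interleave-od : ∀ {ℓ} {X : Set ℓ} (f g : ℕ → X) n → interleave f g (od n) ≡ g n
interleave-od f g zero = refl
interleave-od f g (suc n) = interleave-od (f ∘ suc) (g ∘ suc) n

parity : ∀ n → (∃[ m ] n ≡ ev m) ⊎ (∃[ m ] n ≡ od m)
parity zero = inj₁ (0 , refl)
parity (suc zero) = inj₂ (0 , refl)
parity (suc (suc n)) with parity n
... | inj₁ (m , refl) = inj₁ (suc m , refl)
... | inj₂ (m , refl) = inj₂ (suc m , refl)

sub-cong : ∀ {θ θ′} → (∀ n → θ n ≡ θ′ n) → ∀ A → sub θ A ≡ sub θ′ A
sub-cong h (tv a) = h a
sub-cong h (A ⊗ B) = cong₂ _⊗_ (sub-cong h A) (sub-cong h B)
sub-cong h (A ⊸ B) = cong₂ _⊸_ (sub-cong h A) (sub-cong h B)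

sub-∘ : ∀ θ θ′ A → sub θ (sub θ′ A) ≡ sub (sub θ ∘ θ′) A
sub-∘ θ θ′ (tv a) = refl
sub-∘ θ θ′ (A ⊗ B) = cong₂ _⊗_ (sub-∘ θ θ′ A) (sub-∘ θ θ′ B)
sub-∘ θ θ′ (A ⊸ B) = cong₂ _⊸_ (sub-∘ θ θ′ A) (sub-∘ θ θ′ B)

ren : (ℕ → ℕ) → Ty → Ty
ren ρ = sub (tv ∘ ρ)

ren-ev : ∀ (θ θ′ : TySub) A → sub (interleave θ θ′) (ren ev A) ≡ sub θ A
ren-ev θ θ′ A = trans (sub-∘ _ _ A) (sub-cong (interleave-ev θ θ′) A)

ren-od : ∀ (θ θ′ : TySub) A → sub (interleave θ θ′) (ren od A) ≡ sub θ′ A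
ren-od θ θ′ A = trans (sub-∘ _ _ A) (sub-cong (interleave-od θ θ′) A)

δ : ℕ → ℕ → ℕ
δ n a with n ≟ a
... | yes _ = 1
... | no _  = 0

δ-≡ : ∀ n → δ n n ≡ 1
δ-≡ n with n ≟ n
... | yes _ = refl
... | no k  = ⊥-elim (k refl)

δ-≢ : ∀ {n a} → n ≢ a → δ n a ≡ 0
δ-≢ {n} {a} k with n ≟ a
... | yes e = ⊥-elim (k e)
... | no _  = refl

-- The Boolean is a sign: `true` counts the positive occurrences of the variable `n`, `false` the
-- negative ones, and the domain of an arrow flips it.
occ : Bool → ℕ → Ty → ℕ
occ b n (tv a) = if b then δ n a else 0
occ b n (A ⊗ B) = occ b n A + occ b n B
occ b n (A ⊸ B) = occ (not b) n A + occ b n B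

tot : ℕ → Ty → ℕ
tot n (tv a) = δ n a
tot n (A ⊗ B) = tot n A + tot n B
tot n (A ⊸ B) = tot n A + tot n B

occ≤tot : ∀ b n A → occ b n A ≤ tot n A
occ≤tot true n (tv a) = ℕ.≤-refl
occ≤tot false n (tv a) = z≤n
occ≤tot b n (A ⊗ B) = ℕ.+-mono-≤ (occ≤tot b n A) (occ≤tot b n B)
occ≤tot b n (A ⊸ B) = ℕ.+-mono-≤ (occ≤tot (not b) n A) (occ≤tot b n B)

ev-injective : ∀ {m n} → ev m ≡ ev n → m ≡ n
ev-injective {zero} {zero} e = refl
ev-injective {suc m} {suc n} e = cong suc (ev-injective (ℕ.suc-injective (ℕ.suc-injective e)))

ev≢od : ∀ {m n} → ev m ≢ od n
ev≢od {zero} ()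
ev≢od {suc m} {zero} ()
ev≢od {suc m} {suc n} e = ev≢od {m} {n} (ℕ.suc-injective (ℕ.suc-injective e))

tot-ren : ∀ {ρ} → (∀ {m n} → ρ m ≡ ρ n → m ≡ n) → ∀ n A → tot (ρ n) (ren ρ A) ≡ tot n A
tot-ren {ρ} inj n (tv a) with n ≟ a
... | yes refl = δ-≡ (ρ n)
... | no k = δ-≢ (k ∘ inj)
tot-ren inj n (A ⊗ B) = cong₂ _+_ (tot-ren inj n A) (tot-ren inj n B)
tot-ren inj n (A ⊸ B) = cong₂ _+_ (tot-ren inj n A) (tot-ren inj n B)

tot-ren-∉ : ∀ {ρ n} → (∀ m → n ≢ ρ m) → ∀ A → tot n (ren ρ A) ≡ 0
tot-ren-∉ k (tv a) = δ-≢ (k a)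
tot-ren-∉ k (A ⊗ B) = cong₂ _+_ (tot-ren-∉ k A) (tot-ren-∉ k B)
tot-ren-∉ k (A ⊸ B) = cong₂ _+_ (tot-ren-∉ k A) (tot-ren-∉ k B)

distinct-+ : ∀ {A B} → (∀ n → tot n A ≤ 1) → (∀ n → tot n B ≤ 1) →
  ∀ n → tot n (ren ev A) + tot n (ren od B) ≤ 1
distinct-+ {A} {B} h k n with parity n
... | inj₁ (m , refl) rewrite tot-ren {ev} ev-injective m A
      | tot-ren-∉ {od} {ev m} (λ _ → ev≢od) B | ℕ.+-identityʳ (tot m A) = h m
... | inj₂ (m , refl) rewrite tot-ren {od} (ev-injective ∘ ℕ.suc-injective) m B
      | tot-ren-∉ {ev} {od m} (λ _ e → ev≢od (sym e)) A = k m

-- Renaming atoms along a proof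

-- Every occurrence, input or output, gets a variable of its own, because the two sides of a
-- connective are sent to even and odd indices; `ρ` remembers the original names. Of these labels
-- `label` keeps those at the inputs.
relabel : ∀ A → ∃[ A⁰ ] ∃[ ρ ] (ren ρ A⁰ ≡ A × (∀ n → tot n A⁰ ≤ 1))
relabel (tv a) = tv 0 , (λ _ → a) , refl , δ≤1
  where
  δ≤1 : ∀ n → δ n 0 ≤ 1
  δ≤1 n with n ≟ 0
  ... | yes _ = ℕ.≤-refl
  ... | no _ = z≤n
relabel (A ⊗ B) with relabel A | relabel B
... | A⁰ , ρ , e , h | B⁰ , ρ′ , e′ , h′ = ren ev A⁰ ⊗ ren od B⁰ , interleave ρ ρ′ ,
  cong₂ _⊗_ (trans (sub-∘ _ _ A⁰) (trans (sub-cong (cong tv ∘ interleave-ev ρ ρ′) A⁰) e))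
            (trans (sub-∘ _ _ B⁰) (trans (sub-cong (cong tv ∘ interleave-od ρ ρ′) B⁰) e′)) ,
  distinct-+ {A⁰} {B⁰} h h′
relabel (A ⊸ B) with relabel A | relabel B
... | A⁰ , ρ , e , h | B⁰ , ρ′ , e′ , h′ = ren ev A⁰ ⊸ ren od B⁰ , interleave ρ ρ′ ,
  cong₂ _⊸_ (trans (sub-∘ _ _ A⁰) (trans (sub-cong (cong tv ∘ interleave-ev ρ ρ′) A⁰) e))
            (trans (sub-∘ _ _ B⁰) (trans (sub-cong (cong tv ∘ interleave-od ρ ρ′) B⁰) e′)) ,
  distinct-+ {A⁰} {B⁰} h h′

-- Agree ρ b A A′: A and A′ have the same shape and the same atoms at the
-- occurrences of sign b, while the other atoms are only equal up to ρ.

data Agree (ρ : ℕ → ℕ) : Bool → Ty → Ty → Set where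
  fixed : ∀ {a} → Agree ρ true (tv a) (tv a)
  free  : ∀ {a b} → ρ a ≡ ρ b → Agree ρ false (tv a) (tv b)
  _⊗_   : ∀ {b A A′ B B′} → Agree ρ b A A′ → Agree ρ b B B′ → Agree ρ b (A ⊗ B) (A′ ⊗ B′)
  _⊸_   : ∀ {b A A′ B B′} → Agree ρ (not b) A A′ → Agree ρ b B B′ → Agree ρ b (A ⊸ B) (A′ ⊸ B′)

Agree-ren : ∀ {ρ b A A′} → Agree ρ b A A′ → ren ρ A ≡ ren ρ A′
Agree-ren fixed = refl
Agree-ren (free e) = cong tv e
Agree-ren (p ⊗ q) = cong₂ _⊗_ (Agree-ren p) (Agree-ren q)
Agree-ren (p ⊸ q) = cong₂ _⊸_ (Agree-ren p) (Agree-ren q)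

Agree-occ : ∀ {ρ b A A′} → Agree ρ b A A′ → ∀ n → occ b n A ≡ occ b n A′
Agree-occ fixed n = refl
Agree-occ (free e) n = refl
Agree-occ (p ⊗ q) n = cong₂ _+_ (Agree-occ p n) (Agree-occ q n)
Agree-occ (p ⊸ q) n = cong₂ _+_ (Agree-occ p n) (Agree-occ q n)

Agree-sym : ∀ {ρ b A A′} → Agree ρ b A A′ → Agree ρ b A′ A
Agree-sym fixed = fixed
Agree-sym (free e) = free (sym e)
Agree-sym (p ⊗ q) = Agree-sym p ⊗ Agree-sym q
Agree-sym (p ⊸ q) = Agree-sym p ⊸ Agree-sym q

Agree-trans : ∀ {ρ b A A′ A″} → Agree ρ b A A′ → Agree ρ b A′ A″ → Agree ρ b A A″
Agree-trans fixed fixed = fixed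
Agree-trans (free e) (free e′) = free (trans e e′)
Agree-trans (p ⊗ q) (p′ ⊗ q′) = Agree-trans p p′ ⊗ Agree-trans q q′
Agree-trans (p ⊸ q) (p′ ⊸ q′) = Agree-trans p p′ ⊸ Agree-trans q q′

data CtxRel (R : Ty → Ty → Set) : Ctx → Ctx → Set where
  []  : CtxRel R [] []
  _∷_ : ∀ {x A B Γ Δ} → R A B → CtxRel R Γ Δ → CtxRel R ((x , A) ∷ Γ) ((x , B) ∷ Δ)

CtxRel-names : ∀ {R Γ Δ} → CtxRel R Γ Δ → names Γ ≡ names Δ
CtxRel-names [] = refl
CtxRel-names (_ ∷ r) = cong (_ ∷_) (CtxRel-names r)

CtxRel-flip : ∀ {R Γ Δ} → CtxRel R Γ Δ → CtxRel (λ A B → R B A) Δ Γ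
CtxRel-flip [] = []
CtxRel-flip (p ∷ r) = p ∷ CtxRel-flip r

CtxRel-↭ : ∀ {R Γ Γ′ Δ} → Γ ↭ Γ′ → CtxRel R Γ Δ → ∃[ Δ′ ] (Δ ↭ Δ′ × CtxRel R Γ′ Δ′)
CtxRel-↭ _↭_.refl r = _ , ↭-refl , r
CtxRel-↭ (prep x p) (a ∷ r) with CtxRel-↭ p r
... | Δ′ , q , r′ = _ , prep _ q , a ∷ r′
CtxRel-↭ (swap x y p) (a ∷ b ∷ r) with CtxRel-↭ p r
... | Δ′ , q , r′ = _ , swap _ _ q , b ∷ a ∷ r′
CtxRel-↭ (_↭_.trans p p′) r with CtxRel-↭ p r
... | Δ′ , q , r′ with CtxRel-↭ p′ r′
...   | Δ″ , q′ , r″ = Δ″ , ↭-trans q q′ , r″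

CtxRel-++⁻ : ∀ {R} Γ₁ {Γ₂ Δ} → CtxRel R (Γ₁ ++ Γ₂) Δ →
  ∃[ Δ₁ ] ∃[ Δ₂ ] (Δ ≡ Δ₁ ++ Δ₂ × CtxRel R Γ₁ Δ₁ × CtxRel R Γ₂ Δ₂)
CtxRel-++⁻ [] r = [] , _ , refl , [] , r
CtxRel-++⁻ (_ ∷ Γ₁) (a ∷ r) with CtxRel-++⁻ Γ₁ r
... | Δ₁ , Δ₂ , refl , r₁ , r₂ = _ , Δ₂ , refl , a ∷ r₁ , r₂

CtxRel-++⁺ : ∀ {R Γ₁ Γ₂ Δ₁ Δ₂} → CtxRel R Γ₁ Δ₁ → CtxRel R Γ₂ Δ₂ → CtxRel R (Γ₁ ++ Γ₂) (Δ₁ ++ Δ₂)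
CtxRel-++⁺ [] r = r
CtxRel-++⁺ (a ∷ r₁) r = a ∷ CtxRel-++⁺ r₁ r

-- The atoms at the inputs of a sequent (negative in the conclusion, positive
-- in the hypotheses) can be named at will; the cut-free proof then dictates
-- the names at the outputs.

Over : (ℕ → ℕ) → Ty → Ty → Set
Over ρ A A⁰ = ren ρ A⁰ ≡ A

label : ∀ {ρ Γ t C Γ⁰ C⁰} → CF Γ t C → CtxRel (Over ρ) Γ Γ⁰ → Over ρ C C⁰ →
  ∃[ Γ′ ] ∃[ C′ ] (CtxRel (Agree ρ true) Γ⁰ Γ′ × Agree ρ false C⁰ C′ × Γ′ ⊢ t ∶ C′)
label {C⁰ = tv c} cax (_∷_ {B = tv b} e []) e′ =
  -- The output `c` of an axiom is renamed to the input `b` to which the axiom links it.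
  _ , tv b , fixed ∷ [] , free (tv-injective (trans e′ (sym e))) , ax
  where
  tv-injective : ∀ {a b} → tv a ≡ tv b → a ≡ b
  tv-injective refl = refl
label {C⁰ = tv c} cax (_∷_ {B = _ ⊗ _} () []) e′
label {C⁰ = tv c} cax (_∷_ {B = _ ⊸ _} () []) e′
label {C⁰ = _ ⊗ _} cax r ()
label {C⁰ = _ ⊸ _} cax r ()
label (cperm p d) r e with CtxRel-↭ (↭-sym p) r
... | Γ₁ , q , r₁ with label d r₁ e
...   | Γ₂ , C′ , s , a , d′ with CtxRel-↭ (↭-sym q) s
...     | Γ₃ , q′ , s′ = Γ₃ , C′ , s′ , a , perm q′ d′
label (cconv c d) r e with label d r e
... | Γ′ , C′ , s , a , d′ = Γ′ , C′ , s , a , ≈⇒ˡ (c d′)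
label {C⁰ = tv _} (c⊸R L h) r ()
label {C⁰ = _ ⊗ _} (c⊸R L h) r ()
label {C⁰ = A⁰ ⊸ B⁰} (c⊸R L h) r refl with fresh L
... | y , n with label (h y n) (refl ∷ r) refl
...   | _ , C′ , a ∷ s , b , d′ = _ , _ , s , a ⊸ b , strip-var d′
label {C⁰ = tv _} (c⊗R d e u) r ()
label {C⁰ = _ ⊸ _} (c⊗R d e u) r ()
label {C⁰ = A⁰ ⊗ B⁰} (c⊗R {Γ₁} d e u) r refl with CtxRel-++⁻ Γ₁ r
... | Δ₁ , Δ₂ , refl , r₁ , r₂ with label d r₁ refl | label e r₂ refl
...   | Γ₁′ , A′ , s₁ , a₁ , d₁ | Γ₂′ , B′ , s₂ , a₂ , d₂ =
  _ , _ , CtxRel-++⁺ s₁ s₂ , a₁ ⊗ a₂ ,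
  pair d₁ d₂ (≡.subst Unique (trans (CtxRel-names r) (CtxRel-names (CtxRel-++⁺ s₁ s₂))) u)
label (c⊗L L h z∉) (_∷_ {B = tv _} () r) e
label (c⊗L L h z∉) (_∷_ {B = _ ⊸ _} () r) e
label (c⊗L L h z∉) (_∷_ {B = A⁰ ⊗ B⁰} refl r) e with fresh₂ L
... | a , b , a∉ , b∉ , a≢b with label (h a b a∉ b∉ a≢b) (refl ∷ refl ∷ r) e
...   | _ , C′ , p ∷ q ∷ s , c , d′ = _ , C′ , p ⊗ q ∷ s , c ,
  ⊢-⊗L (strip-pair d′) (λ z∈ → z∉ (≡.subst (_ ∈_) (sym (trans (CtxRel-names r) (CtxRel-names s))) z∈))
label (c⊸L d L h u) (_∷_ {B = tv _} () r) e
label (c⊸L d L h u) (_∷_ {B = _ ⊗ _} () r) e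
label (c⊸L {Γ₁} d L h u) (_∷_ {x = f} {B = A⁰ ⊸ B⁰} refl r) e with CtxRel-++⁻ Γ₁ r
... | Δ₁ , Δ₂ , refl , r₁ , r₂ with fresh L
...   | x , x∉ with label d r₁ refl | label (h x x∉) (refl ∷ r₂) e
...     | Γ₁′ , A′ , s₁ , a₁ , d₁ | _ , C′ , b ∷ s₂ , c , d₂ =
  _ , C′ , (a₁ ⊸ b) ∷ CtxRel-++⁺ s₁ s₂ , c ,
  ⊢-⊸L d₁ (strip-var d₂) (≡.subst (λ l → Unique (f ∷ l)) (trans (CtxRel-names r) (CtxRel-names (CtxRel-++⁺ s₁ s₂))) u)

-- Balance of inputs and outputs

occΓ : Bool → ℕ → Ctx → ℕ
occΓ b n [] = 0
occΓ b n ((_ , A) ∷ Γ) = occ b n A + occΓ b n Γ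

occΓ-++ : ∀ b n Γ {Δ} → occΓ b n (Γ ++ Δ) ≡ occΓ b n Γ + occΓ b n Δ
occΓ-++ b n [] = refl
occΓ-++ b n ((_ , A) ∷ Γ) = trans (cong (occ b n A +_) (occΓ-++ b n Γ)) (sym (ℕ.+-assoc (occ b n A) _ _))

occΓ-↭ : ∀ b n {Γ Δ} → Γ ↭ Δ → occΓ b n Γ ≡ occΓ b n Δ
occΓ-↭ b n _↭_.refl = refl
occΓ-↭ b n (prep (_ , A) p) = cong (occ b n A +_) (occΓ-↭ b n p)
occΓ-↭ b n (swap (_ , A) (_ , B) p) = trans (sym (ℕ.+-assoc (occ b n A) _ _))
  (trans (cong₂ _+_ (ℕ.+-comm (occ b n A) (occ b n B)) (occΓ-↭ b n p)) (ℕ.+-assoc (occ b n B) _ _))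
occΓ-↭ b n (_↭_.trans p q) = trans (occΓ-↭ b n p) (occΓ-↭ b n q)

-- Outputs (b = true) and inputs (b = false) of a sequent
occS : Bool → ℕ → Ctx → Ty → ℕ
occS b n Γ C = occΓ (not b) n Γ + occ b n C

occS-⊗R : ∀ b n Γ Δ A B → occS b n (Γ ++ Δ) (A ⊗ B) ≡ occS b n Γ A + occS b n Δ B
occS-⊗R b n Γ Δ A B rewrite occΓ-++ (not b) n Γ {Δ} =
  solve 4 (λ g d a c → (g :+ d) :+ (a :+ c) := (g :+ a) :+ (d :+ c)) refl (occΓ (not b) n Γ) (occΓ (not b) n Δ) (occ b n A) (occ b n B)
  where open +-*-Solver

not² : ∀ b → not (not b) ≡ b
not² true = refl
not² false = refl

occS-⊸L : ∀ b n {f x} Γ Δ A B C →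
  occS b n ((f , A ⊸ B) ∷ Γ ++ Δ) C ≡ occS b n Γ A + occS b n ((x , B) ∷ Δ) C
occS-⊸L b n Γ Δ A B C rewrite occΓ-++ (not b) n Γ {Δ} | not² b =
  solve 5 (λ a e g d c → ((a :+ e) :+ (g :+ d)) :+ c := (g :+ a) :+ ((e :+ d) :+ c)) refl (occ b n A) (occ (not b) n B) (occΓ (not b) n Γ) (occΓ (not b) n Δ) (occ b n C)
  where open +-*-Solver

occS-⊸R : ∀ b n {y} Γ A B → occS b n Γ (A ⊸ B) ≡ occS b n ((y , A) ∷ Γ) B
occS-⊸R b n Γ A B =
  solve 3 (λ g a c → g :+ (a :+ c) := (a :+ g) :+ c) refl (occΓ (not b) n Γ) (occ (not b) n A) (occ b n B)
  where open +-*-Solver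

occS-⊗L : ∀ b n {z x y} Γ A B C →
  occS b n ((z , A ⊗ B) ∷ Γ) C ≡ occS b n ((x , A) ∷ (y , B) ∷ Γ) C
occS-⊗L b n Γ A B C = cong (_+ occ b n C) (ℕ.+-assoc (occ (not b) n A) _ _)

occS-↭ : ∀ b n {Γ Δ} C → Γ ↭ Δ → occS b n Γ C ≡ occS b n Δ C
occS-↭ b n C p = cong (_+ occ b n C) (occΓ-↭ (not b) n p)

-- An axiom links one output to one input of the same name; all other rules merely regroup
-- occurrences.
balanced : ∀ {Γ t C} → CF Γ t C → ∀ n → occS true n Γ C ≡ occS false n Γ C
balanced (cax {a = a}) n = sym (trans (ℕ.+-identityʳ _) (ℕ.+-identityʳ (δ n a)))
balanced (cperm {C = C} p d) n = trans (sym (occS-↭ true n C p)) (trans (balanced d n) (occS-↭ false n C p))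
balanced (cconv _ d) n = balanced d n
balanced (c⊸R {Γ} {A = A} {B} L h) n with fresh L
... | y , y∉ = trans (occS-⊸R true n {y} Γ A B) (trans (balanced (h y y∉) n) (sym (occS-⊸R false n {y} Γ A B)))
balanced (c⊗R {Γ} {Δ} {A = A} {B} d e _) n = trans (occS-⊗R true n Γ Δ A B)
  (trans (cong₂ _+_ (balanced d n) (balanced e n)) (sym (occS-⊗R false n Γ Δ A B)))
balanced (c⊗L {Γ} {z = z} {A} {B} {C} L h _) n with fresh₂ L
... | a , b , a∉ , b∉ , a≢b = trans (occS-⊗L true n {z} {a} {b} Γ A B C)
  (trans (balanced (h a b a∉ b∉ a≢b) n) (sym (occS-⊗L false n {z} {a} {b} Γ A B C)))
balanced (c⊸L {Γ} {Δ} {f = f} {A} {B} {C} d L h _) n with fresh L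
... | x , x∉ = trans (occS-⊸L true n {f} {x} Γ Δ A B C)
  (trans (cong₂ _+_ (balanced d n) (balanced (h x x∉) n)) (sym (occS-⊸L false n {f} {x} Γ Δ A B C)))

-- Colours of type variables

-- A proof cannot link occurrences of
-- different colours, so the colours show where a sequent must be split.

Mono : (ℕ → Bool) → Bool → Ty → Set
Mono κ c (tv a)  = κ a ≡ c
Mono κ c (A ⊗ B) = Mono κ c A × Mono κ c B
Mono κ c (A ⊸ B) = Mono κ c A × Mono κ c B

MonoΓ : (ℕ → Bool) → Bool → Ctx → Set
MonoΓ κ c = All (λ (_ , A) → Mono κ c A)

Coloured : (ℕ → Bool) → Ctx → Set
Coloured κ = All (λ (_ , A) → ∃[ c ] Mono κ c A)

Mono-unique : ∀ {κ c c′} A → Mono κ c A → Mono κ c′ A → c ≡ c′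
Mono-unique (tv a) p q = trans (sym p) q
Mono-unique (A ⊗ B) (p , _) (q , _) = Mono-unique A p q
Mono-unique (A ⊸ B) (p , _) (q , _) = Mono-unique A p q

true≢false : true ≢ false
true≢false ()

mono-head : ∀ {κ c x A Γ} → MonoΓ κ c ((x , A) ∷ Γ) → Mono κ c A
mono-head (m ∷ _) = m

mono-tail : ∀ {κ c x A Γ} → MonoΓ κ c ((x , A) ∷ Γ) → MonoΓ κ c Γ
mono-tail (_ ∷ m) = m

-- In a linear proof every hypothesis is connected to the conclusion. The critical rule is `c⊸L`:
-- the main premise forces the codomain to the colour of the conclusion, the domain has the same
-- colour, and the side premise then spreads it over its own context.
connected : ∀ {κ c Γ t C} → CF Γ t C → Mono κ c C → Coloured κ Γ → MonoΓ κ c Γ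
connected cax m (_ ∷ []) = m ∷ []
connected (cperm p d) m k = ↭.All-resp-↭ p (connected d m (↭.All-resp-↭ (↭-sym p) k))
connected (cconv _ d) m k = connected d m k
connected (c⊸R L h) (mA , mB) k with fresh L
... | y , y∉ with connected (h y y∉) mB ((_ , mA) ∷ k)
...   | _ ∷ r = r
connected (c⊗R {Γ} d e _) (mA , mB) k = All.++⁺ (connected d mA (All.++⁻ˡ Γ k)) (connected e mB (All.++⁻ʳ Γ k))
connected (c⊗L L h _) m ((_ , mA , mB) ∷ k) with fresh₂ L
... | a , b , a∉ , b∉ , a≢b with connected (h a b a∉ b∉ a≢b) m ((_ , mA) ∷ (_ , mB) ∷ k)
...   | pA ∷ pB ∷ r = (pA , pB) ∷ r
connected (c⊸L {Γ} {B = B} d L h _) m ((_ , mA , mB) ∷ k) with fresh L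
... | x , x∉ with connected (h x x∉) m ((_ , mB) ∷ All.++⁻ʳ Γ k)
...   | pB ∷ r with Mono-unique B pB mB
...     | refl = (mA , mB) ∷ All.++⁺ (connected d mA (All.++⁻ˡ Γ k)) r

-- The colour of a hypothesis decides in which half of a divided context it lies.
take-true : ∀ {κ x A Θ₁ Θ₂ Γ} → Θ₁ ++ Θ₂ ↭ (x , A) ∷ Γ → MonoΓ κ true Θ₁ → MonoΓ κ false Θ₂ → Mono κ true A →
  ∃[ Θ₁′ ] (Θ₁ ↭ (x , A) ∷ Θ₁′ × Θ₁′ ++ Θ₂ ↭ Γ × MonoΓ κ true Θ₁′)
take-true {A = A} {Θ₁} {Θ₂} p m₁ m₂ m with ↭∷⁻ Θ₁ Θ₂ p
... | inj₁ (Θ₁′ , q , r) = Θ₁′ , q , r , All.tail (↭.All-resp-↭ q m₁)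
... | inj₂ (_ , q , _) = ⊥-elim (true≢false (Mono-unique A m (All.head (↭.All-resp-↭ q m₂))))

take-false : ∀ {κ x A Θ₁ Θ₂ Γ} → Θ₁ ++ Θ₂ ↭ (x , A) ∷ Γ → MonoΓ κ true Θ₁ → MonoΓ κ false Θ₂ → Mono κ false A →
  ∃[ Θ₂′ ] (Θ₂ ↭ (x , A) ∷ Θ₂′ × Θ₁ ++ Θ₂′ ↭ Γ × MonoΓ κ false Θ₂′)
take-false {A = A} {Θ₁} {Θ₂} p m₁ m₂ m with ↭∷⁻ Θ₁ Θ₂ p
... | inj₂ (Θ₂′ , q , r) = Θ₂′ , q , r , All.tail (↭.All-resp-↭ q m₂)
... | inj₁ (_ , q , _) = ⊥-elim (true≢false (Mono-unique A (All.head (↭.All-resp-↭ q m₁)) m))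

partition-unique : ∀ {κ} Γ₁ {Γ₂ Θ₁ Θ₂} → Θ₁ ++ Θ₂ ↭ Γ₁ ++ Γ₂ → MonoΓ κ true Θ₁ → MonoΓ κ false Θ₂ →
  MonoΓ κ true Γ₁ → MonoΓ κ false Γ₂ → Θ₁ ↭ Γ₁ × Θ₂ ↭ Γ₂
partition-unique [] {Θ₁ = []} p _ _ _ _ = ↭-refl , p
partition-unique [] {Θ₁ = (_ , A) ∷ Θ₁} p (m ∷ _) _ _ n =
  ⊥-elim (true≢false (Mono-unique A m (All.lookup n (∈-resp-↭ p (here refl)))))
partition-unique (_ ∷ Γ₁) p m₁ m₂ (n ∷ n₁) n₂ with take-true p m₁ m₂ n
... | Θ₁′ , q , r , m₁′ with partition-unique Γ₁ r m₁′ m₂ n₁ n₂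
...   | s , s′ = ↭-trans q (prep _ s) , s′

-- Extensionality, and splitting proof terms along colours

≈-ext : ∀ {y Γ t t′ A B} → y ∉ FV t → y ∉ FV t′ → Γ ⊢ t ∶ A ⊸ B → Γ ⊢ t′ ∶ A ⊸ B →
  ((y , A) ∷ Γ) ⊢ t · ` y ≈ t′ · ` y ∶ B → Γ ⊢ t ≈ t′ ∶ A ⊸ B
≈-ext n n′ d d′ e = ≈trans (η⊒ n (≈⇒ˡ (≈lam e))) (≈trans (≈lam e) (≈sym (η⊒ n′ (≈⇒ʳ (≈lam e)))))

≈-ext⊗ : ∀ {a b z Γ t t′ A B C} → a ≢ b → a ∉ FV t → b ∉ FV t → a ∉ FV t′ → b ∉ FV t′ → z ∉ names Γ →
  ((a , A) ∷ (b , B) ∷ Γ) ⊢ t · ⟨ ` a , ` b ⟩ ≈ t′ · ⟨ ` a , ` b ⟩ ∶ C →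
  ((z , A ⊗ B) ∷ Γ) ⊢ t · ` z ≈ t′ · ` z ∶ C
≈-ext⊗ {a} {b} {z} {Γ} {t} {t′} ne n m n′ m′ z∉ e =
  ≈trans (split-arg ne n m (≈⇒ˡ e′)) (≈trans e′ (≈sym (split-arg ne n′ m′ (≈⇒ʳ e′))))
  where
  e′ = ≈let (≈refl (ax {z})) e (U-∷ z∉ (U-tail (U-tail (⊢-Unique (≈⇒ˡ e)))))

≈-⊸L : ∀ {Γ Δ s s′ t t′ f A B C} → Γ ⊢ s ≈ s′ ∶ A → Δ ⊢ t ≈ t′ ∶ B ⊸ C → Unique (names ((f , A ⊸ B) ∷ Γ ++ Δ)) →
  ((f , A ⊸ B) ∷ Γ ++ Δ) ⊢ t · (` f · s) ≈ t′ · (` f · s′) ∶ C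
≈-⊸L {Γ} {Δ} {f = f} {A} {B} d e u =
  ≈perm p (≈app e (≈app (≈refl ax) d (proj₁ (U-++⁻ ([ f , A ⊸ B ] ++ Γ) u))) (U-↭ (↭-sym p) u))
  where
  p : Δ ++ (f , A ⊸ B) ∷ Γ ↭ (f , A ⊸ B) ∷ Γ ++ Δ
  p = ++-comm Δ ((f , A ⊸ B) ∷ Γ)

⊢-let : ∀ {Θ Θ′ x y z a A B C} → Θ ↭ (x , A) ∷ (y , B) ∷ Θ′ → Θ ⊢ a ∶ C → z ∉ names Θ′ →
  ((z , A ⊗ B) ∷ Θ′) ⊢ let⊗ x y (` z) a ∶ C
⊢-let {z = z} p d z∉ = letp (ax {z}) (perm p d) (U-∷ z∉ (U-tail (U-tail (⊢-Unique (perm p d)))))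

⊢-cut : ∀ {Θ Θ′ Γ x g s a A B C} → Θ ↭ (x , B) ∷ Θ′ → Θ ⊢ a ∶ C → Γ ⊢ s ∶ A →
  Unique (names ((g , A ⊸ B) ∷ Γ ++ Θ′)) → ((g , A ⊸ B) ∷ Γ ++ Θ′) ⊢ (ƛ x ⇒ a) · (` g · s) ∶ C
⊢-cut p d e u = ⊢-⊸L e (lam (perm p d)) u

-- If f : A ⊸ B is the only formula with two colours,
-- every proof term factors through an application of f.

record Split⊸ (κ : ℕ → Bool) (Θ : Ctx) (t : Tm) (f : ℕ) (A B C : Ty) (Θ′ : Ctx) : Set where
  constructor split
  field
    {Θ₁ Θ₂} : Ctx
    {a b}   : Tm
    part    : Θ₁ ++ Θ₂ ↭ Θ′
    mono₁   : MonoΓ κ true Θ₁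
    mono₂   : MonoΓ κ false Θ₂
    typ₁    : Θ₁ ⊢ a ∶ A
    typ₂    : Θ₂ ⊢ b ∶ B ⊸ C
    eq      : Θ ⊢ t ≈ b · (` f · a) ∶ C

record Split⊗ (κ : ℕ → Bool) (Θ : Ctx) (t : Tm) (A B : Ty) : Set where
  constructor split
  field
    {Θ₁ Θ₂} : Ctx
    {a b}   : Tm
    part    : Θ₁ ++ Θ₂ ↭ Θ
    mono₁   : MonoΓ κ true Θ₁
    mono₂   : MonoΓ κ false Θ₂
    typ₁    : Θ₁ ⊢ a ∶ A
    typ₂    : Θ₂ ⊢ b ∶ B
    eq      : Θ ⊢ t ≈ ⟨ a , b ⟩ ∶ A ⊗ B

-- Brings the right rule to the end of the proof. A left rule below it acts on a hypothesis of one
-- colour, hence entirely within one component of the pair, and a commutation moves it into that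
-- component.
split⊗ : ∀ {κ Θ t A B} → CF Θ t (A ⊗ B) → Mono κ true A → Mono κ false B → Coloured κ Θ → Split⊗ κ Θ t A B
split⊗ (cperm p d) mA mB k with split⊗ d mA mB (↭.All-resp-↭ (↭-sym p) k)
... | split q m₁ m₂ d₁ d₂ e = split (↭-trans q p) m₁ m₂ d₁ d₂ (≈perm p e)
split⊗ (cconv c d) mA mB k with split⊗ d mA mB k
... | split q m₁ m₂ d₁ d₂ e = split q m₁ m₂ d₁ d₂ (≈trans (c (≈⇒ˡ e)) e)
split⊗ (c⊗R {Γ} d e u) mA mB k =
  split ↭-refl (connected d mA (All.++⁻ˡ Γ k)) (connected e mB (All.++⁻ʳ Γ k)) (CF⇒⊢ d) (CF⇒⊢ e)
    (≈refl (pair (CF⇒⊢ d) (CF⇒⊢ e) u))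
split⊗ (c⊗L {Γ} {t} {z} L h z∉) mA mB ((c , mD , mE) ∷ k) with fresh₂ (L ++ FV t)
... | p , q , p∉ , q∉ , p≢q with split⊗ (h p q (∉ˡ p∉) (∉ˡ q∉) p≢q) mA mB ((c , mD) ∷ (c , mE) ∷ k)
...   | split {Θ₁} {Θ₂} {a} {b} π m₁ m₂ d₁ d₂ e = branch c mD mE
  where
  u : Unique (p ∷ q ∷ names Γ)
  u = ⊢-Unique (≈⇒ˡ e)
  e′ : ((z , _) ∷ Γ) ⊢ t · ` z ≈ let⊗ p q (` z) ⟨ a , b ⟩ ∶ _
  e′ = ≈trans (split-arg p≢q (∉ʳ L p∉) (∉ʳ L q∉) (≈⇒ˡ l)) l
    where l = ≈let (≈refl (ax {z})) e (U-∷ z∉ (U-tail (U-tail u)))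
  z∉ₗ : ∀ {Θ₁ Θ₂} → Θ₁ ++ Θ₂ ↭ Γ → z ∉ names Θ₁
  z∉ₗ {Θ₁} r x = z∉ (∈-resp-↭ (names-↭ r) (∈-names-++ˡ Θ₁ x))
  z∉ᵣ : ∀ {Θ₁ Θ₂} → Θ₁ ++ Θ₂ ↭ Γ → z ∉ names Θ₂
  z∉ᵣ {Θ₁} r x = z∉ (∈-resp-↭ (names-↭ r) (∈-names-++ʳ Θ₁ x))
  uΘ : Unique (names (Θ₁ ++ Θ₂))
  uΘ = U-↭ (↭-sym π) u
  branch : ∀ c → Mono _ c _ → Mono _ c _ → Split⊗ _ _ (t · ` z) _ _
  branch true mD mE with take-true π m₁ m₂ mD
  ... | Θ₁′ , r₁ , π₁ , m₁′ with take-true π₁ m₁′ m₂ mE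
  ...   | Θ₁″ , r₂ , π₂ , m₁″ = split (prep _ π₂) ((mD , mE) ∷ m₁″) m₂ (⊢-let r d₁ (z∉ₗ π₂)) d₂
          (≈trans e′ (≈sym (proj₁ (commˡ pr (off (here refl)) (off (there (here refl)))) (≈⇒ʳ e′))))
    where
    r = ↭-trans r₁ (prep _ r₂)
    off : ∀ {v} → v ∈ p ∷ q ∷ [] → v ∉ FV b
    off {v} v∈ = ⊢-∉ d₂ (λ w → proj₂ (proj₂ (U-++⁻ Θ₁ uΘ)) (∈-resp-↭ (names-↭ (↭-sym r)) (v∈′ v∈)) w)
      where
      v∈′ : v ∈ p ∷ q ∷ [] → v ∈ p ∷ q ∷ names Θ₁″
      v∈′ (here e) = here e
      v∈′ (there (here e)) = there (here e)
  branch false mD mE with take-false π m₁ m₂ mD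
  ... | Θ₂′ , r₁ , π₁ , m₂′ with take-false π₁ m₁ m₂′ mE
  ...   | Θ₂″ , r₂ , π₂ , m₂″ = split (↭-trans (shift _ Θ₁ Θ₂″) (prep _ π₂)) m₁ ((mD , mE) ∷ m₂″) d₁ (⊢-let r d₂ (z∉ᵣ {Θ₁} π₂))
          (≈trans e′ (≈sym (proj₁ (commʳ pr (off (here refl)) (off (there (here refl)))) (≈⇒ʳ e′))))
    where
    r = ↭-trans r₁ (prep _ r₂)
    off : ∀ {v} → v ∈ p ∷ q ∷ [] → v ∉ FV a
    off {v} v∈ = ⊢-∉ d₁ (λ w → proj₂ (proj₂ (U-++⁻ Θ₁ uΘ)) w (∈-resp-↭ (names-↭ (↭-sym r)) (v∈′ v∈)))
      where
      v∈′ : v ∈ p ∷ q ∷ [] → v ∈ p ∷ q ∷ names Θ₂″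
      v∈′ (here e) = here e
      v∈′ (there (here e)) = there (here e)
split⊗ (c⊸L {Γ₁} {Γ₂} {s} {t} {g} {D} {E} dr L h ug) mA mB ((c , mD , mE) ∷ k) with fresh (L ++ FV t)
... | x , x∉ with split⊗ (h x (∉ˡ x∉)) mA mB ((c , mE) ∷ All.++⁻ʳ Γ₁ k)
...   | split {Θ₁} {Θ₂} {a} {b} π m₁ m₂ d₁ d₂ e = branch c mD mE
  where
  e′ : ((g , D ⊸ E) ∷ Γ₁ ++ Γ₂) ⊢ t · (` g · s) ≈ (ƛ x ⇒ ⟨ a , b ⟩) · (` g · s) ∶ _
  e′ = ≈trans (proj₂ (η·≋ (∉ʳ L x∉)) (≈⇒ˡ l)) l
    where l = ≈-⊸L (≈refl (CF⇒⊢ dr)) (≈lam e) ug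
  uΘ : Unique (names (Θ₁ ++ Θ₂))
  uΘ = U-↭ (↭-sym π) (⊢-Unique (≈⇒ˡ e))
  branch : ∀ c → Mono _ c D → Mono _ c E → Split⊗ _ _ (t · (` g · s)) _ _
  branch true mD mE with take-true π m₁ m₂ mE
  ... | Θ₁′ , r , π′ , m₁′ = split p ((mD , mE) ∷ All.++⁺ (connected dr mD (All.++⁻ˡ Γ₁ k)) m₁′) m₂
          (⊢-cut r d₁ (CF⇒⊢ dr) (proj₁ (U-++⁻ ((g , D ⊸ E) ∷ Γ₁ ++ Θ₁′) (U-↭ (↭-sym p) ug)))) d₂
          (≈trans e′ (≈sym (proj₁ (push-nodeˡ pr off) (≈⇒ʳ e′))))
    where
    p : ((g , D ⊸ E) ∷ Γ₁ ++ Θ₁′) ++ Θ₂ ↭ (g , D ⊸ E) ∷ Γ₁ ++ Γ₂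
    p = prep _ (↭-trans (↭-reflexive (++-assoc Γ₁ Θ₁′ Θ₂)) (++⁺ˡ Γ₁ π′))
    off : x ∉ FV b
    off = ⊢-∉ d₂ (λ w → proj₂ (proj₂ (U-++⁻ Θ₁ uΘ)) (∈-resp-↭ (names-↭ (↭-sym r)) (here refl)) w)
  branch false mD mE with take-false π m₁ m₂ mE
  ... | Θ₂′ , r , π′ , m₂′ = split p m₁ ((mD , mE) ∷ All.++⁺ (connected dr mD (All.++⁻ˡ Γ₁ k)) m₂′) d₁
          (⊢-cut r d₂ (CF⇒⊢ dr) (proj₁ (proj₂ (U-++⁻ Θ₁ (U-↭ (↭-sym p) ug)))))
          (≈trans e′ (≈sym (proj₁ (push-nodeʳ pr off) (≈⇒ʳ e′))))
    where
    p : Θ₁ ++ ((g , D ⊸ E) ∷ Γ₁ ++ Θ₂′) ↭ (g , D ⊸ E) ∷ Γ₁ ++ Γ₂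
    p = ↭-trans (shift _ Θ₁ (Γ₁ ++ Θ₂′)) (prep _ (↭-trans (prove 3 (v0 ⊕ (v1 ⊕ v2)) (v1 ⊕ (v0 ⊕ v2)) (Θ₁ ∷ Γ₁ ∷ Θ₂′ ∷ [])) (++⁺ˡ Γ₁ π′)))
    off : x ∉ FV a
    off = ⊢-∉ d₁ (λ w → proj₂ (proj₂ (U-++⁻ Θ₁ uΘ)) w (∈-resp-↭ (names-↭ (↭-sym r)) (here refl)))

atom-↭̸-⊸ : ∀ {x a f A B} {Θ : Ctx} → [ x , tv a ] ↭ (f , A ⊸ B) ∷ Θ → ⊥
atom-↭̸-⊸ π with ↭.↭-singleton-inv (↭-sym π)
... | ()

-- Brings the left rule for `f` to the end of the proof. Every other rule concerns a single colour:
-- for `true` it is moved into the argument `a`, for `false` into the continuation `b`, to which the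
-- conclusion `C` belongs.
split⊸ : ∀ {κ Θ t f A B C Θ′} → CF Θ t C → Θ ↭ (f , A ⊸ B) ∷ Θ′ →
  Mono κ true A → Mono κ false B → Mono κ false C → Coloured κ Θ′ → Split⊸ κ Θ t f A B C Θ′
split⊸ cax π mA mB mC k = ⊥-elim (atom-↭̸-⊸ π)
split⊸ (cperm p d) π mA mB mC k with split⊸ d (↭-trans p π) mA mB mC k
... | split q m₁ m₂ d₁ d₂ e = split q m₁ m₂ d₁ d₂ (≈perm p e)
split⊸ (cconv c d) π mA mB mC k with split⊸ d π mA mB mC k
... | split q m₁ m₂ d₁ d₂ e = split q m₁ m₂ d₁ d₂ (≈trans (c (≈⇒ˡ e)) e)
split⊸ {Θ = Θ} {t} {f} {A} {B} {Θ′ = Θ′} (c⊸R {A = C₁} {C₂} L h) π mA mB (mC₁ , mC₂) k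
  with fresh (f ∷ L ++ FV t)
... | y , y∉ with split⊸ (h y (∉ˡ (y∉ ∘ there))) (↭-trans (prep _ π) (swap _ _ ↭-refl)) mA mB mC₂ ((_ , mC₁) ∷ k)
...   | split {Θ₁} {Θ₂} {a} {b} π′ m₁ m₂ d₁ d₂ e with take-false π′ m₁ m₂ mC₁ | fresh (y ∷ names Θ₂ ++ FV b)
-- `b` contains `y`, which must be abstracted after the argument of type `B`; hence `b′` takes `w`
-- first and `y` second.
...     | Θ₂′ , r , π″ , m₂′ | w , w∉ = split π″ m₁ m₂′ d₁ db
  (≈-ext (∉ʳ L (y∉ ∘ there)) y∉b′F (CF-c⊸ L h) dbF (≈trans e (≈sym (proj₁ expand (≈⇒ʳ e)))))
  where
  F = ` f · a
  b′ = ƛ w ⇒ (ƛ y ⇒ (b · ` w))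
  uΘ : Unique (names (Θ₁ ++ Θ₂))
  uΘ = U-↭ (↭-sym π′) (U-∷ {y} {names Θ′} y∉Θ′ (U-tail (U-↭ π (⊢-Unique (CF-c⊸ L h)))))
    where
    y∉Θ′ : y ∉ names Θ′
    y∉Θ′ z = U-head (⊢-Unique (≈⇒ˡ e)) (∈-resp-↭ (names-↭ (↭-sym π)) (there z))
  y∉F : y ∉ FV F
  y∉F (here refl) = y∉ (here refl)
  y∉F (there z) = ⊢-∉ d₁ (λ v → proj₂ (proj₂ (U-++⁻ Θ₁ uΘ)) v (∈-resp-↭ (names-↭ (↭-sym r)) (here refl))) z
  w∉b : w ∉ FV b
  w∉b = ∉ʳ (names Θ₂) (w∉ ∘ there)
  dbw : ((y , C₁) ∷ (w , B) ∷ Θ₂′) ⊢ b · ` w ∶ C₂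
  dbw = perm p (app d₂ ax (U-↭ (++-comm [ w , B ] Θ₂) (U-∷ (∉ˡ (w∉ ∘ there)) (⊢-Unique d₂))))
    where
    p : Θ₂ ++ [ w , B ] ↭ (y , C₁) ∷ (w , B) ∷ Θ₂′
    p = ↭-trans (++-comm Θ₂ [ w , B ]) (↭-trans (prep _ r) (swap _ _ ↭-refl))
  db : Θ₂′ ⊢ b′ ∶ B ⊸ (C₁ ⊸ C₂)
  db = lam (lam dbw)
  y∉b′F : y ∉ FV (b′ · F)
  y∉b′F = ∉-++ (FV b′) (λ z → proj₂ (∈-remove⁻ (FV (b · ` w)) (proj₁ (∈-remove⁻ (FV (ƛ y ⇒ (b · ` w))) z))) refl) y∉F
  dbF : Θ ⊢ b′ · F ∶ C₁ ⊸ C₂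
  dbF = perm p (⊢-⊸L d₁ db (U-↭ (↭-sym p) (⊢-Unique (CF-c⊸ L h))))
    where
    p : (f , A ⊸ B) ∷ Θ₁ ++ Θ₂′ ↭ Θ
    p = ↭-trans (prep _ π″) (↭-sym π)
  expand : (b′ · F) · ` y ≋ b · F
  expand =
      (b′ · F) · ` y ≋⟨ push-nodeˡ ap (λ { (here e) → w∉ (here e) }) ⟩
      (ƛ w ⇒ ((ƛ y ⇒ (b · ` w)) · ` y)) · F ≋⟨ ≋-app (≋-lam (β-var (⊢-Lin dbw) (proj₂ (⊢-Lin (lam dbw))))) ≋-refl ⟩
      (ƛ w ⇒ (b · ` w)) · F ≋⟨ η·≋ w∉b ⟩
      b · F ∎
split⊸ {f = f} {A} {B} {C = C} {Θ′} (c⊗R {Γ₁} {Γ₂} {t₁} {t₂} e₁ e₂ u) π mA mB (mC₁ , mC₂) k with ↭∷⁻ Γ₁ Γ₂ π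
... | inj₁ (Γ₁′ , q , r) with split⊸ e₁ q mA mB mC₁ (All.++⁻ˡ Γ₁′ (↭.All-resp-↭ (↭-sym r) k))
...   | split {Θ₁} {Θ₂} {a} {b} π′ m₁ m₂ d₁ d₂ e with fresh (names Θ₂ ++ FV b ++ FV t₂ ++ names Γ₂)
...     | w , w∉ = split part m₁ (All.++⁺ m₂ (connected e₂ mC₂ (All.++⁻ʳ Γ₁′ (↭.All-resp-↭ (↭-sym r) k)))) d₁
  (lam (pair (perm (++-comm Θ₂ _) (app d₂ ax (U-↭ (++-comm [ w , B ] Θ₂) (U-∷ (∉ˡ w∉) (⊢-Unique d₂))))) (CF⇒⊢ e₂) uw))
  (≈trans step (≈sym (proj₁ eqn (≈⇒ʳ step))))
  where
  part : Θ₁ ++ (Θ₂ ++ Γ₂) ↭ Θ′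
  part = ↭-trans (↭-reflexive (sym (++-assoc Θ₁ Θ₂ Γ₂))) (↭-trans (++⁺ʳ Γ₂ π′) r)
  u₂ : Unique (names (Θ₂ ++ Γ₂))
  u₂ = proj₁ (proj₂ (U-++⁻ Θ₁ (U-↭ (↭-sym part) (U-tail (U-↭ π u)))))
  uw : Unique (w ∷ names (Θ₂ ++ Γ₂))
  uw = U-∷ (λ z → case (∈-names-++⁻ Θ₂ z)) u₂
    where
    case : w ∈ names Θ₂ ⊎ w ∈ names Γ₂ → ⊥
    case (inj₁ z) = ∉ˡ w∉ z
    case (inj₂ z) = ∉ʳ (FV t₂) (∉ʳ (FV b) (∉ʳ (names Θ₂) w∉)) z
  F = ` f · a
  step = ≈pair e (≈refl (CF⇒⊢ e₂)) u
  eqn : (ƛ w ⇒ ⟨ b · ` w , t₂ ⟩) · F ≋ ⟨ b · F , t₂ ⟩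
  eqn =
      (ƛ w ⇒ ⟨ b · ` w , t₂ ⟩) · F ≋⟨ ≋-sym (push-nodeˡ pr (∉ˡ (∉ʳ (FV b) (∉ʳ (names Θ₂) w∉)))) ⟩
      ⟨ (ƛ w ⇒ (b · ` w)) · F , t₂ ⟩ ≋⟨ ≋-pair (η·≋ (∉ˡ (∉ʳ (names Θ₂) w∉))) ≋-refl ⟩
      ⟨ b · F , t₂ ⟩ ∎
split⊸ {f = f} {A} {B} {C = C} {Θ′} (c⊗R {Γ₁} {Γ₂} {t₁} {t₂} e₁ e₂ u) π mA mB (mC₁ , mC₂) k | inj₂ (Γ₂′ , q , r)
  with split⊸ e₂ q mA mB mC₂ (All.++⁻ʳ Γ₁ (↭.All-resp-↭ (↭-sym r) k))
...   | split {Θ₁} {Θ₂} {a} {b} π′ m₁ m₂ d₁ d₂ e with fresh (names Θ₂ ++ FV b ++ FV t₁ ++ names Γ₁)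
...     | w , w∉ = split part m₁ (All.++⁺ (connected e₁ mC₁ (All.++⁻ˡ Γ₁ (↭.All-resp-↭ (↭-sym r) k))) m₂) d₁
  (lam (perm (shift _ Γ₁ Θ₂) (pair (CF⇒⊢ e₁) (perm (++-comm Θ₂ _) (app d₂ ax (U-↭ (++-comm [ w , B ] Θ₂) (U-∷ (∉ˡ w∉) (⊢-Unique d₂)))))
    (U-↭ (↭-sym (shift (w , B) Γ₁ Θ₂)) uw))))
  (≈trans step (≈sym (proj₁ eqn (≈⇒ʳ step))))
  where
  part : Θ₁ ++ (Γ₁ ++ Θ₂) ↭ Θ′
  part = ↭-trans (prove 3 (v0 ⊕ (v1 ⊕ v2)) (v1 ⊕ (v0 ⊕ v2)) (Θ₁ ∷ Γ₁ ∷ Θ₂ ∷ [])) (↭-trans (++⁺ˡ Γ₁ π′) r)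
  u₂ : Unique (names (Γ₁ ++ Θ₂))
  u₂ = proj₁ (proj₂ (U-++⁻ Θ₁ (U-↭ (↭-sym part) (U-tail (U-↭ π u)))))
  uw : Unique (w ∷ names (Γ₁ ++ Θ₂))
  uw = U-∷ (λ z → case (∈-names-++⁻ Γ₁ z)) u₂
    where
    case : w ∈ names Γ₁ ⊎ w ∈ names Θ₂ → ⊥
    case (inj₁ z) = ∉ʳ (FV t₁) (∉ʳ (FV b) (∉ʳ (names Θ₂) w∉)) z
    case (inj₂ z) = ∉ˡ w∉ z
  F = ` f · a
  step = ≈pair (≈refl (CF⇒⊢ e₁)) e u
  eqn : (ƛ w ⇒ ⟨ t₁ , b · ` w ⟩) · F ≋ ⟨ t₁ , b · F ⟩
  eqn =
      (ƛ w ⇒ ⟨ t₁ , b · ` w ⟩) · F ≋⟨ ≋-sym (push-nodeʳ pr (∉ˡ (∉ʳ (FV b) (∉ʳ (names Θ₂) w∉)))) ⟩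
      ⟨ t₁ , (ƛ w ⇒ (b · ` w)) · F ⟩ ≋⟨ ≋-pair ≋-refl (η·≋ (∉ˡ (∉ʳ (names Θ₂) w∉))) ⟩
      ⟨ t₁ , b · F ⟩ ∎
split⊸ {κ} {f = f} {A} {B} {C} {Θ′} (c⊗L {Γ₀} {t} {z} {D} {E} L h z∉) π mA mB mC k with ∷↭∷⁻ π
... | inj₁ (() , _)
... | inj₂ (Γ₀′ , q₀ , r₀) with ↭.All-resp-↭ (↭-sym r₀) k | fresh₂ (f ∷ L ++ FV t)
...   | (c , mD , mE) ∷ k′ | p , q , p∉ , q∉ , p≢q
  with split⊸ (h p q (∉ˡ (p∉ ∘ there)) (∉ˡ (q∉ ∘ there)) p≢q) π₀ mA mB mC ((c , mD) ∷ (c , mE) ∷ k′)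
  where
  π₀ : (p , D) ∷ (q , E) ∷ Γ₀ ↭ (f , A ⊸ B) ∷ (p , D) ∷ (q , E) ∷ Γ₀′
  π₀ = ↭-trans (prep _ (prep _ q₀)) (↭-trans (prep _ (swap _ _ ↭-refl)) (swap _ _ ↭-refl))
...     | split {Θ₁} {Θ₂} {a} {b} π′ m₁ m₂ d₁ d₂ e = branch c mD mE
  where
  F = ` f · a
  u : Unique (p ∷ q ∷ names Γ₀)
  u = ⊢-Unique (≈⇒ˡ e)
  uΘ : Unique (names (Θ₁ ++ Θ₂))
  uΘ = U-↭ (↭-sym π′) (U-tail (U-↭ π₁ u))
    where
    π₁ : (p , D) ∷ (q , E) ∷ Γ₀ ↭ (f , A ⊸ B) ∷ (p , D) ∷ (q , E) ∷ Γ₀′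
    π₁ = ↭-trans (prep _ (prep _ q₀)) (↭-trans (prep _ (swap _ _ ↭-refl)) (swap _ _ ↭-refl))
  e′ : ((z , D ⊗ E) ∷ Γ₀) ⊢ t · ` z ≈ let⊗ p q (` z) (b · F) ∶ C
  e′ = ≈trans (split-arg p≢q (∉ʳ L (p∉ ∘ there)) (∉ʳ L (q∉ ∘ there)) (≈⇒ˡ l)) l
    where l = ≈let (≈refl (ax {z})) e (U-∷ z∉ (U-tail (U-tail u)))
  z∉′ : z ∉ names Γ₀′
  z∉′ v = z∉ (∈-resp-↭ (names-↭ (↭-sym q₀)) (there v))
  fresh-f : ∀ {v} → v ∈ p ∷ q ∷ [] → v ≢ f
  fresh-f (here refl) refl = p∉ (here refl)
  fresh-f (there (here refl)) refl = q∉ (here refl)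
  weaken : ∀ {v xs} → v ∈ p ∷ q ∷ [] → v ∈ p ∷ q ∷ xs
  weaken (here e) = here e
  weaken (there (here e)) = there (here e)
  branch : ∀ c → Mono κ c D → Mono κ c E → Split⊸ κ _ (t · ` z) f A B C Θ′
  branch true mD mE with take-true π′ m₁ m₂ mD
  ... | Θ₁′ , r₁ , π₁ , m₁′ with take-true π₁ m₁′ m₂ mE
  ...   | Θ₁″ , r₂ , π₂ , m₁″ = split (↭-trans (prep _ π₂) r₀) ((mD , mE) ∷ m₁″) m₂
          (⊢-let r d₁ (λ v → z∉′ (∈-resp-↭ (names-↭ π₂) (∈-names-++ˡ Θ₁″ v)))) d₂
          (≈trans e′ (≈sym (proj₁ eqn (≈⇒ʳ e′))))
    where
    r = ↭-trans r₁ (prep _ r₂)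
    off : ∀ {v} → v ∈ p ∷ q ∷ [] → v ∉ FV b
    off v∈ = ⊢-∉ d₂ (λ w → proj₂ (proj₂ (U-++⁻ Θ₁ uΘ)) (∈-resp-↭ (names-↭ (↭-sym r)) (weaken v∈)) w)
    offf : ∀ {v} → v ∈ p ∷ q ∷ [] → v ∉ FV (` f)
    offf v∈ (here e) = fresh-f v∈ e
    p∈ : p ∈ p ∷ q ∷ []
    p∈ = here refl
    q∈ : q ∈ p ∷ q ∷ []
    q∈ = there (here refl)
    eqn : b · (` f · let⊗ p q (` z) a) ≋ let⊗ p q (` z) (b · F)
    eqn =
        b · (` f · let⊗ p q (` z) a) ≋⟨ ≋-appʳ (commʳ ap (offf p∈) (offf q∈)) ⟩
        b · let⊗ p q (` z) F ≋⟨ commʳ ap (off p∈) (off q∈) ⟩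
        let⊗ p q (` z) (b · F) ∎
  branch false mD mE with take-false π′ m₁ m₂ mD
  ... | Θ₂′ , r₁ , π₁ , m₂′ with take-false π₁ m₁ m₂′ mE
  ...   | Θ₂″ , r₂ , π₂ , m₂″ = split (↭-trans (shift _ Θ₁ Θ₂″) (↭-trans (prep _ π₂) r₀)) m₁ ((mD , mE) ∷ m₂″) d₁
          (⊢-let r d₂ (λ v → z∉′ (∈-resp-↭ (names-↭ π₂) (∈-names-++ʳ Θ₁ v))))
          (≈trans e′ (≈sym (proj₁ (commˡ ap (off (here refl)) (off (there (here refl)))) (≈⇒ʳ e′))))
    where
    r = ↭-trans r₁ (prep _ r₂)
    off : ∀ {v} → v ∈ p ∷ q ∷ [] → v ∉ FV F
    off v∈ (here e) = fresh-f v∈ e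
    off v∈ (there w) = ⊢-∉ d₁ (λ x → proj₂ (proj₂ (U-++⁻ Θ₁ uΘ)) x (∈-resp-↭ (names-↭ (↭-sym r)) (weaken v∈))) w
split⊸ {κ} {f = f} {A} {B} {C} {Θ′} (c⊸L {Γ₁} {Γ₂} {s} {t} {g} {D} {E} dr L h ug) π mA mB mC k with ∷↭∷⁻ π
... | inj₁ (refl , q) = let x , x∉ = fresh L ; k′ = ↭.All-resp-↭ (↭-sym q) k in
  split q (connected dr mA (All.++⁻ˡ Γ₁ k′)) (All.tail (connected (h x x∉) mC ((false , mB) ∷ All.++⁻ʳ Γ₁ k′)))
    (CF⇒⊢ dr) (CF-c⊸ L h) (≈refl (⊢-⊸L (CF⇒⊢ dr) (CF-c⊸ L h) ug))
... | inj₂ (Θ″ , q , r) with ↭.All-resp-↭ (↭-sym r) k | fresh (f ∷ L ++ FV t) | ↭∷⁻ Γ₁ Γ₂ q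
...   | (c , mD , mE) ∷ k′ | x , x∉ | inj₁ (Γ₁′ , q₁ , r₁)
  -- Here `f` is used inside the argument of `g`. The main premise connects `E` to the conclusion,
  -- so `g` has the colour `false` and the induction hypothesis applies with `D` as conclusion.
  with Mono-unique {κ} {false} {c} E (mono-head (connected (h x (∉ˡ (x∉ ∘ there))) mC ((c , mE) ∷ All.++⁻ʳ Γ₁′ (↭.All-resp-↭ (↭-sym r₁) k′)))) mE
...     | refl with split⊸ dr q₁ mA mB mD (All.++⁻ˡ Γ₁′ (↭.All-resp-↭ (↭-sym r₁) k′))
...       | split {Θ₁} {Θ₂} {a} {b} π′ m₁ m₂ d₁ d₂ e
  with fresh (g ∷ names (Θ₂ ++ Γ₂) ++ FV b ++ FV t)
...         | w , w∉ = split part m₁ ((mD , mE) ∷ All.++⁺ m₂ mΓ₂) d₁ db (≈trans step (≈sym (proj₁ eqn (≈⇒ʳ step))))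
  where
  F = ` f · a
  dt : Γ₂ ⊢ t ∶ E ⊸ C
  dt = CF-c⊸ L h
  mΓ₂ : MonoΓ κ false Γ₂
  mΓ₂ = All.tail (connected (h x (∉ˡ (x∉ ∘ there))) mC ((_ , mE) ∷ All.++⁻ʳ Γ₁′ (↭.All-resp-↭ (↭-sym r₁) k′)))
  part : Θ₁ ++ (g , D ⊸ E) ∷ (Θ₂ ++ Γ₂) ↭ Θ′
  part = ↭-trans (shift _ Θ₁ (Θ₂ ++ Γ₂)) (↭-trans (prep _ (↭-trans (↭-reflexive (sym (++-assoc Θ₁ Θ₂ Γ₂))) (↭-trans (++⁺ʳ Γ₂ π′) r₁))) r)
  uΘ : Unique (g ∷ names (Θ₂ ++ Γ₂))
  uΘ = proj₁ (proj₂ (U-++⁻ Θ₁ (U-↭ (↭-sym part) (U-tail (U-↭ π ug)))))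
  p : (g , D ⊸ E) ∷ (Θ₂ ++ [ w , B ]) ++ Γ₂ ↭ (w , B) ∷ (g , D ⊸ E) ∷ (Θ₂ ++ Γ₂)
  p = prove 4 (v0 ⊕ ((v1 ⊕ v2) ⊕ v3)) (v2 ⊕ (v0 ⊕ (v1 ⊕ v3))) ([ g , D ⊸ E ] ∷ Θ₂ ∷ [ w , B ] ∷ Γ₂ ∷ [])
  uw : Unique (names ((g , D ⊸ E) ∷ (Θ₂ ++ [ w , B ]) ++ Γ₂))
  uw = U-↭ (↭-sym p) (U-∷ (∉-∷ (λ e → w∉ (here e)) (∉ˡ (w∉ ∘ there))) uΘ)
  db : ((g , D ⊸ E) ∷ (Θ₂ ++ Γ₂)) ⊢ ƛ w ⇒ (t · (` g · (b · ` w))) ∶ B ⊸ C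
  db = lam (perm p (⊢-⊸L (app d₂ ax (proj₁ (U-++⁻ (Θ₂ ++ [ w , B ]) (U-tail uw)))) dt uw))
  step = ≈-⊸L e (≈refl dt) ug
  w∉b : w ∉ FV b
  w∉b = ∉ˡ (∉ʳ (names (Θ₂ ++ Γ₂)) (w∉ ∘ there))
  w∉t : w ∉ FV t
  w∉t = ∉ʳ (FV b) (∉ʳ (names (Θ₂ ++ Γ₂)) (w∉ ∘ there))
  eqn : (ƛ w ⇒ (t · (` g · (b · ` w)))) · F ≋ t · (` g · (b · F))
  eqn =
      (ƛ w ⇒ (t · (` g · (b · ` w)))) · F ≋⟨ ≋-sym (push-nodeʳ ap w∉t) ⟩
      t · ((ƛ w ⇒ (` g · (b · ` w))) · F) ≋⟨ ≋-appʳ (comp≋ (λ { (here e) → w∉ (here e) }) w∉b) ⟩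
      t · (` g · (b · F)) ∎
split⊸ {κ} {f = f} {A} {B} {C} {Θ′} (c⊸L {Γ₁} {Γ₂} {s} {t} {g} {D} {E} dr L h ug) π mA mB mC k
  | inj₂ (Θ″ , q , r) | (c , mD , mE) ∷ k′ | x , x∉ | inj₂ (Γ₂′ , q₂ , r₂)
  with split⊸ (h x (∉ˡ (x∉ ∘ there))) (↭-trans (prep _ q₂) (swap _ _ ↭-refl)) mA mB mC
         ((c , mE) ∷ All.++⁻ʳ Γ₁ (↭.All-resp-↭ (↭-sym r₂) k′))
...   | split {Θ₁} {Θ₂} {a} {b} π′ m₁ m₂ d₁ d₂ e = branch c mD mE
  where
  F = ` f · a
  G = ` g · s
  mΓ₁ : ∀ {c} → Mono κ c D → MonoΓ κ c Γ₁
  mΓ₁ m = connected dr m (All.++⁻ˡ Γ₁ (↭.All-resp-↭ (↭-sym r₂) k′))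
  ux : Unique (x ∷ names Γ₂)
  ux = ⊢-Unique (≈⇒ˡ e)
  uΘ : Unique (names (Θ₁ ++ Θ₂))
  uΘ = U-↭ (↭-sym π′) (U-tail (U-↭ π₁ ux))
    where
    π₁ : (x , E) ∷ Γ₂ ↭ (f , A ⊸ B) ∷ (x , E) ∷ Γ₂′
    π₁ = ↭-trans (prep _ q₂) (swap _ _ ↭-refl)
  ug′ : Unique (names ((g , D ⊸ E) ∷ Γ₁ ++ Γ₂′))
  ug′ = U-↭ (prep (g , D ⊸ E) (↭-sym r₂)) (U-↭ (↭-sym r) (U-tail (U-↭ π ug)))
  e′ : ((g , D ⊸ E) ∷ Γ₁ ++ Γ₂) ⊢ t · G ≈ (ƛ x ⇒ (b · F)) · G ∶ C
  e′ = ≈trans (proj₂ (η·≋ (∉ʳ L (x∉ ∘ there))) (≈⇒ˡ l)) l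
    where l = ≈-⊸L (≈refl (CF⇒⊢ dr)) (≈lam e) ug
  x≢f : x ∉ FV (` f)
  x≢f (here e) = x∉ (here e)
  branch : ∀ c → Mono κ c D → Mono κ c E → Split⊸ κ _ (t · G) f A B C Θ′
  branch true mD mE with take-true π′ m₁ m₂ mE
  ... | Θ₁′ , q₁ , π₁ , m₁′ = split part ((mD , mE) ∷ All.++⁺ (mΓ₁ mD) m₁′) m₂
        (⊢-cut q₁ d₁ (CF⇒⊢ dr) (proj₁ (U-++⁻ ((g , D ⊸ E) ∷ Γ₁ ++ Θ₁′) (U-↭ (↭-sym p) ug′)))) d₂
        (≈trans e′ (≈sym (proj₁ eqn (≈⇒ʳ e′))))
    where
    p : ((g , D ⊸ E) ∷ Γ₁ ++ Θ₁′) ++ Θ₂ ↭ (g , D ⊸ E) ∷ Γ₁ ++ Γ₂′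
    p = prep _ (↭-trans (↭-reflexive (++-assoc Γ₁ Θ₁′ Θ₂)) (++⁺ˡ Γ₁ π₁))
    part : ((g , D ⊸ E) ∷ Γ₁ ++ Θ₁′) ++ Θ₂ ↭ Θ′
    part = ↭-trans p (↭-trans (prep _ r₂) r)
    off : x ∉ FV b
    off = ⊢-∉ d₂ (λ w → proj₂ (proj₂ (U-++⁻ Θ₁ uΘ)) (∈-resp-↭ (names-↭ (↭-sym q₁)) (here refl)) w)
    eqn : b · (` f · ((ƛ x ⇒ a) · G)) ≋ (ƛ x ⇒ (b · F)) · G
    eqn =
        b · (` f · ((ƛ x ⇒ a) · G)) ≋⟨ ≋-appʳ (push-nodeʳ ap x≢f) ⟩
        b · ((ƛ x ⇒ F) · G) ≋⟨ push-nodeʳ ap off ⟩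
        (ƛ x ⇒ (b · F)) · G ∎
  branch false mD mE with take-false π′ m₁ m₂ mE
  ... | Θ₂′ , q₁ , π₁ , m₂′ = split part m₁ ((mD , mE) ∷ All.++⁺ (mΓ₁ mD) m₂′) d₁
        (⊢-cut q₁ d₂ (CF⇒⊢ dr) (proj₁ (proj₂ (U-++⁻ Θ₁ (U-↭ (↭-sym p) ug′)))))
        (≈trans e′ (≈sym (proj₁ (push-nodeˡ ap off) (≈⇒ʳ e′))))
    where
    p : Θ₁ ++ ((g , D ⊸ E) ∷ Γ₁ ++ Θ₂′) ↭ (g , D ⊸ E) ∷ Γ₁ ++ Γ₂′
    p = ↭-trans (shift _ Θ₁ (Γ₁ ++ Θ₂′)) (prep _ (↭-trans (prove 3 (v0 ⊕ (v1 ⊕ v2)) (v1 ⊕ (v0 ⊕ v2)) (Θ₁ ∷ Γ₁ ∷ Θ₂′ ∷ [])) (++⁺ˡ Γ₁ π₁)))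
    part : Θ₁ ++ ((g , D ⊸ E) ∷ Γ₁ ++ Θ₂′) ↭ Θ′
    part = ↭-trans p (↭-trans (prep _ r₂) r)
    off : x ∉ FV F
    off (here e) = x∉ (here e)
    off (there w) = ⊢-∉ d₁ (λ v → proj₂ (proj₂ (U-++⁻ Θ₁ uΘ)) v (∈-resp-↭ (names-↭ (↭-sym q₁)) (here refl))) w

-- Coherence

pos? : ℕ → Bool
pos? zero    = false
pos? (suc _) = true

pos?-≥ : ∀ {n} → 1 ≤ n → pos? n ≡ true
pos?-≥ (s≤s _) = refl

Mono-intro : ∀ {κ c} A → (∀ n b → 1 ≤ occ b n A → κ n ≡ c) → Mono κ c A
Mono-intro (tv a) h = h a true (ℕ.≤-reflexive (sym (δ-≡ a)))
Mono-intro (A ⊗ B) h = Mono-intro A (λ n b p → h n b (ℕ.≤-trans p (ℕ.m≤m+n _ _))) ,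
                       Mono-intro B (λ n b p → h n b (ℕ.≤-trans p (ℕ.m≤n+m _ (occ b n A))))
Mono-intro (A ⊸ B) h = Mono-intro A (λ n b p → h n (not b) (ℕ.≤-trans p (ℕ.≤-trans (ℕ.≤-reflexive (cong (λ c → occ c n A) (sym (not² b)))) (ℕ.m≤m+n _ _)))) ,
                       Mono-intro B (λ n b p → h n b (ℕ.≤-trans p (ℕ.m≤n+m _ (occ (not b) n A))))

Mono-Γ : ∀ {κ c} Γ → (∀ n b → 1 ≤ occΓ b n Γ → κ n ≡ c) → MonoΓ κ c Γ
Mono-Γ [] h = []
Mono-Γ ((_ , A) ∷ Γ) h = Mono-intro A (λ n b p → h n b (ℕ.≤-trans p (ℕ.m≤m+n _ _))) ∷
  Mono-Γ Γ (λ n b p → h n b (ℕ.≤-trans p (ℕ.m≤n+m _ (occ b n A))))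

-- By balance an input variable also occurs as an output, so a condition on the outputs controls the
-- colour of the whole sequent.
Mono-sequent : ∀ {κ c Γ t C} → CF Γ t C → (∀ n → 1 ≤ occS true n Γ C → κ n ≡ c) → Mono κ c C × MonoΓ κ c Γ
Mono-sequent {κ} {c} {Γ} {t} {C} d h =
  Mono-intro C (λ n b p → any b n (ℕ.≤-trans p (ℕ.m≤n+m _ (occΓ (not b) n Γ)))) ,
  Mono-Γ Γ (λ n b p → any (not b) n (ℕ.≤-trans p (ℕ.≤-trans (ℕ.≤-reflexive (cong (λ c → occΓ c n Γ) (sym (not² b)))) (ℕ.m≤m+n _ _))))
  where
  any : ∀ b n → 1 ≤ occS b n Γ C → κ n ≡ c
  any true n p = h n p
  any false n p = h n (ℕ.≤-trans p (ℕ.≤-reflexive (sym (balanced d n))))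

mono⇒coloured : ∀ {κ c Γ} → MonoΓ κ c Γ → Coloured κ Γ
mono⇒coloured = All.map (λ m → _ , m)

≤1-exclusive : ∀ {m n} → m + n ≤ 1 → 1 ≤ n → pos? m ≡ false
≤1-exclusive {zero} _ _ = refl
≤1-exclusive {suc m} {suc n} (s≤s p) _ with ℕ.≤-trans (ℕ.m≤n+m (suc n) m) p
... | ()

-- A variable is coloured by whether it has an output in the first premise. By the bound `h` it then
-- has none in the second, so the two premises are monochrome in different colours.
module Bicolour {Γ Δ : Ctx} {s t : Tm} {A B : Ty} (d : CF Γ s A) (e : CF Δ t B)
  (h : ∀ n → occS true n Γ A + occS true n Δ B ≤ 1) where

  κ : ℕ → Bool
  κ n = pos? (occS true n Γ A)
  first : Mono κ true A × MonoΓ κ true Γ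
  first = Mono-sequent d (λ n p → pos?-≥ p)
  second : Mono κ false B × MonoΓ κ false Δ
  second = Mono-sequent e (λ n p → ≤1-exclusive (h n) p)
  h₁ : ∀ n → occS true n Γ A ≤ 1
  h₁ n = ℕ.≤-trans (ℕ.m≤m+n _ _) (h n)
  h₂ : ∀ n → occS true n Δ B ≤ 1
  h₂ n = ℕ.≤-trans (ℕ.m≤n+m _ (occS true n Γ A)) (h n)

-- With one atomic hypothesis and an atomic conclusion no logical rule applies; only the axiom is
-- left, up to exchange and conversion.
atomic-unique : ∀ {Γ t C x a} → CF Γ t C → Γ ↭ [ x , tv a ] → C ≡ tv a → Γ ⊢ t ≈ ` x ∶ C
atomic-unique cax p e with ↭.↭-singleton-inv p
... | refl = ≈refl ax
atomic-unique (cperm q d) p e = ≈perm q (atomic-unique d (↭-trans q p) e)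
atomic-unique (cconv c d) p e = ≈trans (c (CF⇒⊢ d)) (atomic-unique d p e)
atomic-unique (c⊸R _ _) p ()
atomic-unique (c⊗R _ _ _) p ()
atomic-unique (c⊗L _ _ _) p e with ↭.↭-singleton-inv p
... | ()
atomic-unique (c⊸L _ _ _ _) p e with ↭.↭-singleton-inv p
... | ()

≤1-≡ : ∀ {m n} → m ≡ n → m ≤ 1 → n ≤ 1
≤1-≡ refl p = p

-- Induction on the proof of `t`; of `t′` only the typing is known. The invertible rules `c⊸R` and
-- `c⊗L` are handled by extensionality. For `c⊗R` and `c⊸L` the premises share no type variable, so
-- `t′` splits along the colours into parts living in the same contexts as those of `t`.
coherence : ∀ {Γ t t′ C} → CF Γ t C → Γ ⊢ t′ ∶ C → (∀ n → occS true n Γ C ≤ 1) → Γ ⊢ t ≈ t′ ∶ C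
coherence cax d′ k = ≈sym (atomic-unique (fundamental d′) ↭-refl refl)
coherence (cperm {C = C} p d) d′ k =
  ≈perm p (coherence d (perm (↭-sym p) d′) (λ n → ≤1-≡ (occS-↭ true n C (↭-sym p)) (k n)))
coherence (cconv c d) d′ k = ≈trans (c (CF⇒⊢ d)) (coherence d d′ k)
coherence {Γ} {t} {t′} (c⊸R {A = A} {B} L h) d′ k with fresh (L ++ FV t ++ FV t′ ++ names Γ)
... | y , y∉ = ≈-ext (∉ˡ (∉ʳ L y∉)) (∉ˡ (∉ʳ (FV t) (∉ʳ L y∉))) (CF-c⊸ L h) d′
  (coherence (h y (∉ˡ y∉)) (perm (++-comm Γ _) (app d′ ax (U-↭ (++-comm [ y , A ] Γ)
      (U-∷ (∉ʳ (FV t′) (∉ʳ (FV t) (∉ʳ L y∉))) (⊢-Unique d′)))))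
    (λ n → ≤1-≡ (occS-⊸R true n {y} Γ A B) (k n)))
coherence (c⊗R {Γ} {Δ} {A = A} {B} d e u) d′ k = go (split⊗ (fundamental d′) (proj₁ first) (proj₁ second)
    (All.++⁺ (mono⇒coloured (proj₂ first)) (mono⇒coloured (proj₂ second))))
  where
  open Bicolour d e (λ n → ≤1-≡ (occS-⊗R true n Γ Δ A B) (k n))
  go : Split⊗ κ (Γ ++ Δ) _ A B → (Γ ++ Δ) ⊢ _ ≈ _ ∶ A ⊗ B
  go (split π m₁ m₂ d₁ d₂ eq) with partition-unique Γ π m₁ m₂ (proj₂ first) (proj₂ second)
  ... | p , q = ≈trans (≈pair (coherence d (perm p d₁) h₁) (coherence e (perm q d₂) h₂) u) (≈sym eq)
coherence {t′ = t′} (c⊗L {Γ} {t} {z} {A} {B} {C} L h z∉) d′ k with fresh₂ (L ++ FV t ++ FV t′ ++ names Γ)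
... | a , b , a∉ , b∉ , a≢b = ≈trans
  (≈-ext⊗ a≢b (∉ˡ (∉ʳ L a∉)) (∉ˡ (∉ʳ L b∉)) (off a∉) (off b∉) z∉
    (coherence (h a b (∉ˡ a∉) (∉ˡ b∉) a≢b) typ (λ n → ≤1-≡ (occS-⊗L true n {z} {a} {b} Γ A B C) (k n))))
  (proj₁ (β-var (⊢-Lin d′) (proj₂ (⊢-Lin (lam d′)))) d′)
  where
  -- `t′` need not be an application to `z`, so it is β-expanded to one before the two terms are
  -- compared.
  t″ = ƛ z ⇒ t′
  off : ∀ {v} → v ∉ L ++ FV t ++ FV t′ ++ names Γ → v ∉ FV t″
  off v∉ p = ∉ˡ (∉ʳ (FV t) (∉ʳ L v∉)) (proj₁ (∈-remove⁻ (FV t′) p))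
  offΓ : ∀ {v} → v ∉ L ++ FV t ++ FV t′ ++ names Γ → v ∉ names Γ
  offΓ v∉ = ∉ʳ (FV t′) (∉ʳ (FV t) (∉ʳ L v∉))
  π : Γ ++ ((a , A) ∷ (b , B) ∷ []) ↭ (a , A) ∷ (b , B) ∷ Γ
  π = ++-comm Γ _
  typ : ((a , A) ∷ (b , B) ∷ Γ) ⊢ t″ · ⟨ ` a , ` b ⟩ ∶ C
  typ = perm π (app (lam d′) (pair ax ax ((a≢b ∷ []) ∷ [] ∷ []))
    (U-↭ (↭-sym π) (U-∷ (∉-∷ a≢b (offΓ a∉)) (U-∷ (offΓ b∉) (U-tail (⊢-Unique d′))))))
coherence {t′ = t′} (c⊸L {Γ} {Δ} {s} {t} {f} {A} {B} {C} d L h u) d′ k with fresh (L ++ FV t)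
... | x , x∉ = go (split⊸ (fundamental d′) ↭-refl (proj₁ first) mB (proj₁ second)
    (All.++⁺ (mono⇒coloured (proj₂ first)) (mono⇒coloured mΔ)))
  where
  open Bicolour d (h x (∉ˡ x∉)) (λ n → ≤1-≡ (occS-⊸L true n {f} {x} Γ Δ A B C) (k n))
  mB : Mono κ false B
  mB = mono-head {κ} {false} {x} (proj₂ second)
  mΔ : MonoΓ κ false Δ
  mΔ = mono-tail {κ} {false} {x} (proj₂ second)
  go : Split⊸ κ ((f , A ⊸ B) ∷ Γ ++ Δ) t′ f A B C (Γ ++ Δ) → ((f , A ⊸ B) ∷ Γ ++ Δ) ⊢ t · (` f · s) ≈ t′ ∶ C
  go (split {a = a} {b} π m₁ m₂ d₁ d₂ eq) with partition-unique Γ π m₁ m₂ (proj₂ first) mΔ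
  ... | p , q = ≈trans (≈-⊸L (coherence d (perm p d₁) h₁) t≈b u) (≈sym eq)
    where
    ux : Unique (x ∷ names Δ)
    ux = CF-Unique (h x (∉ˡ x∉))
    x∉b : x ∉ FV b
    x∉b = ⊢-∉ (perm q d₂) (U-head ux)
    t≈b : Δ ⊢ t ≈ b ∶ B ⊸ C
    t≈b = ≈-ext (∉ʳ L x∉) x∉b (CF-c⊸ L h) (perm q d₂)
      (coherence (h x (∉ˡ x∉)) (perm (++-comm Δ _) (app (perm q d₂) ax (U-↭ (++-comm [ x , B ] Δ) ux))) h₂)

-- Evaluation of closed terms

Closed : Tm → Set
Closed t = Lin t × (∀ {z} → z ∉ FV t)

-- With closed images naive substitution cannot capture, so closed programs can be evaluated without
-- any freshening.
ClosedS : Subst → Set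
ClosedS σ = ∀ z → Closed (look σ z) ⊎ look σ z ≡ ` z

closed-[] : ClosedS []
closed-[] z = inj₂ refl

closed-∷ : ∀ {x v σ} → Closed v → ClosedS σ → ClosedS ((x , v) ∷ σ)
closed-∷ {x} c h z with z ≟ x
... | yes _ = inj₁ c
... | no _ = h z

closed-drop : ∀ x σ → ClosedS σ → ClosedS (dropS x σ)
closed-drop x σ h z with z ≟ x
... | yes refl = inj₂ (look-drop-≡ x σ)
... | no n rewrite look-drop-≢ σ n = h z

closed-NC : ∀ {σ} t → ClosedS σ → NC σ t
closed-NC {σ} t h {y} {z} _ n p with h z
... | inj₁ c = proj₂ c p
... | inj₂ e = n (sym (∈-[-] (≡.subst (λ u → y ∈ FV u) e p)))

closed-LinS : ∀ {σ} t → ClosedS σ → LinS σ t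
closed-LinS {σ} t h = (λ {z} _ → lin z) , λ {z} {z′} _ _ → dj z z′
  where
  lin : ∀ z → Lin (look σ z)
  lin z with h z
  ... | inj₁ c = proj₁ c
  ... | inj₂ e = ≡.subst Lin (sym e) tt
  dj : ∀ z z′ → z ≢ z′ → Disj (FVσ σ z) (FVσ σ z′)
  dj z z′ n {v} p q with h z | h z′
  ... | inj₁ c | _ = proj₂ c p
  ... | inj₂ _ | inj₁ c = proj₂ c q
  ... | inj₂ e | inj₂ e′ = n (trans (sym (∈-[-] (≡.subst (λ u → v ∈ FV u) e p))) (∈-[-] (≡.subst (λ u → v ∈ FV u) e′ q)))

closed-Lin : ∀ {σ} t → ClosedS σ → Lin t → Lin (subst σ t)
closed-Lin {σ} t h l = Lin-subst t {σ} l (closed-NC {σ} t h) (closed-LinS {σ} t h)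

subst-closed : ∀ {σ} t → Closed t → subst σ t ≡ t
subst-closed t c = subst-id t (λ p → ⊥-elim (proj₂ c p))

subst-∘ : ∀ t {σ τ υ} → ClosedS σ → (∀ z → subst τ (look σ z) ≡ look υ z) → subst τ (subst σ t) ≡ subst υ t
subst-∘-drop : ∀ y {σ τ υ} → ClosedS σ → (∀ z → subst τ (look σ z) ≡ look υ z) →
  ∀ z → subst (dropS y τ) (look (dropS y σ) z) ≡ look (dropS y υ) z
subst-∘-drop y {σ} {τ} {υ} h e z with z ≟ y
... | yes refl rewrite look-drop-≡ y σ = trans (look-drop-≡ y τ) (sym (look-drop-≡ y υ))
... | no n rewrite look-drop-≢ σ n | look-drop-≢ υ n with h z
...   | inj₁ c = trans (trans (subst-closed {dropS y τ} _ c) (sym (subst-closed {τ} _ c))) (e z)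
...   | inj₂ q = trans (cong (subst (dropS y τ)) q) (trans (look-drop-≢ τ n) (trans (sym (cong (subst τ) q)) (e z)))
subst-∘ (` x) h e = e x
subst-∘ (t · s) {σ} {τ} {υ} h e = cong₂ _·_ (subst-∘ t {σ} {τ} {υ} h e) (subst-∘ s {σ} {τ} {υ} h e)
subst-∘ (ƛ x ⇒ t) {σ} {τ} {υ} h e = cong (ƛ x ⇒_) (subst-∘ t {dropS x σ} {dropS x τ} {dropS x υ} (closed-drop x σ h) (subst-∘-drop x {σ} {τ} {υ} h e))
subst-∘ ⟨ t , s ⟩ {σ} {τ} {υ} h e = cong₂ ⟨_,_⟩ (subst-∘ t {σ} {τ} {υ} h e) (subst-∘ s {σ} {τ} {υ} h e)
subst-∘ (let⊗ x y s t) {σ} {τ} {υ} h e = cong₂ (let⊗ x y) (subst-∘ s {σ} {τ} {υ} h e)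
  (subst-∘ t {dropS x (dropS y σ)} {dropS x (dropS y τ)} {dropS x (dropS y υ)} (closed-drop x (dropS y σ) (closed-drop y σ h))
    (subst-∘-drop x {dropS y σ} {dropS y τ} {dropS y υ} (closed-drop y σ h) (subst-∘-drop y {σ} {τ} {υ} h e)))

eval-λ : ∀ {x v} σ t → ClosedS σ → Lin (ƛ x ⇒ t) → Closed v → subst σ (ƛ x ⇒ t) · v ≋ subst ((x , v) ∷ σ) t
eval-λ {x} {v} σ t h l c = ≡.subst (λ r → subst σ (ƛ x ⇒ t) · v ≋ r) eq
  (β≋ {x} {t′} {v} (closed-Lin {σ} (ƛ x ⇒ t) h l , proj₁ c , (λ _ q → proj₂ c q)) (noCapture {t′} {v} (λ _ → proj₂ c)))
  where
  t′ = subst (dropS x σ) t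
  eq : subst [ x ↦ v ] t′ ≡ subst ((x , v) ∷ σ) t
  eq = subst-∘ t {dropS x σ} {[ x ↦ v ]} {(x , v) ∷ σ} (closed-drop x σ h) lk
    where
    lk : ∀ z → subst [ x ↦ v ] (look (dropS x σ) z) ≡ look ((x , v) ∷ σ) z
    lk z = step (z ≟ x)
      where
      step : Dec (z ≡ x) → subst [ x ↦ v ] (look (dropS x σ) z) ≡ look ((x , v) ∷ σ) z
      step (yes refl) = trans (cong (subst [ x ↦ v ]) (look-drop-≡ x σ)) (trans (look-≡ x v []) (sym (look-≡ x v σ)))
      step (no n) = trans (cong (subst [ x ↦ v ]) (look-drop-≢ σ n)) (trans (rest (h z)) (sym (look-≢ n)))
        where
        rest : Closed (look σ z) ⊎ look σ z ≡ ` z → subst [ x ↦ v ] (look σ z) ≡ look σ z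
        rest (inj₁ k) = subst-closed {[ x ↦ v ]} _ k
        rest (inj₂ e) = trans (cong (subst [ x ↦ v ]) e) (trans (look-≢ {u = v} {[]} n) (sym e))

eval-let : ∀ {x y a b} σ s t → ClosedS σ → Lin (let⊗ x y s t) → Closed a → Closed b → subst σ s ⊒ ⟨ a , b ⟩ →
  subst σ (let⊗ x y s t) ⊒ subst ((y , b) ∷ (x , a) ∷ σ) t
eval-let {x} {y} {a} {b} σ s t h (_ , lt , x≢y , x∈ , y∈ , _) ca cb e =

      subst σ (let⊗ x y s t) ⊒⟨ ⊒-let e ⊒-refl ⟩
      let⊗ x y ⟨ a , b ⟩ t′ ⊒⟨ proj₁ (βlet≋) ⟩
      (ƛ x ⇒ (ƛ y ⇒ t′)) · a · b ⊒⟨ ⊒-reflexive (cong (λ u → (ƛ x ⇒ (ƛ y ⇒ u)) · a · b) eq) ⟩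
      subst σ F · a · b ⊒⟨ ⊒-appˡ (proj₁ (eval-λ σ (ƛ y ⇒ t) h ((lt , y∈) , ∈-remove⁺ x∈ x≢y) ca)) ⟩
      subst ((x , a) ∷ σ) (ƛ y ⇒ t) · b ⊒⟨ proj₁ (eval-λ ((x , a) ∷ σ) t (closed-∷ {x} {a} {σ} ca h) (lt , y∈) cb) ⟩
      r ∎⊒
  where
  F = ƛ x ⇒ (ƛ y ⇒ t)
  t′ = subst (dropS x (dropS y σ)) t
  r = subst ((y , b) ∷ (x , a) ∷ σ) t
  eq : t′ ≡ subst (dropS y (dropS x σ)) t
  eq = subst-ext t λ {z} _ → lk z
    where
    lk : ∀ z → look (dropS x (dropS y σ)) z ≡ look (dropS y (dropS x σ)) z
    lk z with z ≟ x | z ≟ y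
    ... | yes refl | yes refl = refl
    ... | yes refl | no n = trans (look-drop-≡ x (dropS y σ)) (sym (trans (look-drop-≢ (dropS x σ) n) (look-drop-≡ x σ)))
    ... | no n | yes refl = trans (trans (look-drop-≢ (dropS y σ) n) (look-drop-≡ y σ)) (sym (look-drop-≡ y (dropS x σ)))
    ... | no n | no m = trans (trans (look-drop-≢ (dropS y σ) n) (look-drop-≢ σ m))
                              (sym (trans (look-drop-≢ (dropS x σ) m) (look-drop-≢ σ n)))

closed-subst : ∀ {σ} t → ClosedS σ → Lin t → (∀ {z} → z ∈ FV t → Closed (look σ z)) → Closed (subst σ t)
closed-subst {σ} t h l k = closed-Lin {σ} t h l , λ p → let z , z∈ , q = FV-subst⁻ t {σ} p in proj₂ (k z∈) q

closed-· : ∀ {t s} → Closed t → Closed s → Closed (t · s)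
closed-· {t} {s} (l , n) (m , k) = (l , m , λ p → ⊥-elim (n p)) , λ p → case (∈-++⁻ (FV t) p)
  where
  case : ∀ {z} → z ∈ FV t ⊎ z ∈ FV s → ⊥
  case (inj₁ p) = n p
  case (inj₂ p) = k p

closed-⟨⟩ : ∀ {t s} → Closed t → Closed s → Closed ⟨ t , s ⟩
closed-⟨⟩ {t} {s} c d = closed-· {t} {s} c d

⊢⇒Closed : ∀ {t A} → [] ⊢ t ∶ A → Closed t
⊢⇒Closed d = ⊢-Lin d , ⊢-∉ d (λ ())

-- Realizability with weights in ℤ/2

-- A closed term acts on closed pairs as
-- the identity (weight false) or as the exchange (weight true). A realizer of
-- an atom a carries a term acting by the prescribed bit of a together with a
-- payload; linearity makes the weights in ℤ/2 of the payloads add up.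

Act : Bool → Tm → Set
Act w h = Closed h × (∀ {a b} → Closed a → Closed b → h · ⟨ a , b ⟩ ⊒ (if w then ⟨ b , a ⟩ else ⟨ a , b ⟩))

module Realizability (bit : ℕ → Bool) where

  R : Ty → Bool → Tm → Set
  R (tv a)  w v = Closed v × ∃[ c ] ∃[ h ] (v ⊒ ⟨ c , h ⟩ × Act (bit a) c × Act w h)
  R (A ⊗ B) w v = Closed v × ∃[ v₁ ] ∃[ v₂ ] ∃[ w₁ ] ∃[ w₂ ]
                  (v ⊒ ⟨ v₁ , v₂ ⟩ × R A w₁ v₁ × R B w₂ v₂ × w ≡ w₁ xor w₂)
  R (A ⊸ B) w v = Closed v × (∀ {w′ x} → R A w′ x → R B (w xor w′) (v · x))

  R-closed : ∀ A {w v} → R A w v → Closed v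
  R-closed (tv a) = proj₁
  R-closed (A ⊗ B) = proj₁
  R-closed (A ⊸ B) = proj₁

  -- Closure under expansion: to show that a program is a realizer it suffices to look at what it
  -- evaluates to.
  R-⊒ : ∀ A {w v v′} → Closed v → v ⊒ v′ → R A w v′ → R A w v
  R-⊒ (tv a) {v = v} {v′} k e (_ , c , h , e′ , r) = k , c , h , (v ⊒⟨ e ⟩
      v′ ⊒⟨ e′ ⟩
      ⟨ c , h ⟩ ∎⊒) , r
  R-⊒ (A ⊗ B) {v = v} {v′} k e (_ , a , b , w₁ , w₂ , e′ , r) = k , a , b , w₁ , w₂ , (v ⊒⟨ e ⟩
      v′ ⊒⟨ e′ ⟩
      ⟨ a , b ⟩ ∎⊒) , r
  R-⊒ (A ⊸ B) {v = v} {v′} k e (_ , f) = k , λ {w′} {x} r →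
    R-⊒ B (closed-· {v} {x} k (R-closed A r)) (⊒-appˡ e) (f r)

  R-≡ : ∀ {A w w′ v} → w ≡ w′ → R A w v → R A w′ v
  R-≡ refl r = r

  weight : (ℕ → Bool) → Ctx → Bool
  weight w [] = false
  weight w ((x , _) ∷ Γ) = w x xor weight w Γ

  weight-++ : ∀ w Γ {Δ} → weight w (Γ ++ Δ) ≡ weight w Γ xor weight w Δ
  weight-++ w [] = refl
  weight-++ w ((x , _) ∷ Γ) {Δ} = trans (cong (w x xor_) (weight-++ w Γ)) (sym (Bool.xor-assoc (w x) (weight w Γ) (weight w Δ)))

  weight-↭ : ∀ w {Γ Δ} → Γ ↭ Δ → weight w Γ ≡ weight w Δ
  weight-↭ w _↭_.refl = refl
  weight-↭ w (prep (x , _) p) = cong (w x xor_) (weight-↭ w p)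
  weight-↭ w {_ ∷ _ ∷ Γ} {_ ∷ _ ∷ Δ} (swap (x , _) (y , _) p) = trans (sym (Bool.xor-assoc (w x) (w y) (weight w Γ)))
    (trans (cong₂ _xor_ (Bool.xor-comm (w x) (w y)) (weight-↭ w p)) (Bool.xor-assoc (w y) (w x) (weight w Δ)))
  weight-↭ w (_↭_.trans p q) = trans (weight-↭ w p) (weight-↭ w q)

  setw : (ℕ → Bool) → ℕ → Bool → ℕ → Bool
  setw w x b z with z ≟ x
  ... | yes _ = b
  ... | no _  = w z

  setw-≡ : ∀ w x b → setw w x b x ≡ b
  setw-≡ w x b with x ≟ x
  ... | yes _ = refl
  ... | no n = ⊥-elim (n refl)

  setw-≢ : ∀ {w x b z} → z ≢ x → setw w x b z ≡ w z
  setw-≢ {x = x} {z = z} n with z ≟ x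
  ... | yes e = ⊥-elim (n e)
  ... | no _ = refl

  weight-setw : ∀ {w x b} Γ → x ∉ names Γ → weight (setw w x b) Γ ≡ weight w Γ
  weight-setw [] n = refl
  weight-setw {w} {x} {b} ((y , _) ∷ Γ) n =
    cong₂ _xor_ (setw-≢ {w} {x} {b} (λ e → n (here (sym e)))) (weight-setw {w} {x} {b} Γ (n ∘ there))

  Env : Ctx → (ℕ → Bool) → Subst → Set
  Env Γ w σ = ∀ {x A} → (x , A) ∈ Γ → R A (w x) (look σ x)

  Env-∷ : ∀ {Γ w σ x A b v} → x ∉ names Γ → Env Γ w σ → R A b v → Env ((x , A) ∷ Γ) (setw w x b) ((x , v) ∷ σ)
  Env-∷ {Γ} {w} {σ} {x} {A} {b} {v} n h r (here refl) =
    R-≡ {A} (sym (setw-≡ w x b)) (≡.subst (R A b) (sym (look-≡ x v σ)) r)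
  Env-∷ {Γ} {w} {σ} {x} {A} {b} {v} n h r {y} {B} (there p) =
    R-≡ {B} (sym (setw-≢ {w} {x} {b} y≢x)) (≡.subst (R B (w y)) (sym (look-≢ {u = v} {σ} y≢x)) (h p))
    where
    y≢x : y ≢ x
    y≢x refl = n (∈-names p)

  Env-closed : ∀ {Γ w σ t A} → Γ ⊢ t ∶ A → ClosedS σ → Env Γ w σ → Closed (subst σ t)
  Env-closed {Γ} {w} {σ} {t} d c h = closed-subst {σ} t c (⊢-Lin d) λ {z} z∈ →
    let (x , A) , p , e = ∈-map⁻ proj₁ (∈-resp-↭ (proj₂ (names-FV d)) z∈) in
    ≡.subst (λ z → Closed (look σ z)) (sym e) (R-closed A (h p))

  -- A linear term uses each hypothesis exactly once and creates no payload of its own, so the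
  -- weight of its value is the sum of the weights supplied. For a closed term the sum is empty,
  -- which gives weight `false`.
  adequacy : ∀ {Γ t A w} σ → Γ ⊢ t ∶ A → ClosedS σ → Env Γ w σ → R A (weight w Γ) (subst σ t)
  adequacy {A = A} {w} σ (ax {x}) c h = R-≡ {A} (sym (Bool.xor-identityʳ (w x))) (h (here refl))
  adequacy {A = A} {w} σ (exch Γ Δ d) c h = R-≡ {A} (weight-↭ w (swap-mid Γ)) (adequacy σ d c (h ∘ ∈-resp-↭ (swap-mid Γ)))
  adequacy {w = w} σ (lam {x} {A} {Γ} {t} {B} d) c h = Env-closed {w = w} {σ} (lam d) c h , λ {w′} {v} r →
    R-⊒ B (closed-· {subst σ (ƛ x ⇒ t)} {v} (Env-closed {w = w} {σ} (lam d) c h) (R-closed A r))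
      (proj₁ (eval-λ σ t c (⊢-Lin (lam d)) (R-closed A r)))
      (R-≡ {B} (trans (cong₂ _xor_ (setw-≡ w x w′) (weight-setw {w} {x} {w′} Γ x∉)) (Bool.xor-comm w′ (weight w Γ)))
        (adequacy {w = setw w x w′} ((x , v) ∷ σ) d (closed-∷ {x} {v} {σ} (R-closed A r) c) (Env-∷ {Γ} {w} {σ} {x} {A} {w′} {v} x∉ h r)))
    where
    x∉ : x ∉ names Γ
    x∉ = U-head (⊢-Unique d)
  adequacy {w = w} σ (app {Γ} {Δ} {A = A} {B} d e u) c h =
    R-≡ {B} (sym (weight-++ w Γ)) (proj₂ (adequacy σ d c (h ∘ ∈-++⁺ˡ)) (adequacy σ e c (h ∘ ∈-++⁺ʳ Γ)))
  adequacy {w = w} σ (pair {Γ} {Δ} {s} {t} {A} {B} d e u) c h =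
    Env-closed {w = w} {σ} (pair d e u) c h , _ , _ , _ , _ , ⊒-refl ,
    adequacy σ d c (h ∘ ∈-++⁺ˡ) , adequacy σ e c (h ∘ ∈-++⁺ʳ Γ) , weight-++ w Γ
  adequacy {w = w} σ (letp {Γ} {Δ} {x} {y} {s} {t} {A} {B} {C} d e u) c h with adequacy σ d c (h ∘ ∈-++⁺ˡ)
  ... | _ , v₁ , v₂ , w₁ , w₂ , e′ , r₁ , r₂ , q =
    R-⊒ C (Env-closed {w = w} {σ} (letp d e u) c h)
      (eval-let σ s t c (⊢-Lin (letp d e u)) (R-closed A r₁) (R-closed B r₂) e′)
      (R-≡ {C} eq (adequacy {w = wy} ((y , v₂) ∷ (x , v₁) ∷ σ) (perm (swap _ _ ↭-refl) e)
        (closed-∷ {y} {v₂} {(x , v₁) ∷ σ} (R-closed B r₂) (closed-∷ {x} {v₁} {σ} (R-closed A r₁) c))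
        (Env-∷ {(x , A) ∷ Δ} {wx} {(x , v₁) ∷ σ} {y} {B} {w₂} {v₂} y∉
          (Env-∷ {Δ} {w} {σ} {x} {A} {w₁} {v₁} x∉ (h ∘ ∈-++⁺ʳ Γ) r₁) r₂)))
    where
    wx = setw w x w₁
    wy = setw wx y w₂
    x∉ : x ∉ names Δ
    x∉ = U-head (⊢-Unique e) ∘ there
    y∉ : y ∉ x ∷ names Δ
    y∉ = U-head (U-↭ (swap (x , A) (y , B) (↭-refl {x = Δ})) (⊢-Unique e))
    eq : wy y xor (wy x xor weight wy Δ) ≡ weight w (Γ ++ Δ)
    eq = trans (cong₂ _xor_ (setw-≡ wx y w₂)
        (cong₂ _xor_ (trans (setw-≢ {wx} {y} {w₂} (λ e → y∉ (here (sym e)))) (setw-≡ w x w₁))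
          (trans (weight-setw {wx} {y} {w₂} Δ (y∉ ∘ there)) (weight-setw {w} {x} {w₁} Δ x∉))))
      (trans (sym (Bool.xor-assoc w₂ w₁ (weight w Δ)))
        (trans (cong (_xor weight w Δ) (trans (Bool.xor-comm w₂ w₁) (sym q))) (sym (weight-++ w Γ))))

  adequacy-closed : ∀ {t A} → [] ⊢ t ∶ A → R A false t
  adequacy-closed {t} {A} d = ≡.subst (R A false) (subst-[] t) (adequacy {w = λ _ → false} [] d closed-[] λ ())

-- Concrete actions and tests

disj? : ∀ xs ys → Dec (Disj xs ys)
disj? [] ys = yes λ ()
disj? (x ∷ xs) ys with x ∈? ys | disj? xs ys
... | yes p | _ = no λ d → d (here refl) p
... | no _ | no n = no λ d → n (d ∘ there)
... | no n | yes d = yes λ { (here refl) → n ; (there p) → d p }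

-- Decidability lets the linearity of each concrete test term be checked by evaluation, through
-- `lin`.
lin? : ∀ t → Dec (Lin t)
lin? (` x) = yes tt
lin? (t · s) = lin? t ×-dec (lin? s ×-dec disj? (FV t) (FV s))
lin? (ƛ x ⇒ t) = lin? t ×-dec (x ∈? FV t)
lin? ⟨ t , s ⟩ = lin? t ×-dec (lin? s ×-dec disj? (FV t) (FV s))
lin? (let⊗ x y s t) = lin? s ×-dec (lin? t ×-dec (¬? (x ≟ y) ×-dec ((x ∈? FV t) ×-dec ((y ∈? FV t) ×-dec
  disj? (FV s) (remove x (remove y (FV t)))))))

lin : ∀ t {_ : True (lin? t)} → Lin t
lin t {p} = toWitness p

closed-I : Closed I
closed-I = lin I , λ ()

exchange : Tm
exchange = ƛ 0 ⇒ let⊗ 1 2 (` 0) ⟨ ` 2 , ` 1 ⟩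

closed-exchange : Closed exchange
closed-exchange = lin exchange , λ ()

flip : Bool → Tm → Tm → Tm
flip w a b = if w then ⟨ b , a ⟩ else ⟨ a , b ⟩

act-I : Act false I
act-I = closed-I , λ {a} {b} ca cb → proj₁ (I≋ (proj₁ (closed-⟨⟩ {a} {b} ca cb)))

act-exchange : Act true exchange
act-exchange = closed-exchange , λ {a} {b} ca cb → let cp = closed-⟨⟩ {a} {b} ca cb in
  (exchange · ⟨ a , b ⟩ ⊒⟨ proj₁ (eval-λ [] (let⊗ 1 2 (` 0) ⟨ ` 2 , ` 1 ⟩) closed-[] (lin exchange) cp) ⟩
      subst [ 0 ↦ ⟨ a , b ⟩ ] (let⊗ 1 2 (` 0) ⟨ ` 2 , ` 1 ⟩) ⊒⟨ eval-let [ 0 ↦ ⟨ a , b ⟩ ] (` 0) ⟨ ` 2 , ` 1 ⟩ (closed-∷ {0} {⟨ a , b ⟩} {[]} cp closed-[]) (lin (let⊗ 1 2 (` 0) ⟨ ` 2 , ` 1 ⟩)) ca cb ⊒-refl ⟩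
      ⟨ b , a ⟩ ∎⊒)

act-⊒ : ∀ {w h h′} → Closed h → h ⊒ h′ → Act w h′ → Act w h
act-⊒ {w} {h} {h′} c e (_ , f) = c , λ {a} {b} ca cb →
  (h · ⟨ a , b ⟩ ⊒⟨ ⊒-appˡ e ⟩
      h′ · ⟨ a , b ⟩ ⊒⟨ f ca cb ⟩
      flip w a b ∎⊒)

closedS-∷ : ∀ x {v σ} → Closed v → ClosedS σ → ClosedS ((x , v) ∷ σ)
closedS-∷ x {v} {σ} = closed-∷ {x} {v} {σ}

-- The bound name 3 is safe because only closed terms are composed; it is the name bound in the
-- templates below, so that their values are literally of the form `comp f g`.
comp : Tm → Tm → Tm
comp f g = ƛ 3 ⇒ (f · (g · ` 3))

act-comp : ∀ {w₁ w₂ f g} → Act w₁ f → Act w₂ g → Act (w₁ xor w₂) (comp f g)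
act-comp {w₁} {w₂} {f} {g} (cf , ef) (cg , eg) =
  closed-subst {σ} (ƛ 3 ⇒ (` 1 · (` 2 · ` 3))) cσ (lin (ƛ 3 ⇒ (` 1 · (` 2 · ` 3))))
    (λ { (here refl) → cf ; (there (here refl)) → cg }) ,
  λ {a} {b} ca cb → (comp f g · ⟨ a , b ⟩ ⊒⟨ proj₁ (eval-λ σ (` 1 · (` 2 · ` 3)) cσ (lin (ƛ 3 ⇒ (` 1 · (` 2 · ` 3)))) (closed-⟨⟩ {a} {b} ca cb)) ⟩
      f · (g · ⟨ a , b ⟩) ⊒⟨ ⊒-appʳ (eg ca cb) ⟩
      f · flip w₂ a b ⊒⟨ two w₁ w₂ ef ca cb ⟩
      flip (w₁ xor w₂) a b ∎⊒)
  where
  σ : Subst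
  σ = [ 1 ↦ f , 2 ↦ g ]
  cσ : ClosedS σ
  cσ = closedS-∷ 1 cf (closedS-∷ 2 {g} {[]} cg closed-[])
  two : ∀ w₁ w₂ → (∀ {a b} → Closed a → Closed b → f · ⟨ a , b ⟩ ⊒ flip w₁ a b) →
    ∀ {a b} → Closed a → Closed b → f · flip w₂ a b ⊒ flip (w₁ xor w₂) a b
  two true true e ca cb = e cb ca
  two true false e ca cb = e ca cb
  two false true e ca cb = e cb ca
  two false false e ca cb = e ca cb

act-≡ : ∀ {w w′ h} → w ≡ w′ → Act w h → Act w′ h
act-≡ refl a = a

-- MK S feeds a payload into a value of shape S, and ER S consumes
-- a value and returns its payload. At an input the boolean of a leaf is the
-- bit supplied there; at an output it tells whether the received bit is added
-- to the payload or discarded.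

data Sk : Set where
  leaf     : Bool → Sk
  tens arr : Sk → Sk → Sk

act-of : Bool → Tm
act-of false = I
act-of true  = exchange

act-of-act : ∀ b → Act b (act-of b)
act-of-act false = act-I
act-of-act true = act-exchange

-- Open templates, whose free variables are later replaced by the tests for the components. In
-- `er-drop` the unwanted bit is spent on a pair of two identities: both components are equal, so it
-- makes no difference whether the bit exchanges them.
mk-leaf er-keep er-drop mk-tens er-tens mk-arr er-arr : Tm
mk-leaf = ƛ 0 ⇒ ⟨ ` 1 , ` 0 ⟩
er-keep = ƛ 0 ⇒ let⊗ 1 2 (` 0) (ƛ 3 ⇒ (` 1 · (` 2 · ` 3)))
er-drop = ƛ 0 ⇒ let⊗ 1 2 (` 0) (let⊗ 4 5 (` 1 · ⟨ I , I ⟩) (ƛ 3 ⇒ (` 4 · ((ƛ 3 ⇒ (` 5 · (` 2 · ` 3))) · ` 3))))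
mk-tens = ƛ 0 ⇒ ⟨ ` 1 · ` 0 , ` 2 · I ⟩
er-tens = ƛ 0 ⇒ let⊗ 1 2 (` 0) (ƛ 3 ⇒ ((` 4 · ` 1) · ((` 5 · ` 2) · ` 3)))
mk-arr  = ƛ 0 ⇒ (ƛ 1 ⇒ (` 2 · (ƛ 3 ⇒ (` 0 · ((` 4 · ` 1) · ` 3)))))
er-arr  = ƛ 0 ⇒ (` 1 · (` 0 · (` 2 · I)))

MK ER : Sk → Tm
MK (leaf b)   = subst [ 1 ↦ act-of b ] mk-leaf
MK (tens S T) = subst [ 1 ↦ MK S , 2 ↦ MK T ] mk-tens
MK (arr S T)  = subst [ 2 ↦ MK T , 4 ↦ ER S ] mk-arr
ER (leaf true)  = er-keep
ER (leaf false) = er-drop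
ER (tens S T) = subst [ 4 ↦ ER S , 5 ↦ ER T ] er-tens
ER (arr S T)  = subst [ 1 ↦ ER T , 2 ↦ MK S ] er-arr

closed₂ : ∀ x y {u v} → Closed u → Closed v → ClosedS [ x ↦ u , y ↦ v ]
closed₂ x y {u} {v} cu cv = closedS-∷ x cu (closedS-∷ y {v} {[]} cv closed-[])

closed-MK : ∀ S → Closed (MK S)
closed-ER : ∀ S → Closed (ER S)
closed-MK (leaf b) = closed-subst {[ 1 ↦ act-of b ]} mk-leaf (closedS-∷ 1 {act-of b} {[]} (proj₁ (act-of-act b)) closed-[]) (lin mk-leaf)
  λ { (here refl) → proj₁ (act-of-act b) }
closed-MK (tens S T) = closed-subst {[ 1 ↦ MK S , 2 ↦ MK T ]} mk-tens (closed₂ 1 2 {MK S} {MK T} (closed-MK S) (closed-MK T)) (lin mk-tens)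
  λ { (here refl) → closed-MK S ; (there (here refl)) → closed-MK T }
closed-MK (arr S T) = closed-subst {[ 2 ↦ MK T , 4 ↦ ER S ]} mk-arr (closed₂ 2 4 {MK T} {ER S} (closed-MK T) (closed-ER S)) (lin mk-arr)
  λ { (here refl) → closed-MK T ; (there (here refl)) → closed-ER S }
closed-ER (leaf true) = lin er-keep , λ ()
closed-ER (leaf false) = lin er-drop , λ ()
closed-ER (tens S T) = closed-subst {[ 4 ↦ ER S , 5 ↦ ER T ]} er-tens (closed₂ 4 5 {ER S} {ER T} (closed-ER S) (closed-ER T)) (lin er-tens)
  λ { (here refl) → closed-ER S ; (there (here refl)) → closed-ER T }
closed-ER (arr S T) = closed-subst {[ 1 ↦ ER T , 2 ↦ MK S ]} er-arr (closed₂ 1 2 {ER T} {MK S} (closed-ER T) (closed-MK S)) (lin er-arr)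
  λ { (here refl) → closed-ER T ; (there (here refl)) → closed-MK S }

module Tests (bit : ℕ → Bool) where
  open Realizability bit

  -- Feed A S k (Obs A S k): S is a skeleton of A at an input (output) and the
  -- bits kept by S add up to k.
  data Feed : Ty → Sk → Bool → Set
  data Obs  : Ty → Sk → Bool → Set
  data Feed where
    atom : ∀ {a} → Feed (tv a) (leaf (bit a)) false
    _⊗_  : ∀ {A B S T k l} → Feed A S k → Feed B T l → Feed (A ⊗ B) (tens S T) (k xor l)
    _⊸_  : ∀ {A B S T k l} → Obs A S k → Feed B T l → Feed (A ⊸ B) (arr S T) (k xor l)
  data Obs where
    atom : ∀ {a b} → Obs (tv a) (leaf b) (b ∧ bit a)
    _⊗_  : ∀ {A B S T k l} → Obs A S k → Obs B T l → Obs (A ⊗ B) (tens S T) (k xor l)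
    _⊸_  : ∀ {A B S T k l} → Feed A S k → Obs B T l → Obs (A ⊸ B) (arr S T) (k xor l)

  -- The two directions call each other at an arrow. A fed function observes its argument, composes
  -- the result with its own payload and feeds the composite to its codomain; an observed function
  -- is applied to an argument fed with the identity.
  feed : ∀ {A S k w h} → Feed A S k → Act w h → R A (w xor k) (MK S · h)
  obs  : ∀ {A S k w v} → Obs A S k → R A w v → Act (w xor k) (ER S · v)

  feed {tv a} {leaf b} {w = w} {h} atom r = closed-· {MK (leaf b)} {h} (closed-MK (leaf b)) (proj₁ r) , act-of b , h ,
    proj₁ (eval-λ [ 1 ↦ act-of b ] ⟨ ` 1 , ` 0 ⟩ (closedS-∷ 1 {act-of b} {[]} (proj₁ (act-of-act b)) closed-[]) (lin mk-leaf) (proj₁ r)) ,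
    act-of-act b , act-≡ (sym (Bool.xor-identityʳ w)) r
  feed {A ⊗ B} {tens S T} {w = w} {h} (_⊗_ {k = k} {l} p q) r =
    closed-· {MK (tens S T)} {h} (closed-MK (tens S T)) (proj₁ r) , MK S · h , MK T · I , _ , _ ,
    proj₁ (eval-λ [ 1 ↦ MK S , 2 ↦ MK T ] ⟨ ` 1 · ` 0 , ` 2 · I ⟩ (closed₂ 1 2 {MK S} {MK T} (closed-MK S) (closed-MK T)) (lin mk-tens) (proj₁ r)) ,
    feed p r , feed {w = false} q act-I , sym (Bool.xor-assoc w k l)
  feed {A ⊸ B} {arr S T} {w = w} {h} (_⊸_ {k = k} {l} p q) r =
    cm , λ {w′} {x} rx → let cx = R-closed A rx in
    R-⊒ B (closed-· {MK (arr S T) · h} {x} cm cx)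
      (MK (arr S T) · h · x ⊒⟨ ⊒-appˡ (proj₁ (eval-λ σ (ƛ 1 ⇒ inner) cσ (lin mk-arr) (proj₁ r))) ⟩
          subst ((0 , h) ∷ σ) (ƛ 1 ⇒ inner) · x ⊒⟨ proj₁ (eval-λ ((0 , h) ∷ σ) inner (closedS-∷ 0 {h} {σ} (proj₁ r) cσ) (lin (ƛ 1 ⇒ inner)) cx) ⟩
          MK T · comp h (ER S · x) ∎⊒)
      (R-≡ {B} (xor-lemma w k l w′) (feed q (act-comp {f = h} {ER S · x} r (obs p rx))))
    where
    σ = [ 2 ↦ MK T , 4 ↦ ER S ]
    cσ : ClosedS σ
    cσ = closed₂ 2 4 {MK T} {ER S} (closed-MK T) (closed-ER S)
    inner = ` 2 · (ƛ 3 ⇒ (` 0 · ((` 4 · ` 1) · ` 3)))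
    cm = closed-· {MK (arr S T)} {h} (closed-MK (arr S T)) (proj₁ r)
    right : ∀ x y z → (x xor y) xor z ≡ (x xor z) xor y
    right x y z = trans (Bool.xor-assoc x y z) (trans (cong (x xor_) (Bool.xor-comm y z)) (sym (Bool.xor-assoc x z y)))
    xor-lemma : ∀ w k l w′ → (w xor (w′ xor k)) xor l ≡ (w xor (k xor l)) xor w′
    xor-lemma w k l w′ = trans (cong (_xor l) (trans (sym (Bool.xor-assoc w w′ k)) (right w w′ k)))
      (trans (right (w xor k) w′ l) (cong (_xor w′) (Bool.xor-assoc w k l)))

  obs {tv a} {leaf true} {w = w} {v} atom (cv , c , h , e , rc , rh) =
    act-≡ (Bool.xor-comm (bit a) w)
      (act-⊒ {h = er-keep · v} {comp c h} (closed-· {er-keep} {v} (closed-ER (leaf true)) cv)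
        (er-keep · v ⊒⟨ proj₁ (eval-λ [] body closed-[] (lin er-keep) cv) ⟩
            subst [ 0 ↦ v ] body ⊒⟨ eval-let [ 0 ↦ v ] (` 0) (ƛ 3 ⇒ (` 1 · (` 2 · ` 3))) (closedS-∷ 0 {v} {[]} cv closed-[]) (lin body) (proj₁ rc) (proj₁ rh) e ⟩
            comp c h ∎⊒)
        (act-comp {f = c} {h} rc rh))
    where
    body = let⊗ 1 2 (` 0) (ƛ 3 ⇒ (` 1 · (` 2 · ` 3)))
  obs {tv a} {leaf false} {w = w} {v} atom (cv , c , h , e , rc , rh) =
    act-≡ (sym (Bool.xor-identityʳ w))
      (act-⊒ {h = er-drop · v} {comp I (comp I h)} (closed-· {er-drop} {v} (closed-ER (leaf false)) cv)
        (er-drop · v ⊒⟨ proj₁ (eval-λ [] body closed-[] (lin er-drop) cv) ⟩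
            subst [ 0 ↦ v ] body ⊒⟨ eval-let [ 0 ↦ v ] (` 0) body′ (closedS-∷ 0 {v} {[]} cv closed-[]) (lin body) (proj₁ rc) (proj₁ rh) e ⟩
            subst σ body′ ⊒⟨ eval-let σ (` 1 · ⟨ I , I ⟩) body″
              (closedS-∷ 2 {h} (proj₁ rh) (closedS-∷ 1 {c} {[ 0 ↦ v ]} (proj₁ rc) (closedS-∷ 0 {v} {[]} cv closed-[])))
              (lin body′) closed-I closed-I (both (bit a) (proj₂ rc closed-I closed-I)) ⟩
            comp I (comp I h) ∎⊒)
        (act-comp {false} {w} {I} {comp I h} act-I (act-comp {false} {w} {I} {h} act-I rh)))
    where
    body″ = ƛ 3 ⇒ (` 4 · ((ƛ 3 ⇒ (` 5 · (` 2 · ` 3))) · ` 3))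
    body′ = let⊗ 4 5 (` 1 · ⟨ I , I ⟩) body″
    body = let⊗ 1 2 (` 0) body′
    σ : Subst
    σ = (2 , h) ∷ (1 , c) ∷ [ 0 ↦ v ]
    both : ∀ b → c · ⟨ I , I ⟩ ⊒ flip b I I → c · ⟨ I , I ⟩ ⊒ ⟨ I , I ⟩
    both true e = e
    both false e = e
  obs {A ⊗ B} {tens S T} {w = w} {v} (_⊗_ {k = k} {l} p q) (cv , v₁ , v₂ , w₁ , w₂ , e , r₁ , r₂ , refl) =
    act-≡ (xor-swap w₁ k w₂ l)
      (act-⊒ {h = ER (tens S T) · v} {comp (ER S · v₁) (ER T · v₂)} (closed-· {ER (tens S T)} {v} (closed-ER (tens S T)) cv)
        (ER (tens S T) · v ⊒⟨ proj₁ (eval-λ σ body cσ (lin er-tens) cv) ⟩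
            subst ((0 , v) ∷ σ) body ⊒⟨ eval-let ((0 , v) ∷ σ) (` 0) (ƛ 3 ⇒ ((` 4 · ` 1) · ((` 5 · ` 2) · ` 3))) (closedS-∷ 0 {v} {σ} cv cσ) (lin body) (R-closed A r₁) (R-closed B r₂) e ⟩
            comp (ER S · v₁) (ER T · v₂) ∎⊒)
        (act-comp {f = ER S · v₁} {ER T · v₂} (obs p r₁) (obs q r₂)))
    where
    σ = [ 4 ↦ ER S , 5 ↦ ER T ]
    cσ : ClosedS σ
    cσ = closed₂ 4 5 {ER S} {ER T} (closed-ER S) (closed-ER T)
    body = let⊗ 1 2 (` 0) (ƛ 3 ⇒ ((` 4 · ` 1) · ((` 5 · ` 2) · ` 3)))
    xor-swap : ∀ a b c d → (a xor b) xor (c xor d) ≡ (a xor c) xor (b xor d)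
    xor-swap a b c d = trans (Bool.xor-assoc a b (c xor d)) (trans (cong (a xor_)
      (trans (sym (Bool.xor-assoc b c d)) (trans (cong (_xor d) (Bool.xor-comm b c)) (Bool.xor-assoc c b d)))) (sym (Bool.xor-assoc a c (b xor d))))
  obs {A ⊸ B} {arr S T} {w = w} {v} (_⊸_ {k = k} {l} p q) (cv , f) =
    act-≡ (Bool.xor-assoc w k l)
      (act-⊒ {h = ER (arr S T) · v} {ER T · (v · (MK S · I))} (closed-· {ER (arr S T)} {v} (closed-ER (arr S T)) cv)
        (proj₁ (eval-λ σ (` 1 · (` 0 · (` 2 · I))) (closed₂ 1 2 {ER T} {MK S} (closed-ER T) (closed-MK S)) (lin er-arr) cv))
        (obs q (f (feed {w = false} p act-I))))
    where
    σ = [ 1 ↦ ER T , 2 ↦ MK S ]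

-- Tests that separate or erase

_≟ᵗ_ : ∀ (A B : Ty) → Dec (A ≡ B)
tv a ≟ᵗ tv b with a ≟ b
... | yes refl = yes refl
... | no n = no λ { refl → n refl }
tv _ ≟ᵗ (_ ⊗ _) = no λ ()
tv _ ≟ᵗ (_ ⊸ _) = no λ ()
(_ ⊗ _) ≟ᵗ tv _ = no λ ()
(A ⊗ B) ≟ᵗ (A′ ⊗ B′) with A ≟ᵗ A′ | B ≟ᵗ B′
... | yes refl | yes refl = yes refl
... | no n | _ = no λ { refl → n refl }
... | _ | no n = no λ { refl → n refl }
(_ ⊗ _) ≟ᵗ (_ ⊸ _) = no λ ()
(_ ⊸ _) ≟ᵗ tv _ = no λ ()
(_ ⊸ _) ≟ᵗ (_ ⊗ _) = no λ ()
(A ⊸ B) ≟ᵗ (A′ ⊸ B′) with A ≟ᵗ A′ | B ≟ᵗ B′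
... | yes refl | yes refl = yes refl
... | no n | _ = no λ { refl → n refl }
... | _ | no n = no λ { refl → n refl }

module _ {ρ : ℕ → ℕ} (bit : ℕ → Bool) where
  open Tests bit

  -- Every output leaf is set to drop, so the bits kept add up to `false` whatever the atoms are.
  -- One skeleton serves both types because `Agree` makes their inputs coincide, the only atoms
  -- whose bits are written into a skeleton.
  discard-obs  : ∀ {A A′} → Agree ρ false A A′ → ∃[ S ] (Obs A S false × Obs A′ S false)
  discard-feed : ∀ {A A′} → Agree ρ true A A′ → ∃[ S ] (Feed A S false × Feed A′ S false)
  discard-obs (free _) = leaf false , atom , atom
  discard-obs (p ⊗ q) with discard-obs p | discard-obs q
  ... | S , a , a′ | T , b , b′ = tens S T , a ⊗ b , a′ ⊗ b′
  discard-obs (p ⊸ q) with discard-feed p | discard-obs q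
  ... | S , a , a′ | T , b , b′ = arr S T , a ⊸ b , a′ ⊸ b′
  discard-feed fixed = _ , atom , atom
  discard-feed (p ⊗ q) with discard-feed p | discard-feed q
  ... | S , a , a′ | T , b , b′ = tens S T , a ⊗ b , a′ ⊗ b′
  discard-feed (p ⊸ q) with discard-obs p | discard-feed q
  ... | S , a , a′ | T , b , b′ = arr S T , a ⊸ b , a′ ⊸ b′

isAtom : ℕ → ℕ → Bool
isAtom a n = ⌊ n ≟ a ⌋

module _ {ρ : ℕ → ℕ} where
  private
    module T (a : ℕ) = Tests (isAtom a)

  -- The first output whose atoms differ is kept; the bit of its atom in A
  -- tells the two types apart.
  differ-obs  : ∀ {A A′} → Agree ρ false A A′ → A ≢ A′ → ∃[ a ] ∃[ S ] (T.Obs a A S true × T.Obs a A′ S false)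
  differ-feed : ∀ {A A′} → Agree ρ true A A′ → A ≢ A′ → ∃[ a ] ∃[ S ] (T.Feed a A S true × T.Feed a A′ S false)
  differ-obs {tv a} {tv b} (free _) n = a , leaf true ,
    ≡.subst (T.Obs a (tv a) (leaf true)) (same a) T.atom , ≡.subst (T.Obs a (tv b) (leaf true)) (other a b (λ { refl → n refl })) T.atom
    where
    same : ∀ a → isAtom a a ≡ true
    same a with a ≟ a
    ... | yes _ = refl
    ... | no k = ⊥-elim (k refl)
    other : ∀ a b → a ≢ b → isAtom a b ≡ false
    other a b k with b ≟ a
    ... | yes e = ⊥-elim (k (sym e))
    ... | no _ = refl
  differ-obs {A ⊗ B} {A′ ⊗ B′} (p ⊗ q) n with A ≟ᵗ A′
  ... | no k with differ-obs p k
  -- The atom `a` is known only after the differing side has been searched; the other side is then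
  -- discarded for the same assignment of bits `isAtom a`.
  ...   | a , S , x , x′ with discard-obs (isAtom a) q
  ...     | U , y , y′ = a , tens S U , x T.⊗ y , x′ T.⊗ y′
  differ-obs {A ⊗ B} {A′ ⊗ B′} (p ⊗ q) n | yes refl with differ-obs q (λ { refl → n refl })
  ...   | a , U , y , y′ with discard-obs (isAtom a) p
  ...     | S , x , x′ = a , tens S U , x T.⊗ y , x′ T.⊗ y′
  differ-obs {A ⊸ B} {A′ ⊸ B′} (p ⊸ q) n with A ≟ᵗ A′
  ... | no k with differ-feed p k
  ...   | a , S , x , x′ with discard-obs (isAtom a) q
  ...     | U , y , y′ = a , arr S U , x T.⊸ y , x′ T.⊸ y′
  differ-obs {A ⊸ B} {A′ ⊸ B′} (p ⊸ q) n | yes refl with differ-obs q (λ { refl → n refl })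
  ...   | a , U , y , y′ with discard-feed (isAtom a) p
  ...     | S , x , x′ = a , arr S U , x T.⊸ y , x′ T.⊸ y′
  differ-feed fixed n = ⊥-elim (n refl)
  differ-feed {A ⊗ B} {A′ ⊗ B′} (p ⊗ q) n with A ≟ᵗ A′
  ... | no k with differ-feed p k
  ...   | a , S , x , x′ with discard-feed (isAtom a) q
  ...     | U , y , y′ = a , tens S U , x T.⊗ y , x′ T.⊗ y′
  differ-feed {A ⊗ B} {A′ ⊗ B′} (p ⊗ q) n | yes refl with differ-feed q (λ { refl → n refl })
  ...   | a , U , y , y′ with discard-feed (isAtom a) p
  ...     | S , x , x′ = a , tens S U , x T.⊗ y , x′ T.⊗ y′
  differ-feed {A ⊸ B} {A′ ⊸ B′} (p ⊸ q) n with A ≟ᵗ A′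
  ... | no k with differ-obs p k
  ...   | a , S , x , x′ with discard-feed (isAtom a) q
  ...     | U , y , y′ = a , arr S U , x T.⊸ y , x′ T.⊸ y′
  differ-feed {A ⊸ B} {A′ ⊸ B′} (p ⊸ q) n | yes refl with differ-feed q (λ { refl → n refl })
  ...   | a , U , y , y′ with discard-obs (isAtom a) p
  ...     | S , x , x′ = a , arr S U , x T.⊸ y , x′ T.⊸ y′

Agree-refl : ∀ {ρ} b A → Agree ρ b A A
Agree-refl true (tv a) = fixed
Agree-refl false (tv a) = free refl
Agree-refl b (A ⊗ B) = Agree-refl b A ⊗ Agree-refl b B
Agree-refl b (A ⊸ B) = Agree-refl (not b) A ⊸ Agree-refl b B

-- The linear substitute for weakening: a closed term of type `B` is absorbed into an action that
-- leaves pairs unchanged.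
eraser : ∀ B → ∃[ E ] (Closed E × (∀ {t} → [] ⊢ t ∶ B → Act false (E · t)))
eraser B with discard-obs {id} (λ _ → false) (Agree-refl false B)
... | S , o , _ = ER S , closed-ER S , λ d → Tests.obs _ o (Realizability.adequacy-closed _ d)

separator : ∀ {ρ A A′ s s′} → Agree ρ false A A′ → A ≢ A′ → [] ⊢ s ∶ A → [] ⊢ s′ ∶ A′ →
  ∃[ T ] (Closed T × Act true (T · s) × Act false (T · s′))
separator p n d d′ with differ-obs p n
... | a , S , o , o′ = ER S , closed-ER S ,
  Tests.obs _ o (Realizability.adequacy-closed _ d) , Tests.obs _ o′ (Realizability.adequacy-closed _ d′)

-- Unification

-- A given unifier τ bounds the recursion: replacing a variable
-- x by its value preserves the sizes of all sides under τ.

size : Ty → ℕ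
size (tv _)  = 1
size (A ⊗ B) = suc (size A + size B)
size (A ⊸ B) = suc (size A + size B)

1≤size : ∀ A → 1 ≤ size A
1≤size (tv _) = s≤s z≤n
1≤size (A ⊗ B) = s≤s z≤n
1≤size (A ⊸ B) = s≤s z≤n

Eqs : Set
Eqs = List (Ty × Ty)

Unifies : TySub → Ty × Ty → Set
Unifies θ e = sub θ (proj₁ e) ≡ sub θ (proj₂ e)

Solves : TySub → Eqs → Set
Solves θ = All (Unifies θ)

-- Most generality in its idempotent form: every solution `τ` absorbs `θ`, so `τ` itself is the
-- substitution through which it factors.
MGU : Eqs → Set
MGU es = ∃[ θ ] (Solves θ es × (∀ τ → Solves τ es → ∀ n → sub τ (θ n) ≡ τ n))

[_:=_] : ℕ → Ty → TySub
[ x := B ] n with n ≟ x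
... | yes _ = B
... | no _  = tv n

sub-∉ : ∀ {x θ θ′} → (∀ {n} → n ≢ x → θ n ≡ θ′ n) → ∀ A → tot x A ≡ 0 → sub θ A ≡ sub θ′ A
sub-∉ {x} h (tv a) e = h (λ { refl → 1≢0 (trans (sym (δ-≡ a)) e) })
  where
  1≢0 : 1 ≢ 0
  1≢0 ()
sub-∉ {x} h (A ⊗ B) e = cong₂ _⊗_ (sub-∉ h A (ℕ.m+n≡0⇒m≡0 (tot x A) e)) (sub-∉ h B (ℕ.m+n≡0⇒n≡0 (tot x A) e))
sub-∉ {x} h (A ⊸ B) e = cong₂ _⊸_ (sub-∉ h A (ℕ.m+n≡0⇒m≡0 (tot x A) e)) (sub-∉ h B (ℕ.m+n≡0⇒n≡0 (tot x A) e))

+-pos : ∀ {n} m → 1 ≤ m + n → 1 ≤ m ⊎ 1 ≤ n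
+-pos zero p = inj₂ p
+-pos (suc m) p = inj₁ (s≤s z≤n)

size-occurs : ∀ {x} τ A → 1 ≤ tot x A → size (τ x) ≤ size (sub τ A)
size-occurs {x} τ (tv a) p with x ≟ a
... | yes refl = ℕ.≤-refl
size-occurs {x} τ (A ⊗ B) p with +-pos (tot x A) p
... | inj₁ q = ℕ.≤-trans (size-occurs τ A q) (ℕ.≤-trans (ℕ.m≤m+n _ _) (ℕ.n≤1+n _))
... | inj₂ q = ℕ.≤-trans (size-occurs τ B q) (ℕ.≤-trans (ℕ.m≤n+m _ (size (sub τ A))) (ℕ.n≤1+n _))
size-occurs {x} τ (A ⊸ B) p with +-pos (tot x A) p
... | inj₁ q = ℕ.≤-trans (size-occurs τ A q) (ℕ.≤-trans (ℕ.m≤m+n _ _) (ℕ.n≤1+n _))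
... | inj₂ q = ℕ.≤-trans (size-occurs τ B q) (ℕ.≤-trans (ℕ.m≤n+m _ (size (sub τ A))) (ℕ.n≤1+n _))

-- The given solution `τ` takes the place of an occurs check: if `x` occurred properly in `B`, its
-- value under `τ` would be smaller than itself.
no-cycle : ∀ {x} τ B → τ x ≡ sub τ B → B ≢ tv x → tot x B ≡ 0
no-cycle {x} τ (tv b) e n = δ-≢ (λ { refl → n refl })
no-cycle {x} τ (A ⊗ B) e n with tot x A + tot x B in q
... | zero = refl
... | suc m with +-pos {tot x B} (tot x A) (≡.subst (1 ≤_) (sym q) (s≤s z≤n))
...   | inj₁ p = ⊥-elim (ℕ.<-irrefl (cong size e) (s≤s (ℕ.≤-trans (size-occurs τ A p) (ℕ.m≤m+n _ _))))
...   | inj₂ p = ⊥-elim (ℕ.<-irrefl (cong size e) (s≤s (ℕ.≤-trans (size-occurs τ B p) (ℕ.m≤n+m _ (size (sub τ A))))))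
no-cycle {x} τ (A ⊸ B) e n with tot x A + tot x B in q
... | zero = refl
... | suc m with +-pos {tot x B} (tot x A) (≡.subst (1 ≤_) (sym q) (s≤s z≤n))
...   | inj₁ p = ⊥-elim (ℕ.<-irrefl (cong size e) (s≤s (ℕ.≤-trans (size-occurs τ A p) (ℕ.m≤m+n _ _))))
...   | inj₂ p = ⊥-elim (ℕ.<-irrefl (cong size e) (s≤s (ℕ.≤-trans (size-occurs τ B p) (ℕ.m≤n+m _ (size (sub τ A))))))

-- Counting the left sides is enough: for a solution `τ` the right sides have the same sizes.
measure : TySub → Eqs → ℕ
measure τ [] = 0
measure τ ((A , _) ∷ es) = size (sub τ A) + measure τ es

subE : TySub → Eqs → Eqs
subE θ = map (λ (A , B) → sub θ A , sub θ B)

sub-:= : ∀ {x B} τ → τ x ≡ sub τ B → ∀ A → sub τ (sub [ x := B ] A) ≡ sub τ A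
sub-:= {x} {B} τ e A = trans (sub-∘ τ [ x := B ] A) (sub-cong at A)
  where
  at : ∀ n → sub τ ([ x := B ] n) ≡ τ n
  at n with n ≟ x
  ... | yes refl = sym e
  ... | no _ = refl

Solves-:= : ∀ {x B es} τ → τ x ≡ sub τ B → Solves τ es → Solves τ (subE [ x := B ] es)
Solves-:= τ e [] = []
Solves-:= {es = (A , C) ∷ es} τ e (p ∷ ps) =
  trans (sub-:= τ e A) (trans p (sym (sub-:= τ e C))) ∷ Solves-:= τ e ps

measure-:= : ∀ {x B} τ → τ x ≡ sub τ B → ∀ es → measure τ (subE [ x := B ] es) ≡ measure τ es
measure-:= τ e [] = refl
measure-:= τ e ((A , _) ∷ es) = cong₂ _+_ (cong size (sub-:= τ e A)) (measure-:= τ e es)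

Solves-subE : ∀ {θ θ′} es → Solves θ (subE θ′ es) → Solves (sub θ ∘ θ′) es
Solves-subE [] [] = []
Solves-subE {θ} {θ′} ((A , C) ∷ es) (p ∷ ps) = trans (sym (sub-∘ θ θ′ A)) (trans p (sub-∘ θ θ′ C)) ∷ Solves-subE es ps

eliminate : ∀ {x B es} → tot x B ≡ 0 → MGU (subE [ x := B ] es) → MGU ((tv x , B) ∷ es)
eliminate {x} {B} {es} x∉B (θ , s , u) = sub θ ∘ [ x := B ] , solved ∷ Solves-subE es s , λ { τ (e ∷ es′) n → univ τ e es′ n }
  where
  at-x : [ x := B ] x ≡ B
  at-x with x ≟ x
  ... | yes _ = refl
  ... | no k = ⊥-elim (k refl)
  off-x : ∀ {n} → n ≢ x → [ x := B ] n ≡ tv n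
  off-x {n} k with n ≟ x
  ... | yes e = ⊥-elim (k e)
  ... | no _ = refl
  solved : sub θ ([ x := B ] x) ≡ sub (sub θ ∘ [ x := B ]) B
  solved = trans (cong (sub θ) at-x) (sub-∉ (λ k → sym (cong (sub θ) (off-x k))) B x∉B)
  univ : ∀ τ → τ x ≡ sub τ B → Solves τ es → ∀ n → sub τ (sub θ ([ x := B ] n)) ≡ τ n
  univ τ e es′ n = trans (sub-∘ τ θ ([ x := B ] n))
    (trans (sub-cong (u τ (Solves-:= τ e es′)) ([ x := B ] n)) (sub-:= τ e (tv n)))

⊗-injective : ∀ {A B C D : Ty} → _≡_ {A = Ty} (A ⊗ B) (C ⊗ D) → A ≡ C × B ≡ D
⊗-injective refl = refl , refl

⊸-injective : ∀ {A B C D : Ty} → _≡_ {A = Ty} (A ⊸ B) (C ⊸ D) → A ≡ C × B ≡ D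
⊸-injective refl = refl , refl

unify : ∀ fuel es τ → Solves τ es → measure τ es < fuel → MGU es
unify-var : ∀ fuel x B es τ → τ x ≡ sub τ B → Solves τ es → measure τ es < fuel → MGU ((tv x , B) ∷ es)
unify-var fuel x B es τ e s m with B ≟ᵗ tv x
... | yes refl = let θ , s′ , u = unify fuel es τ s m in θ , refl ∷ s′ , λ { τ′ (_ ∷ p) → u τ′ p }
... | no n = eliminate (no-cycle τ B e n)
  (unify fuel (subE [ x := B ] es) τ (Solves-:= τ e s) (≡.subst (_< fuel) (sym (measure-:= τ e es)) m))
flip-head : ∀ {A B es} → MGU ((A , B) ∷ es) → MGU ((B , A) ∷ es)
flip-head (θ , e ∷ s , u) = θ , sym e ∷ s , λ { τ (e′ ∷ s′) → u τ (sym e′ ∷ s′) }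
mgu-⊗ : ∀ {A B C D es} → MGU ((A , C) ∷ (B , D) ∷ es) → MGU ((A ⊗ B , C ⊗ D) ∷ es)
mgu-⊗ (θ , p ∷ q ∷ r , u) = θ , cong₂ _⊗_ p q ∷ r ,
  λ { τ (e ∷ s) → u τ (proj₁ (⊗-injective e) ∷ proj₂ (⊗-injective e) ∷ s) }
mgu-⊸ : ∀ {A B C D es} → MGU ((A , C) ∷ (B , D) ∷ es) → MGU ((A ⊸ B , C ⊸ D) ∷ es)
mgu-⊸ (θ , p ∷ q ∷ r , u) = θ , cong₂ _⊸_ p q ∷ r ,
  λ { τ (e ∷ s) → u τ (proj₁ (⊸-injective e) ∷ proj₂ (⊸-injective e) ∷ s) }
less : ∀ {m n fuel} → 1 ≤ m → m + n < suc fuel → n < fuel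
less {suc m} {n} _ (s≤s p) = ℕ.≤-trans (s≤s (ℕ.m≤n+m n m)) p
decompose : ∀ {a b c fuel} → suc (a + b) + c < suc fuel → a + (b + c) < fuel
decompose {a} {b} {c} {fuel} (s≤s p) = ≡.subst (λ k → suc k ≤ fuel) (ℕ.+-assoc a b c) p
unify zero es τ s ()
unify (suc fuel) [] τ s m = tv , [] , λ _ _ _ → refl
unify (suc fuel) ((tv x , B) ∷ es) τ (e ∷ s) m = unify-var fuel x B es τ e s (less (1≤size (τ x)) m)
unify (suc fuel) ((A@(_ ⊗ _) , tv x) ∷ es) τ (e ∷ s) m =
  flip-head (unify-var fuel x A es τ (sym e) s (less (1≤size (sub τ A)) m))
unify (suc fuel) ((A@(_ ⊸ _) , tv x) ∷ es) τ (e ∷ s) m =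
  flip-head (unify-var fuel x A es τ (sym e) s (less (1≤size (sub τ A)) m))
unify (suc fuel) ((A ⊗ B , C ⊗ D) ∷ es) τ (e ∷ s) m = let e₁ , e₂ = ⊗-injective e in
  mgu-⊗ (unify fuel ((A , C) ∷ (B , D) ∷ es) τ (e₁ ∷ e₂ ∷ s) (decompose {size (sub τ A)} m))
unify (suc fuel) ((A ⊸ B , C ⊸ D) ∷ es) τ (e ∷ s) m = let e₁ , e₂ = ⊸-injective e in
  mgu-⊸ (unify fuel ((A , C) ∷ (B , D) ∷ es) τ (e₁ ∷ e₂ ∷ s) (decompose {size (sub τ A)} m))
unify (suc fuel) ((_ ⊗ _ , _ ⊸ _) ∷ es) τ (() ∷ s) m
unify (suc fuel) ((_ ⊸ _ , _ ⊗ _) ∷ es) τ (() ∷ s) m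

mgu : ∀ A B τ → sub τ A ≡ sub τ B →
  ∃[ θ ] (sub θ A ≡ sub θ B × (∀ τ → sub τ A ≡ sub τ B → ∀ C → sub τ (sub θ C) ≡ sub τ C))
mgu A B τ e with unify _ [ A , B ] τ (e ∷ []) ℕ.≤-refl
... | θ , p ∷ [] , u = θ , p , λ τ′ e′ C → trans (sub-∘ τ′ θ C) (sub-cong (u τ′ (e′ ∷ [])) C)

-- Principal types

HasTy-sub : ∀ {E t A} θ → HasTy E t A → HasTy (sub θ ∘ E) t (sub θ A)
sub-upd : ∀ θ {E x A} z → upd (sub θ ∘ E) x (sub θ A) z ≡ sub θ (upd E x A z)
sub-upd θ {x = x} z with z ≟ x
... | yes _ = refl
... | no _ = refl
HasTy-sub θ (var e) = var (cong (sub θ) e)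
HasTy-sub θ (app d e) = app (HasTy-sub θ d) (HasTy-sub θ e)
HasTy-sub θ (lam {E} {x} {A = A} d) = lam (HasTy-ext (λ {z} _ → sym (sub-upd θ {E} {x} {A} z)) (HasTy-sub θ d))
HasTy-sub θ (pair d e) = pair (HasTy-sub θ d) (HasTy-sub θ e)
HasTy-sub θ (letp {E} {x} {y} {A = A} {B} d e) = letp (HasTy-sub θ d)
  (HasTy-ext (λ {z} _ → trans (sym (sub-upd θ {upd E y B} {x} {A} z)) (upd-cong {x = x} {sub θ A} {z} (λ _ → sym (sub-upd θ {E} {y} {B} z))))
    (HasTy-sub θ e))

record Principal (t : Tm) : Set where
  constructor principal
  field
    env  : ℕ → Ty
    ty   : Ty
    typ  : HasTy env t ty
    univ : ∀ {E A} → HasTy E t A → ∃[ θ ] (sub θ ty ≡ A × (∀ {x} → x ∈ FV t → sub θ (env x) ≡ E x))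

glue-univ : ∀ {xs ys} {E₁ E₂ E : ℕ → Ty} {θ} → Disj xs ys → (∀ {x} → x ∈ xs → sub θ (E₁ x) ≡ E x) →
  (∀ {x} → x ∈ ys → sub θ (E₂ x) ≡ E x) → ∀ {x} → x ∈ xs ++ ys → sub θ (glue xs E₁ E₂ x) ≡ E x
glue-univ {xs} {θ = θ} d h k x∈ with ∈-++⁻ xs x∈
... | inj₁ p = trans (cong (sub θ) (glue-∈ p)) (h p)
... | inj₂ p = trans (cong (sub θ) (glue-∉ (λ q → d q p))) (k p)

-- Subterms have disjoint free variables, so their environments are merged without unification; a
-- single equation remains at an application or a let, none at an abstraction or a pair. The typing
-- assumed at the start provides the solution that `mgu` needs.
principalType : ∀ {E A} t → Lin t → HasTy E t A → Principal t
principalType (` x) l d = principal (λ _ → tv 0) (tv 0) (var refl) λ { {A = A} (var e) → (λ _ → A) , refl , λ { (here refl) → sym e } }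
principalType (t · s) (l , m , dj) (app {B = B₀} d₀ e₀) with principalType t l d₀ | principalType s m e₀
... | principal E₁ C₁ h₁ u₁ | principal E₂ C₂ h₂ u₂ =
  principal (sub θ ∘ E₁₂) (sub θ α) (app (≡.subst (HasTy _ t) eq (HasTy-sub θ (HasTy-glueˡ (HasTy-sub (tv ∘ ev) h₁))))
      (HasTy-sub θ (HasTy-glueʳ dj (HasTy-sub (tv ∘ od) (HasTy-sub (tv ∘ ev) h₂)))))
    λ { (app d e) → let τ , e₁ , k , b = common d e in τ , trans (most τ e₁ α) b , λ p → trans (most τ e₁ (E₁₂ _)) (k p) }
  where
  -- Three disjoint supplies of variables are in play: `ev` for `t`, `od` after `ev` for `s`, and
  -- `od` after `od` for the unknown result type.
  α = tv (od (od 0))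
  E₁₂ = glue (FV t) (ren ev ∘ E₁) (ren od ∘ (ren ev ∘ E₂))
  C₂′ = ren od (ren ev C₂)
  common : ∀ {E A B} → HasTy E t (A ⊸ B) → HasTy E s A →
    ∃[ τ ] (sub τ (ren ev C₁) ≡ sub τ (C₂′ ⊸ α) × (∀ {x} → x ∈ FV t ++ FV s → sub τ (E₁₂ x) ≡ E x) × sub τ α ≡ B)
  common {E} {A} {B} d e with u₁ d | u₂ e
  ... | θ₁ , p₁ , q₁ | θ₂ , p₂ , q₂ = τ , trans (trans (ren-ev θ₁ υ C₁) p₁) (sym (cong₂ _⊸_ (trans (on₂ C₂) p₂) refl)) ,
      glue-univ {E = E} dj (λ {x} p → trans (ren-ev θ₁ υ (E₁ x)) (q₁ p)) (λ {x} p → trans (on₂ (E₂ x)) (q₂ p)) , refl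
    where
    υ = interleave θ₂ (λ _ → B)
    τ = interleave θ₁ υ
    on₂ : ∀ C → sub τ (ren od (ren ev C)) ≡ sub θ₂ C
    on₂ C = trans (ren-od θ₁ υ (ren ev C)) (ren-ev θ₂ (λ _ → B) C)
  M = mgu (ren ev C₁) (C₂′ ⊸ α) (proj₁ (common d₀ e₀)) (proj₁ (proj₂ (common d₀ e₀)))
  θ = proj₁ M
  eq = proj₁ (proj₂ M)
  most = proj₂ (proj₂ M)
principalType (ƛ x ⇒ t) (l , x∈) (lam d₀) with principalType t l d₀
... | principal E₁ C₁ h₁ u₁ = principal E₁ (E₁ x ⊸ C₁) (lam (HasTy-ext (λ _ → upd-self {E₁} refl) h₁))
  λ { {E} (lam {A = A} d) → let θ , p , q = u₁ d in θ , cong₂ _⊸_ (trans (q x∈) (upd-≡ E x A)) p ,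
      λ z∈ → let z∈′ , n = ∈-remove⁻ (FV t) z∈ in trans (q z∈′) (upd-≢ E x A n) }
principalType ⟨ t , s ⟩ (l , m , dj) (pair d₀ e₀) with principalType t l d₀ | principalType s m e₀
... | principal E₁ C₁ h₁ u₁ | principal E₂ C₂ h₂ u₂ =
  principal (glue (FV t) (ren ev ∘ E₁) (ren od ∘ E₂)) (ren ev C₁ ⊗ ren od C₂)
    (pair (HasTy-glueˡ (HasTy-sub (tv ∘ ev) h₁)) (HasTy-glueʳ dj (HasTy-sub (tv ∘ od) h₂)))
    λ { {E} (pair d e) → let θ₁ , p₁ , q₁ = u₁ d ; θ₂ , p₂ , q₂ = u₂ e in
        interleave θ₁ θ₂ , cong₂ _⊗_ (trans (ren-ev θ₁ θ₂ C₁) p₁) (trans (ren-od θ₁ θ₂ C₂) p₂) ,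
        glue-univ {E = E} dj (λ {x} p → trans (ren-ev θ₁ θ₂ (E₁ x)) (q₁ p)) (λ {x} p → trans (ren-od θ₁ θ₂ (E₂ x)) (q₂ p)) }
principalType (let⊗ x y s t) (m , l , x≢y , x∈ , y∈ , dj) (letp d₀ e₀) with principalType s m d₀ | principalType t l e₀
... | principal E₁ C₁ h₁ u₁ | principal E₂ C₂ h₂ u₂ =
  principal (sub θ ∘ E₁₂) (sub θ (ren od C₂))
    (letp (≡.subst (HasTy _ s) eq (HasTy-sub θ (HasTy-glueˡ (HasTy-sub (tv ∘ ev) h₁))))
      (HasTy-ext ext (HasTy-sub θ (HasTy-sub (tv ∘ od) h₂))))
    λ { (letp d e) → let τ , e₁ , k , b = common d e in τ , trans (most τ e₁ (ren od C₂)) b , λ p → trans (most τ e₁ (E₁₂ _)) (k p) }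
  where
  R = remove x (remove y (FV t))
  E₂′ = ren od ∘ E₂
  E₁₂ = glue (FV s) (ren ev ∘ E₁) E₂′
  T₂ = E₂′ x ⊗ E₂′ y
  common : ∀ {E A B C} → HasTy E s (A ⊗ B) → HasTy (upd (upd E y B) x A) t C →
    ∃[ τ ] (sub τ (ren ev C₁) ≡ sub τ T₂ × (∀ {z} → z ∈ FV s ++ R → sub τ (E₁₂ z) ≡ E z) × sub τ (ren od C₂) ≡ C)
  common {E} {A} {B} d e with u₁ d | u₂ e
  ... | θ₁ , p₁ , q₁ | θ₂ , p₂ , q₂ = interleave θ₁ θ₂ ,
      trans (trans (ren-ev θ₁ θ₂ C₁) p₁) (sym (cong₂ _⊗_
        (trans (ren-od θ₁ θ₂ (E₂ x)) (trans (q₂ x∈) (upd-≡ (upd E y B) x A)))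
        (trans (ren-od θ₁ θ₂ (E₂ y)) (trans (q₂ y∈) (trans (upd-≢ (upd E y B) x A (λ e → x≢y (sym e))) (upd-≡ E y B)))))) ,
      glue-univ {E = E} dj (λ {z} p → trans (ren-ev θ₁ θ₂ (E₁ z)) (q₁ p))
        (λ {z} p → let z∈ , n , k = ∈-remove₂⁻ (FV t) p in
          trans (ren-od θ₁ θ₂ (E₂ z)) (trans (q₂ z∈) (trans (upd-≢ (upd E y B) x A n) (upd-≢ E y B k)))) ,
      trans (ren-od θ₁ θ₂ C₂) p₂
  M = mgu (ren ev C₁) T₂ (proj₁ (common d₀ e₀)) (proj₁ (proj₂ (common d₀ e₀)))
  θ = proj₁ M
  eq = proj₁ (proj₂ M)
  most = proj₂ (proj₂ M)
  ext : ∀ {z} → z ∈ FV t → sub θ (E₂′ z) ≡ upd (upd (sub θ ∘ E₁₂) y (sub θ (E₂′ y))) x (sub θ (E₂′ x)) z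
  ext {z} z∈ with z ≟ x
  ... | yes refl = refl
  ... | no n with z ≟ y
  ...   | yes refl = refl
  ...   | no k = sym (cong (sub θ) (glue-∉ (λ p → dj p (∈-remove₂⁺ z∈ n k))))

-- Type substitution and poly-typability

subΓ : TySub → Ctx → Ctx
subΓ θ = map (λ (x , A) → x , sub θ A)

names-sub : ∀ θ Γ → names (subΓ θ Γ) ≡ names Γ
names-sub θ [] = refl
names-sub θ (_ ∷ Γ) = cong (_ ∷_) (names-sub θ Γ)

subΓ-Unique : ∀ θ Γ Δ → Unique (names (Γ ++ Δ)) → Unique (names (subΓ θ Γ ++ subΓ θ Δ))
subΓ-Unique θ Γ Δ = ≡.subst Unique (trans (sym (names-sub θ (Γ ++ Δ))) (cong names (map-++ _ Γ Δ)))

⊢-sub : ∀ {Γ t A} θ → Γ ⊢ t ∶ A → subΓ θ Γ ⊢ t ∶ sub θ A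
⊢-sub θ ax = ax
⊢-sub {t = t} {C} θ (exch Γ Δ d) = ≡.subst (λ Ξ → Ξ ⊢ t ∶ sub θ C) (sym (map-++ _ Γ _))
  (exch (subΓ θ Γ) (subΓ θ Δ) (≡.subst (λ Ξ → Ξ ⊢ t ∶ sub θ C) (map-++ _ Γ _) (⊢-sub θ d)))
⊢-sub θ (lam d) = lam (⊢-sub θ d)
⊢-sub {t = t} {C} θ (app {Γ} {Δ} d e u) = ≡.subst (λ Ξ → Ξ ⊢ t ∶ sub θ C) (sym (map-++ _ Γ Δ))
  (app (⊢-sub θ d) (⊢-sub θ e) (subΓ-Unique θ Γ Δ u))
⊢-sub {t = t} {C} θ (pair {Γ} {Δ} d e u) = ≡.subst (λ Ξ → Ξ ⊢ t ∶ sub θ C) (sym (map-++ _ Γ Δ))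
  (pair (⊢-sub θ d) (⊢-sub θ e) (subΓ-Unique θ Γ Δ u))
⊢-sub {t = t} {C} θ (letp {Γ} {Δ} d e u) = ≡.subst (λ Ξ → Ξ ⊢ t ∶ sub θ C) (sym (map-++ _ Γ Δ))
  (letp (⊢-sub θ d) (⊢-sub θ e) (subΓ-Unique θ Γ Δ u))

≈-sub : ∀ {Γ t s A} θ → Γ ⊢ t ≈ s ∶ A → subΓ θ Γ ⊢ t ≈ s ∶ sub θ A
≈-sub θ (≈ax d e r) = ≈ax (⊢-sub θ d) (⊢-sub θ e) r
≈-sub θ (≈refl d) = ≈refl (⊢-sub θ d)
≈-sub θ (≈sym e) = ≈sym (≈-sub θ e)
≈-sub θ (≈trans e f) = ≈trans (≈-sub θ e) (≈-sub θ f)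
≈-sub {t = t} {s} {C} θ (≈exch Γ Δ e) = ≡.subst (λ Ξ → Ξ ⊢ t ≈ s ∶ sub θ C) (sym (map-++ _ Γ _))
  (≈exch (subΓ θ Γ) (subΓ θ Δ) (≡.subst (λ Ξ → Ξ ⊢ t ≈ s ∶ sub θ C) (map-++ _ Γ _) (≈-sub θ e)))
≈-sub θ (≈lam e) = ≈lam (≈-sub θ e)
≈-sub {t = t} {s} {C} θ (≈app {Γ} {Δ} e f u) = ≡.subst (λ Ξ → Ξ ⊢ t ≈ s ∶ sub θ C) (sym (map-++ _ Γ Δ))
  (≈app (≈-sub θ e) (≈-sub θ f) (subΓ-Unique θ Γ Δ u))
≈-sub {t = t} {s} {C} θ (≈pair {Γ} {Δ} e f u) = ≡.subst (λ Ξ → Ξ ⊢ t ≈ s ∶ sub θ C) (sym (map-++ _ Γ Δ))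
  (≈pair (≈-sub θ e) (≈-sub θ f) (subΓ-Unique θ Γ Δ u))
≈-sub {t = t} {s} {C} θ (≈let {Γ} {Δ} e f u) = ≡.subst (λ Ξ → Ξ ⊢ t ≈ s ∶ sub θ C) (sym (map-++ _ Γ Δ))
  (≈let (≈-sub θ e) (≈-sub θ f) (subΓ-Unique θ Γ Δ u))

hasPT : ∀ {Γ t A} → Γ ⊢ t ∶ A → ∃[ P ] IsPT t P
hasPT {Γ} {t} d with principalType t (⊢-Lin d) (⊢⇒HasTy d (Agrees-envOf Γ (⊢-Unique d)))
... | principal E P h u = P , (_ , HasTy⇒⊢ t (⊢-Lin d) h) , λ Γ′ A′ d′ →
  let θ , e , _ = u (⊢⇒HasTy d′ (Agrees-envOf Γ′ (⊢-Unique d′))) in θ , e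

IsPT-ev : ∀ {t P} → IsPT t P → IsPT t (ren ev P)
IsPT-ev {P = P} ((Γ , d) , u) = (_ , ⊢-sub (tv ∘ ev) d) , λ Γ′ A′ d′ →
  let θ , e = u Γ′ A′ d′ in interleave θ θ , trans (ren-ev θ θ P) e

IsPT-od : ∀ {t P} → IsPT t P → IsPT t (ren od P)
IsPT-od {P = P} ((Γ , d) , u) = (_ , ⊢-sub (tv ∘ od) d) , λ Γ′ A′ d′ →
  let θ , e = u Γ′ A′ d′ in interleave θ θ , trans (ren-od θ θ P) e

-- Principal types can be given disjoint variables, so any typing of the
-- application t s r shows poly-typability.
typable⇒poly₂ : ∀ {t s r A A₀ B} → [] ⊢ t · s · r ∶ B → [] ⊢ s ∶ A → [] ⊢ r ∶ A₀ → PolyTypable₂ t A A₀ B s r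
typable⇒poly₂ {t} {s} {r} {B = B} d ds dr with inv-app d
... | Γ₁₂ , Γ₃ , C₂ , p , u , d₁₂ , d₃ with inv-app d₁₂
...   | Γ₁ , Γ₂ , C₁ , p′ , u′ , d₁ , d₂ with hasPT d₁ | hasPT ds | hasPT dr
...     | P , hP | Q₁ , h₁ | Q₂ , h₂ with proj₂ hP _ _ d₁ | proj₂ h₁ _ _ d₂ | proj₂ h₂ _ _ d₃
...       | θ , e | θ₁ , e₁ | θ₂ , e₂ = (C₁ , C₂ , B , dt) , ds , dr ,
  ren ev P , ren od (ren ev Q₁) , ren od (ren od Q₂) , interleave θ υ ,
  IsPT-ev hP , IsPT-od (IsPT-ev h₁) , IsPT-od (IsPT-od h₂) ,
  trans (ren-ev θ υ P) (trans e (sym (cong₂ _⊸_ (trans (ren-od θ υ (ren ev Q₁)) (trans (ren-ev θ₁ θ₂ Q₁) e₁))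
    (cong₂ _⊸_ (trans (ren-od θ υ (ren od Q₂)) (trans (ren-od θ₁ θ₂ Q₂) e₂)) refl))))
  where
  υ = interleave θ₁ θ₂
  empty : ∀ {Γ Δ : Ctx} → Γ ++ Δ ≡ [] → Γ ≡ []
  empty {[]} _ = refl
  dt : [] ⊢ t ∶ C₁ ⊸ C₂ ⊸ B
  dt = ≡.subst (λ Γ → Γ ⊢ t ∶ C₁ ⊸ C₂ ⊸ B)
    (empty (↭.↭-empty-inv (≡.subst (Γ₁ ++ Γ₂ ↭_) (empty (↭.↭-empty-inv p)) p′))) d₁

closed⇒[] : ∀ {Γ t A} → Γ ⊢ t ∶ A → Closed t → [] ⊢ t ∶ A
closed⇒[] {[]} d c = d
closed⇒[] {(x , _) ∷ Γ} d c = ⊥-elim (proj₂ c (∈-resp-↭ (↭-sym (proj₂ (names-FV d))) (here refl)))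

poly₁⇒typable : ∀ {t s A B} → PolyTypable₁ t A B s → [] ⊢ t · s ∶ B
poly₁⇒typable ((_ , _ , dt) , ds , P , Q , θ , ((_ , hP) , _) , ((_ , hQ) , _) , e) =
  app (≡.subst ([] ⊢ _ ∶_) e (⊢-sub θ (closed⇒[] hP (⊢⇒Closed dt)))) (⊢-sub θ (closed⇒[] hQ (⊢⇒Closed ds))) []

-- The separating test and the selector

separate : ∀ {A s s′} → [] ⊢ s ∶ A → [] ⊢ s′ ∶ A → ¬ (s ≈βηc s′ ∶ A) →
  ∃[ T ] (Closed T × Act true (T · s) × Act false (T · s′))
separate {A} {s} {s′} d d′ n with relabel A
... | A⁰ , ρ , e , k with label {ρ} {C⁰ = A⁰} (fundamental d) [] e | label {ρ} {C⁰ = A⁰} (fundamental d′) [] e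
...   | .[] , A₁ , [] , p , d₁ | .[] , A₂ , [] , q , d₂ with A₁ ≟ᵗ A₂
...     | no A₁≢A₂ = separator (Agree-trans (Agree-sym p) q) A₁≢A₂ d₁ d₂
-- `ρ` sends the common relabelled type back to `A`, so the equality given by `coherence` descends
-- to `A` by type substitution.
...     | yes refl = ⊥-elim (n (≡.subst (s ≈βηc s′ ∶_) (trans (sym (Agree-ren p)) e)
            (≈-sub (tv ∘ ρ) (coherence (fundamental d₁) d₂ bound))))
  where
  bound : ∀ m → occS true m [] A₁ ≤ 1
  -- Balance turns outputs into inputs; the inputs of `A₁` are those of `A⁰`, where every variable
  -- occurs at most once.
  bound m = ≤1-≡ (trans (Agree-occ p m) (sym (balanced (fundamental d₁) m)))
    (ℕ.≤-trans (occ≤tot false m A⁰) (k m))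

module Selector {T u₁ u₂ E r₀ : Tm} (cT : Closed T) (c₁ : Closed u₁) (c₂ : Closed u₂) (cE : Closed E) (c₀ : Closed r₀) where

  σ : Subst
  -- The names 10 to 14 stand for the closed parameters and lie clear of the names 0 to 5 bound in
  -- the template, whose linearity is then decided by `lin`.
  σ = (10 , T) ∷ (11 , u₁) ∷ (12 , u₂) ∷ (13 , E) ∷ (14 , r₀) ∷ []

  cσ : ClosedS σ
  cσ = closedS-∷ 10 cT (closedS-∷ 11 c₁ (closedS-∷ 12 c₂ (closedS-∷ 13 cE (closedS-∷ 14 {r₀} {[]} c₀ closed-[]))))

  scrutinee clean body : Tm
  scrutinee = (` 10 · ` 0) · ⟨ ` 12 , ` 11 ⟩
  -- The eraser turns the unselected application into an identity action. Running that action on the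
  -- wanted result paired with `I` uses it up, and `I` is used up by applying it to the result.
  clean = let⊗ 4 5 ((` 13 · (` 3 · ` 14)) · ⟨ ` 2 · ` 1 , I ⟩) (` 5 · ` 4)
  body = let⊗ 2 3 scrutinee clean

  -- T · s selects one of u₁ and u₂; the other one is applied to r₀ and erased
  -- at the type B.
  select : Tm
  select = subst σ (ƛ 0 ⇒ (ƛ 1 ⇒ body))

  select-⊒ : ∀ {s r u u′} → Closed s → Closed r → Closed u → Closed u′ →
    (T · s) · ⟨ u₂ , u₁ ⟩ ⊒ ⟨ u , u′ ⟩ → Act false (E · (u′ · r₀)) → select · s · r ⊒ u · r
  select-⊒ {s} {r} {u} {u′} cs cr cu cu′ e (_ , f) =

        select · s · r ⊒⟨ ⊒-appˡ (proj₁ (eval-λ σ (ƛ 1 ⇒ body) cσ (lin (ƛ 0 ⇒ (ƛ 1 ⇒ body))) cs)) ⟩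
        subst σ₀ (ƛ 1 ⇒ body) · r ⊒⟨ proj₁ (eval-λ σ₀ body cσ₀ (lin (ƛ 1 ⇒ body)) cr) ⟩
        subst σ₁ body ⊒⟨ eval-let σ₁ scrutinee clean cσ₁ (lin body) cu cu′ e ⟩
        subst σ₂ clean ⊒⟨ eval-let σ₂ ((` 13 · (` 3 · ` 14)) · ⟨ ` 2 · ` 1 , I ⟩) (` 5 · ` 4) cσ₂ (lin clean) cur closed-I (f cur closed-I) ⟩
        I · (u · r) ⊒⟨ proj₁ (I≋ (proj₁ cur)) ⟩
        u · r ∎⊒
    where
    cur : Closed (u · r)
    cur = closed-· {u} {r} cu cr
    σ₀ σ₁ σ₂ : Subst
    σ₀ = (0 , s) ∷ σ
    σ₁ = (1 , r) ∷ σ₀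
    σ₂ = (3 , u′) ∷ (2 , u) ∷ σ₁
    cσ₀ : ClosedS σ₀
    cσ₀ = closedS-∷ 0 {s} {σ} cs cσ
    cσ₁ : ClosedS σ₁
    cσ₁ = closedS-∷ 1 {r} {σ₀} cr cσ₀
    cσ₂ : ClosedS σ₂
    cσ₂ = closedS-∷ 3 {u′} cu′ (closedS-∷ 2 {u} {σ₁} cu cσ₁)

theorem2 : ∀ (A A₀ B : Ty) (s₁ s₂ r₁ r₂ u₁ u₂ : Tm) →
    [] ⊢ s₁ ∶ A → [] ⊢ s₂ ∶ A → ¬ (s₁ ≈βηc s₂ ∶ A) →
    [] ⊢ r₁ ∶ A₀ → [] ⊢ r₂ ∶ A₀ →
    u₁ ≢ u₂ →
    PolyTypable₁ u₁ A₀ B r₁ → PolyTypable₁ u₁ A₀ B r₂ →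
    PolyTypable₁ u₂ A₀ B r₁ → PolyTypable₁ u₂ A₀ B r₂ →
    (∃[ v ] ∃[ w ]
    (((u₁ · r₁ ≈βηc v ∶ B) ⊎ (u₁ · r₁ ≈βηc w ∶ B)) ×
    ((u₁ · r₂ ≈βηc v ∶ B) ⊎ (u₁ · r₂ ≈βηc w ∶ B)) ×
    ((u₂ · r₁ ≈βηc v ∶ B) ⊎ (u₂ · r₁ ≈βηc w ∶ B)) ×
    ((u₂ · r₂ ≈βηc v ∶ B) ⊎ (u₂ · r₂ ≈βηc w ∶ B)))) →
    ∃[ t ]
    (PolyTypable₂ t A A₀ B s₁ r₁ × PolyTypable₂ t A A₀ B s₁ r₂ ×
    PolyTypable₂ t A A₀ B s₂ r₁ × PolyTypable₂ t A A₀ B s₂ r₂ ×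
    (t · s₁ · r₁ ≈βηc u₁ · r₁ ∶ B) × (t · s₁ · r₂ ≈βηc u₁ · r₂ ∶ B) ×
    (t · s₂ · r₁ ≈βηc u₂ · r₁ ∶ B) × (t · s₂ · r₂ ≈βηc u₂ · r₂ ∶ B))
theorem2 A A₀ B s₁ s₂ r₁ r₂ u₁ u₂ ds₁ ds₂ s₁≉s₂ dr₁ dr₂ _ p₁₁ p₁₂ p₂₁ p₂₂ _
  with separate ds₁ ds₂ s₁≉s₂ | eraser B
... | T , cT , act₁ , act₂ | E , cE , erase =
  select , poly₂ ds₁ dr₁ e₁₁ , poly₂ ds₁ dr₂ e₁₂ , poly₂ ds₂ dr₁ e₂₁ , poly₂ ds₂ dr₂ e₂₂ , e₁₁ , e₁₂ , e₂₁ , e₂₂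
  where
  c₁ : Closed u₁
  c₁ = ⊢⇒Closed (proj₂ (proj₂ (proj₁ p₁₁)))
  c₂ : Closed u₂
  c₂ = ⊢⇒Closed (proj₂ (proj₂ (proj₁ p₂₁)))
  -- `r₁` is the dummy argument of the unselected function: both `u₁ · r₁` and `u₂ · r₁` have type
  -- `B`, so the same eraser handles either of them.
  open Selector {T} {u₁} {u₂} {E} {r₁} cT c₁ c₂ cE (⊢⇒Closed dr₁)
  first : ∀ {r} → [] ⊢ r ∶ A₀ → PolyTypable₁ u₁ A₀ B r → select · s₁ · r ≈βηc u₁ · r ∶ B
  first dr p = select-⊒ (⊢⇒Closed ds₁) (⊢⇒Closed dr) c₁ c₂ (proj₂ act₁ c₂ c₁) (erase (poly₁⇒typable p₂₁)) (poly₁⇒typable p)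
  second : ∀ {r} → [] ⊢ r ∶ A₀ → PolyTypable₁ u₂ A₀ B r → select · s₂ · r ≈βηc u₂ · r ∶ B
  second dr p = select-⊒ (⊢⇒Closed ds₂) (⊢⇒Closed dr) c₂ c₁ (proj₂ act₂ c₂ c₁) (erase (poly₁⇒typable p₁₁)) (poly₁⇒typable p)
  e₁₁ = first dr₁ p₁₁
  e₁₂ = first dr₂ p₁₂
  e₂₁ = second dr₁ p₂₁
  e₂₂ = second dr₂ p₂₂
  poly₂ : ∀ {s r u} → [] ⊢ s ∶ A → [] ⊢ r ∶ A₀ → select · s · r ≈βηc u ∶ B → PolyTypable₂ select A A₀ B s r
  poly₂ ds dr e = typable⇒poly₂ (≈⇒ˡ e) ds dr
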